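{- Let $q$ be a prime power with $q\equiv1\pmod4$, $n$ an odd prime, $Q=\frac{q^n-1}{q-1}$ and $\beta\in\mathbb{F}_q^*$. Write the product of the distinct primes dividing $q^n-1$ as $k p_1\cdots p_s$ with $s\ge0$ and $p_1,\dots,p_s$ distinct primes (not dividing $k$), ordered so that $p_i\mid Q$ for $1\le i\le r$ and $p_i\nmid Q$ for $r<i\le s$. Let $\delta=1-\sum_{i=1}^s\frac1{p_i}$, $\delta_Q=1-\sum_{i=1}^r\frac1{p_i}$, and $k_Q$ the product of the primes dividing $k$ which divide $Q$. Assume $\delta>0$ and $$q^{\frac{n-1}{2}}>2\sqrt2\left(\frac{s-1}{\delta}+2\right)W(k)-\sqrt2\left(\frac{r-1+\delta_Q}{\delta}+1\right)W(k_Q).$$ Then $\mathcal{N}_\beta(q^n-1)>0$.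
   Context: For a divisor $m$ of $q^n-1$, $\xi\in\mathbb{F}_{q^n}^*$ is $m$-free if $\xi=\zeta^d$ with $d\mid m$, $\zeta\in\mathbb{F}_{q^n}^*$ implies $d=1$. $\mathcal{N}_\beta(m)$ is the number of $m$-free $\xi\in\mathbb{F}_{q^n}^*$ with $\mathrm{Tr}(\xi^2)=\beta$, where $\mathrm{Tr}:\mathbb{F}_{q^n}\to\mathbb{F}_q$ is the trace. $W(m)=2^{\nu(m)}$ with $\nu(m)$ the number of distinct prime divisors of $m$. -}

module Defs where

open import Level using (_⊔_)
open import Data.Nat.ListAction using (product)
open import Algebra.Bundles using (CommutativeRing)
open import Data.Nat as ℕ using (ℕ; zero; suc)
open import Data.Nat.Divisibility using (_∣_; _∣?_)
open import Data.Nat.Primality using (prime?)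
open import Data.Integer using (+_)
open import Data.Rational as ℚ using (ℚ; 0ℚ)
open import Data.Fin using (Fin)
open import Data.Vec using (Vec; lookup)
open import Data.List using (List; []; _∷_; filter; length; upTo)
open import Data.Product using (Σ; ∃; _×_; _,_)
open import Data.Sum using (_⊎_)
open import Relation.Nullary using (¬_)
open import Relation.Nullary.Decidable using (_×-dec_)
open import Relation.Binary.PropositionalEquality using (_≡_)

-- the list of distinct primes dividing m (for m ≥ 1), in increasing order
primesDividing : ℕ → List ℕ
primesDividing m = filter (λ p → prime? p ×-dec p ∣? m) (upTo (suc m))

ν : ℕ → ℕ
ν m = length (primesDividing m)

W : ℕ → ℕ
W m = 2 ℕ.^ ν m

rad : ℕ → ℕ
rad m = product (primesDividing m)

primePartIn : ℕ → ℕ → ℕ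
primePartIn k Q = product (filter (λ p → p ∣? Q) (primesDividing k))

-- 1/p as a rational (the value at 0 is irrelevant: only used for primes)
recip : ℕ → ℚ
recip zero    = 0ℚ
recip (suc m) = + 1 ℚ./ suc m

sumRecip : List ℕ → ℚ
sumRecip []       = 0ℚ
sumRecip (p ∷ ps) = recip p ℚ.+ sumRecip ps

-- "L > √2 · T" for a rational L > 0, expressed without reals:
-- for L > 0 this holds iff T ≤ 0 or 2·T² < L².
-- (Only used with L = q^((n-1)/2) > 0.)
GtSqrt2Times : ℚ → ℚ → Set
GtSqrt2Times L T = (T ℚ.≤ 0ℚ) ⊎ ((ℚ.1ℚ ℚ.+ ℚ.1ℚ) ℚ.* (T ℚ.* T) ℚ.< L ℚ.* L)

module _ {c ℓ} (F : CommutativeRing c ℓ) where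
  open CommutativeRing F

  pow : Carrier → ℕ → Carrier
  pow x zero    = 1#
  pow x (suc k) = x * pow x k

  record IsFiniteFieldOfSize (N : ℕ) : Set (c ⊔ ℓ) where
    field
      nontrivial : ¬ (0# ≈ 1#)
      inverse    : ∀ x → ¬ (x ≈ 0#) → Σ Carrier (λ y → x * y ≈ 1#)
      enum       : Vec Carrier N
      enum-onto  : ∀ x → Σ (Fin N) (λ i → lookup enum i ≈ x)
      enum-inj   : ∀ i j → lookup enum i ≈ lookup enum j → i ≡ j

  -- the subfield F_q = {x | x^q = x}
  InSubfield : ℕ → Carrier → Set ℓ
  InSubfield q x = pow x q ≈ x

  Tr : ℕ → ℕ → Carrier → Carrier
  Tr q zero    x = 0#
  Tr q (suc i) x = pow x (q ℕ.^ i) + Tr q i x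

  Free : ℕ → Carrier → Set (c ⊔ ℓ)
  Free m ξ = ¬ (ξ ≈ 0#) ×
             (∀ (d : ℕ) (ζ : Carrier) → d ∣ m → ¬ (ζ ≈ 0#) → ξ ≈ pow ζ d → d ≡ 1)

{-# OPTIONS --safe #-}
-- Write the nonzero elements of F as powers of a generator g, so that g ^ a is free exactly when no
-- prime l dividing N = q ^ n - 1 divides a.  The sum of the characters of order l is the integer
-- valued function c_l (a) = l [l ∣ a] - 1, and products of these give the sums c_d of the characters of
-- squarefree order d.  No Gauss sums are needed: c_d (x / y) is a positive semidefinite kernel, so by
-- Cauchy-Schwarz the square of the sum of c_d over {Tr x = β} is at most c_d (1) times the sum of
-- c_d (x / y) over {Tr x = Tr y = β}.  That second moment does not depend on β ≠ 0, and summed over all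
-- common trace values it is computed exactly from the size of the kernel of the trace.  This gives
-- φ(d) q ^ ((n-1)/2) in general and φ(d) q ^ (n/2-1) when d ∣ Q.  Substituting x = ξ² turns sums over ξ
-- of c_d into such sums, with c_d + c_2d for odd d and c_2d for even d.  The prime sieve then yields
--   δ q ^ ((n-1)/2) ≤ 2 W(k) (δ + E) - (1 - q^(-1/2)) W(k_Q) (δ + E₁),   E = Σ (1 - 1/pᵢ),  E₁ its part over pᵢ ∣ Q,
-- if there is no solution, contradicting the hypothesis when q ≥ 9.  For q = 5 we have 1 + 5^(-1/2) > √2,
-- but then 2 is the only prime dividing N and not Q; either 2 ∣ k, or 2 is a sieving prime and the
-- hypothesis still suffices for r ≤ 10, while for r ≥ 11 every prime dividing Q is 1 modulo 2n, which
-- makes q ^ ((n-1)/2) so large that the sieve succeeds unconditionally.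
module Submission where

-- The estimates stay inside ℤ and ℚ: √2 is bounded below by 141/100 and q^(-1/2) above by a
-- fraction u / v. Functions on the multiplicative group are functions of the exponent of a
-- generator, with period N, so multiplying by a fixed element becomes shifting an index. Where the
-- condition on q comes from: put P = q^((n-1)/2), Y = δ + E₁, let W′ be 2 to the number of primes
-- dividing both k and Q, and T₁ = 2 W(k) (δ + E) - W′ Y. The sieve gives δ P ≤ T₁ + q^(-1/2) W′ Y,
-- the hypothesis gives δ P > √2 T₁. Since T₁ ≥ W′ Y, these collide as soon as q^(-1/2) ≤ √2 - 1,
-- that is for q ≥ 6. For q = 5 a better lower bound for T₁ is required, and the prime 2, which does
-- not divide Q, provides it. If 2 divides k, then W(k) ≥ 2 W′ and T₁ ≥ 3 W′ Y. If 2 is sieved, its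
-- share 1/2 of E gives only T₁ ≥ W′ (Y + 1); this gain is fixed while Y grows with r, and it is too
-- small once Y approaches 11. Hence the separate treatment of r ≥ 11.

-- Finite sums of integers over initial segments of ℕ.

module RangeSums where
  open import Data.Nat as ℕ using (ℕ; zero; suc)
  import Data.Nat.Properties as ℕ
  open import Data.Integer using (ℤ; +_; -[1+_]; -_; _+_; _-_; _*_; _≤_; 0ℤ; 1ℤ; +≤+)
  import Data.Integer.Properties as ℤ
  open import Algebra.Properties.AbelianGroup ℤ.+-0-abelianGroup using () renaming (∙-cancelʳ to +-cancelʳ)
  open import Data.Integer.Tactic.RingSolver using (solve-∀)
  open import Data.Empty using (⊥-elim)
  open import Relation.Nullary using (¬_; Dec; yes; no)
  open import Relation.Binary.PropositionalEquality using (_≡_; _≢_; refl; sym; trans; cong; cong₂; subst; module ≡-Reasoning)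

  𝟙 : ∀ {p} {P : Set p} → Dec P → ℤ
  𝟙 (yes _) = 1ℤ
  𝟙 (no _)  = 0ℤ

  𝟙-yes : ∀ {p} {P : Set p} (d : Dec P) → P → 𝟙 d ≡ 1ℤ
  𝟙-yes (yes _) _ = refl
  𝟙-yes (no ¬p) p = ⊥-elim (¬p p)

  𝟙-no : ∀ {p} {P : Set p} (d : Dec P) → ¬ P → 𝟙 d ≡ 0ℤ
  𝟙-no (yes p) ¬p = ⊥-elim (¬p p)
  𝟙-no (no _)  _  = refl

  𝟙-cong : ∀ {p p′} {P : Set p} {P′ : Set p′} (d : Dec P) (d′ : Dec P′) → (P → P′) → (P′ → P) → 𝟙 d ≡ 𝟙 d′
  𝟙-cong (yes p) d′ f g = sym (𝟙-yes d′ (f p))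
  𝟙-cong (no ¬p) d′ f g = sym (𝟙-no d′ λ p′ → ¬p (g p′))

  𝟙-nonNeg : ∀ {p} {P : Set p} (d : Dec P) → 0ℤ ≤ 𝟙 d
  𝟙-nonNeg (yes _) = +≤+ ℕ.z≤n
  𝟙-nonNeg (no _)  = +≤+ ℕ.z≤n

  ∑ : ℕ → (ℕ → ℤ) → ℤ
  ∑ zero    f = 0ℤ
  ∑ (suc n) f = ∑ n f + f n

  ∑-cong< : ∀ n {f h : ℕ → ℤ} → (∀ i → i ℕ.< n → f i ≡ h i) → ∑ n f ≡ ∑ n h
  ∑-cong< zero    _ = refl
  ∑-cong< (suc n) e = cong₂ _+_ (∑-cong< n λ i i<n → e i (ℕ.m<n⇒m<1+n i<n)) (e n ℕ.≤-refl)

  ∑-cong : ∀ n {f h : ℕ → ℤ} → (∀ i → f i ≡ h i) → ∑ n f ≡ ∑ n h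
  ∑-cong n e = ∑-cong< n λ i _ → e i

  ∑-+ : ∀ n (f h : ℕ → ℤ) → ∑ n (λ i → f i + h i) ≡ ∑ n f + ∑ n h
  ∑-+ zero    f h = refl
  ∑-+ (suc n) f h rewrite ∑-+ n f h = interchange (∑ n f) (∑ n h) (f n) (h n)
    where
    interchange : ∀ a b c d → (a + b) + (c + d) ≡ (a + c) + (b + d)
    interchange = solve-∀

  ∑-*ˡ : ∀ n c (f : ℕ → ℤ) → ∑ n (λ i → c * f i) ≡ c * ∑ n f
  ∑-*ˡ zero    c f = sym (ℤ.*-zeroʳ c)
  ∑-*ˡ (suc n) c f rewrite ∑-*ˡ n c f = sym (ℤ.*-distribˡ-+ c (∑ n f) (f n))

  ∑-*ʳ : ∀ n c (f : ℕ → ℤ) → ∑ n (λ i → f i * c) ≡ ∑ n f * c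
  ∑-*ʳ n c f = trans (∑-cong n λ i → ℤ.*-comm (f i) c) (trans (∑-*ˡ n c f) (ℤ.*-comm c _))

  ∑-const : ∀ n c → ∑ n (λ _ → c) ≡ + n * c
  ∑-const zero    c = sym (ℤ.*-zeroˡ c)
  ∑-const (suc n) c rewrite ∑-const n c | ℤ.pos-+ 1 n = lemma (+ n) c
    where
    lemma : ∀ m c → m * c + c ≡ (1ℤ + m) * c
    lemma = solve-∀

  ∑-zero : ∀ n → ∑ n (λ _ → 0ℤ) ≡ 0ℤ
  ∑-zero n = trans (∑-const n 0ℤ) (ℤ.*-zeroʳ (+ n))

  ∑-swap : ∀ m n (f : ℕ → ℕ → ℤ) → ∑ m (λ i → ∑ n (f i)) ≡ ∑ n (λ j → ∑ m (λ i → f i j))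
  ∑-swap zero    n f = sym (∑-zero n)
  ∑-swap (suc m) n f rewrite ∑-swap m n f = sym (∑-+ n (λ j → ∑ m λ i → f i j) (f m))

  ∑-mono : ∀ n {f h : ℕ → ℤ} → (∀ i → i ℕ.< n → f i ≤ h i) → ∑ n f ≤ ∑ n h
  ∑-mono zero    _ = ℤ.≤-refl
  ∑-mono (suc n) e = ℤ.+-mono-≤ (∑-mono n λ i i<n → e i (ℕ.m<n⇒m<1+n i<n)) (e n ℕ.≤-refl)

  ∑-head : ∀ n (f : ℕ → ℤ) → ∑ (suc n) f ≡ f 0 + ∑ n (λ i → f (suc i))
  ∑-head zero    f = ℤ.+-comm 0ℤ (f 0)
  ∑-head (suc n) f rewrite ∑-head n f = ℤ.+-assoc (f 0) (∑ n λ i → f (suc i)) (f (suc n))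

  ∑-split : ∀ m n (f : ℕ → ℤ) → ∑ (m ℕ.+ n) f ≡ ∑ m f + ∑ n (λ i → f (m ℕ.+ i))
  ∑-split zero    n f = sym (ℤ.+-identityˡ _)
  ∑-split (suc m) n f = begin
    ∑ (suc m ℕ.+ n) f                                        ≡⟨ ∑-head (m ℕ.+ n) f ⟩
    f 0 + ∑ (m ℕ.+ n) (λ i → f (suc i))                      ≡⟨ cong (_+_ (f 0)) (∑-split m n (λ i → f (suc i))) ⟩
    f 0 + (∑ m (λ i → f (suc i)) + ∑ n (λ i → f (suc m ℕ.+ i))) ≡⟨ ℤ.+-assoc (f 0) _ _ ⟨
    f 0 + ∑ m (λ i → f (suc i)) + ∑ n (λ i → f (suc m ℕ.+ i))   ≡⟨ cong (_+ ∑ n (λ i → f (suc m ℕ.+ i))) (∑-head m f) ⟨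
    ∑ (suc m) f + ∑ n (λ i → f (suc m ℕ.+ i))                ∎
    where open ≡-Reasoning

  Periodic : ∀ {a} {A : Set a} → ℕ → (ℕ → A) → Set a
  Periodic n f = ∀ i → f (n ℕ.+ i) ≡ f i

  ∑-shift1 : ∀ n (f : ℕ → ℤ) → Periodic n f → ∑ n (λ i → f (suc i)) ≡ ∑ n f
  ∑-shift1 n f per = +-cancelʳ (f 0) _ _ (begin
    ∑ n (λ i → f (suc i)) + f 0 ≡⟨ ℤ.+-comm _ (f 0) ⟩
    f 0 + ∑ n (λ i → f (suc i)) ≡⟨ ∑-head n f ⟨
    ∑ n f + f n                 ≡⟨ cong (λ m → ∑ n f + f m) (ℕ.+-identityʳ n) ⟨
    ∑ n f + f (n ℕ.+ 0)         ≡⟨ cong (_+_ (∑ n f)) (per 0) ⟩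
    ∑ n f + f 0                 ∎)
    where open ≡-Reasoning

  -- With exponents of a generator as indices, this is the substitution x ↦ g^t x in a sum over the
  -- multiplicative group.
  ∑-shift : ∀ n t (f : ℕ → ℤ) → Periodic n f → ∑ n (λ i → f (t ℕ.+ i)) ≡ ∑ n f
  ∑-shift n zero    f per = refl
  ∑-shift n (suc t) f per =
    trans (∑-shift n t (λ i → f (suc i)) λ i → trans (cong f (sym (ℕ.+-suc n i))) (per (suc i)))
          (∑-shift1 n f per)

  ∑-blocks : ∀ s m (f : ℕ → ℤ) → Periodic m f → ∑ (s ℕ.* m) f ≡ + s * ∑ m f
  ∑-blocks zero    m f per = refl
  ∑-blocks (suc s) m f per = begin
    ∑ (m ℕ.+ s ℕ.* m) f                        ≡⟨ ∑-split m (s ℕ.* m) f ⟩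
    ∑ m f + ∑ (s ℕ.* m) (λ i → f (m ℕ.+ i))    ≡⟨ cong (_+_ (∑ m f)) (∑-cong (s ℕ.* m) per) ⟩
    ∑ m f + ∑ (s ℕ.* m) f                      ≡⟨ cong (_+_ (∑ m f)) (∑-blocks s m f per) ⟩
    ∑ m f + + s * ∑ m f                        ≡⟨ lemma (+ s) (∑ m f) ⟩
    (1ℤ + + s) * ∑ m f                         ≡⟨ cong (_* ∑ m f) (ℤ.pos-+ 1 s) ⟨
    + suc s * ∑ m f                            ∎
    where
    open ≡-Reasoning
    lemma : ∀ s x → x + s * x ≡ (1ℤ + s) * x
    lemma = solve-∀

  -- Separates even from odd exponents, that is squares from nonsquares.
  ∑-pairs : ∀ n (f : ℕ → ℤ) → ∑ (n ℕ.+ n) f ≡ ∑ n (λ i → f (i ℕ.+ i) + f (suc (i ℕ.+ i)))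
  ∑-pairs zero    f = refl
  ∑-pairs (suc n) f rewrite ℕ.+-suc n n | ∑-pairs n f = ℤ.+-assoc (∑ n λ i → f (i ℕ.+ i) + f (suc (i ℕ.+ i))) (f (n ℕ.+ n)) (f (suc (n ℕ.+ n)))

  ∑-single : ∀ n j → j ℕ.< n → (f : ℕ → ℤ) → (∀ i → i ℕ.< n → i ≢ j → f i ≡ 0ℤ) → ∑ n f ≡ f j
  ∑-single (suc n) j j<1+n f z with j ℕ.≟ n
  ... | yes refl = trans (cong (_+ f n) (trans (∑-cong< n λ i i<n → z i (ℕ.m<n⇒m<1+n i<n) (ℕ.<⇒≢ i<n)) (∑-zero n))) (ℤ.+-identityˡ (f n))
  ... | no j≢n = trans (cong₂ _+_ (∑-single n j (ℕ.≤∧≢⇒< (ℕ.≤-pred j<1+n) j≢n) f λ i i<n → z i (ℕ.m<n⇒m<1+n i<n)) (z n ℕ.≤-refl λ e → j≢n (sym e)))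
    (ℤ.+-identityʳ (f j))

  ∑-only-first : ∀ n (f : ℕ → ℤ) → (∀ i → suc i ℕ.< n → f (suc i) ≡ 0ℤ) → 0 ℕ.< n → ∑ n f ≡ f 0
  ∑-only-first n f z 0<n = ∑-single n 0 0<n f λ where
    zero    _   0≢0 → ⊥-elim (0≢0 refl)
    (suc i) i<n _   → z i i<n

  *-nonNeg : ∀ {i j} → 0ℤ ≤ i → 0ℤ ≤ j → 0ℤ ≤ i * j
  *-nonNeg {+ m} {+ n} _ _ = subst (0ℤ ≤_) (ℤ.pos-* m n) (+≤+ ℕ.z≤n)

  square-nonNeg : ∀ i → 0ℤ ≤ i * i
  square-nonNeg (+ m) = subst (0ℤ ≤_) (ℤ.pos-* m m) (+≤+ ℕ.z≤n)
  square-nonNeg (-[1+ m ]) = +≤+ ℕ.z≤n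

-- Positive semidefinite kernels and Cauchy-Schwarz.

module PositiveKernels where
  open RangeSums
  open import Data.Nat as ℕ using (ℕ)
  open import Data.Integer using (ℤ; +_; -_; _+_; _-_; _*_; _≤_; _<_; 0ℤ; 1ℤ; +<+; positive)
  import Data.Integer.Properties as ℤ
  open import Data.Integer.Tactic.RingSolver using (solve-∀)
  open import Data.List using (List; []; _∷_; _++_; map)
  open import Relation.Binary.PropositionalEquality using (_≡_; refl; sym; trans; cong; cong₂; subst; subst₂; module ≡-Reasoning)

  ∑L : ∀ {a} {A : Set a} → List A → (A → ℤ) → ℤ
  ∑L []       φ = 0ℤ
  ∑L (x ∷ xs) φ = φ x + ∑L xs φ

  ∑L-cong : ∀ {a} {A : Set a} (xs : List A) {φ ψ : A → ℤ} → (∀ x → φ x ≡ ψ x) → ∑L xs φ ≡ ∑L xs ψ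
  ∑L-cong []       e = refl
  ∑L-cong (x ∷ xs) e = cong₂ _+_ (e x) (∑L-cong xs e)

  ∑L-++ : ∀ {a} {A : Set a} (xs ys : List A) (φ : A → ℤ) → ∑L (xs ++ ys) φ ≡ ∑L xs φ + ∑L ys φ
  ∑L-++ []       ys φ = sym (ℤ.+-identityˡ _)
  ∑L-++ (x ∷ xs) ys φ = trans (cong (λ s → φ x + s) (∑L-++ xs ys φ)) (sym (ℤ.+-assoc (φ x) _ _))

  ∑L-map : ∀ {a b} {A : Set a} {B : Set b} (h : A → B) (xs : List A) (φ : B → ℤ) → ∑L (map h xs) φ ≡ ∑L xs (λ x → φ (h x))
  ∑L-map h []       φ = refl
  ∑L-map h (x ∷ xs) φ = cong (λ s → φ (h x) + s) (∑L-map h xs φ)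

  ∑L-*ˡ : ∀ {a} {A : Set a} (xs : List A) c (φ : A → ℤ) → ∑L xs (λ x → c * φ x) ≡ c * ∑L xs φ
  ∑L-*ˡ []       c φ = sym (ℤ.*-zeroʳ c)
  ∑L-*ˡ (x ∷ xs) c φ rewrite ∑L-*ˡ xs c φ = sym (ℤ.*-distribˡ-+ c (φ x) _)

  ∑L-nonNeg : ∀ {a} {A : Set a} (xs : List A) (φ : A → ℤ) → (∀ x → 0ℤ ≤ φ x) → 0ℤ ≤ ∑L xs φ
  ∑L-nonNeg []       φ p = ℤ.≤-refl
  ∑L-nonNeg (x ∷ xs) φ p = ℤ.+-mono-≤ (p x) (∑L-nonNeg xs φ p)

  ∑L-square : ∀ {a} {A : Set a} (xs : List A) (φ ψ : A → ℤ) s t →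
    ∑L xs (λ x → (s * φ x - t * ψ x) * (s * φ x - t * ψ x))
      ≡ s * s * ∑L xs (λ x → φ x * φ x) - + 2 * s * t * ∑L xs (λ x → φ x * ψ x) + t * t * ∑L xs (λ x → ψ x * ψ x)
  ∑L-square []       φ ψ s t = base s t
    where
    base : ∀ s t → 0ℤ ≡ s * s * 0ℤ - + 2 * s * t * 0ℤ + t * t * 0ℤ
    base = solve-∀
  ∑L-square (x ∷ xs) φ ψ s t rewrite ∑L-square xs φ ψ s t =
    step s t (φ x) (ψ x) (∑L xs λ x → φ x * φ x) (∑L xs λ x → φ x * ψ x) (∑L xs λ x → ψ x * ψ x)
    where
    step : ∀ s t u v A X B →
      (s * u - t * v) * (s * u - t * v) + (s * s * A - + 2 * s * t * X + t * t * B)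
        ≡ s * s * (u * u + A) - + 2 * s * t * (u * v + X) + t * t * (v * v + B)
    step = solve-∀

  -- The sum of the squares (B φ - X ψ)² equals B (A B - X²), and the positive factor B can be
  -- cancelled without dividing.
  cauchy-schwarz : ∀ {a} {A : Set a} (xs : List A) (φ ψ : A → ℤ) → 0ℤ < ∑L xs (λ x → ψ x * ψ x) →
    ∑L xs (λ x → φ x * ψ x) * ∑L xs (λ x → φ x * ψ x) ≤ ∑L xs (λ x → φ x * φ x) * ∑L xs (λ x → ψ x * ψ x)
  cauchy-schwarz xs φ ψ 0<B = ℤ.0≤i-j⇒j≤i (ℤ.*-cancelˡ-≤-pos 0ℤ _ B
    (subst₂ _≤_ (sym (ℤ.*-zeroʳ B)) (trans (∑L-square xs φ ψ B X) (expand A X B))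
      (∑L-nonNeg xs _ λ x → square-nonNeg (B * φ x - X * ψ x))))
    where
    A = ∑L xs (λ x → φ x * φ x)
    X = ∑L xs (λ x → φ x * ψ x)
    B = ∑L xs (λ x → ψ x * ψ x)
    instance _ = positive 0<B
    expand : ∀ A X B → B * B * A - + 2 * B * X * X + X * X * B ≡ B * (A * B - X * X)
    expand = solve-∀

  -- A shift-invariant kernel on ℕ that is positive semidefinite, witnessed by a Gram
  -- representation up to a positive factor; such representations multiply pointwise.
  record Kernel : Set where
    field
      K     : ℕ → ℕ → ℤ
      C     : ℤ
      0<C   : 0ℤ < C
      L     : List (ℕ → ℤ)
      gram  : ∀ a b → C * K a b ≡ ∑L L (λ f → f a * f b)
      shift : ∀ t a b → K (t ℕ.+ a) (t ℕ.+ b) ≡ K a b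
      symm  : ∀ a b → K a b ≡ K b a

    K₀ : ℤ
    K₀ = K 0 0

  open Kernel using (K; K₀)

  one : Kernel
  one = record
    { K = λ _ _ → 1ℤ ; C = 1ℤ ; 0<C = +<+ ℕ.z<s ; L = (λ _ → 1ℤ) ∷ [] ; gram = λ _ _ → refl
    ; shift = λ _ _ _ → refl ; symm = λ _ _ → refl }

  -- Schur's product theorem made explicit: the products of one Gram vector from each list represent
  -- the pointwise product of the kernels.
  tensor : List (ℕ → ℤ) → List (ℕ → ℤ) → List (ℕ → ℤ)
  tensor []       hs = []
  tensor (f ∷ fs) hs = map (λ h a → f a * h a) hs ++ tensor fs hs

  ∑L-tensor : ∀ fs hs a b → ∑L (tensor fs hs) (λ f → f a * f b) ≡ ∑L fs (λ f → f a * f b) * ∑L hs (λ h → h a * h b)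
  ∑L-tensor []       hs a b = refl
  ∑L-tensor (f ∷ fs) hs a b = begin
    ∑L (map (λ h a → f a * h a) hs ++ tensor fs hs) (λ f → f a * f b)
      ≡⟨ ∑L-++ (map (λ h a → f a * h a) hs) (tensor fs hs) _ ⟩
    ∑L (map (λ h a → f a * h a) hs) (λ f → f a * f b) + ∑L (tensor fs hs) (λ f → f a * f b)
      ≡⟨ cong₂ _+_ (∑L-map _ hs _) (∑L-tensor fs hs a b) ⟩
    ∑L hs (λ h → (f a * h a) * (f b * h b)) + ∑L fs (λ f → f a * f b) * ∑L hs (λ h → h a * h b)
      ≡⟨ cong (_+ (∑L fs (λ f → f a * f b) * ∑L hs (λ h → h a * h b)))
           (trans (∑L-cong hs λ h → regroup (f a) (h a) (f b) (h b)) (∑L-*ˡ hs (f a * f b) _)) ⟩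
    f a * f b * ∑L hs (λ h → h a * h b) + ∑L fs (λ f → f a * f b) * ∑L hs (λ h → h a * h b)
      ≡⟨ ℤ.*-distribʳ-+ (∑L hs (λ h → h a * h b)) (f a * f b) _ ⟨
    (f a * f b + ∑L fs (λ f → f a * f b)) * ∑L hs (λ h → h a * h b) ∎
    where
    open ≡-Reasoning
    regroup : ∀ u x v y → (u * x) * (v * y) ≡ u * v * (x * y)
    regroup = solve-∀

  _⊗_ : Kernel → Kernel → Kernel
  k ⊗ k′ = record
    { K = λ a b → k.K a b * k′.K a b
    ; C = k.C * k′.C
    ; 0<C = subst (_< k.C * k′.C) (ℤ.*-zeroʳ k.C) (ℤ.*-monoˡ-<-pos k.C {{positive k.0<C}} k′.0<C)
    ; L = tensor k.L k′.L
    ; gram = λ a b → trans (regroup k.C k′.C (k.K a b) (k′.K a b))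
        (trans (cong₂ _*_ (k.gram a b) (k′.gram a b)) (sym (∑L-tensor k.L k′.L a b)))
    ; shift = λ t a b → cong₂ _*_ (k.shift t a b) (k′.shift t a b)
    ; symm = λ a b → cong₂ _*_ (k.symm a b) (k′.symm a b)
    }
    where
    module k = Kernel k
    module k′ = Kernel k′
    regroup : ∀ c d x y → (c * d) * (x * y) ≡ (c * x) * (d * y)
    regroup = solve-∀

  form : ℕ → (ℕ → ℤ) → (ℕ → ℤ) → Kernel → ℤ
  form N u v k = ∑ N (λ a → u a * ∑ N (λ b → v b * K k a b))

  module _ (N : ℕ) (k : Kernel) where
    open Kernel k using (C; 0<C; L; gram; symm)

    gram-∑ : ∀ (v : ℕ → ℤ) a → C * ∑ N (λ b → v b * K k a b) ≡ ∑L L (λ f → f a * ∑ N (λ b → v b * f b))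
    gram-∑ v a = trans (sym (∑-*ˡ N C _)) (trans (∑-cong N λ b → trans (swap C (v b) (K k a b)) (cong (v b *_) (gram a b))) (push L))
      where
      swap : ∀ c x y → c * (x * y) ≡ x * (c * y)
      swap = solve-∀
      push : ∀ fs → ∑ N (λ b → v b * ∑L fs (λ f → f a * f b)) ≡ ∑L fs (λ f → f a * ∑ N (λ b → v b * f b))
      push []       = trans (∑-cong N λ b → ℤ.*-zeroʳ (v b)) (∑-zero N)
      push (f ∷ fs) = begin
        ∑ N (λ b → v b * (f a * f b + ∑L fs (λ f → f a * f b)))
          ≡⟨ ∑-cong N (λ b → distrib (v b) (f a) (f b) _) ⟩
        ∑ N (λ b → f a * (v b * f b) + v b * ∑L fs (λ f → f a * f b))
          ≡⟨ ∑-+ N _ _ ⟩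
        ∑ N (λ b → f a * (v b * f b)) + ∑ N (λ b → v b * ∑L fs (λ f → f a * f b))
          ≡⟨ cong₂ _+_ (∑-*ˡ N (f a) _) (push fs) ⟩
        f a * ∑ N (λ b → v b * f b) + ∑L fs (λ f → f a * ∑ N (λ b → v b * f b)) ∎
        where
        open ≡-Reasoning
        distrib : ∀ v x y s → v * (x * y + s) ≡ x * (v * y) + v * s
        distrib = solve-∀

    form-gram : ∀ (u v : ℕ → ℤ) → C * form N u v k ≡ ∑L L (λ f → ∑ N (λ a → u a * f a) * ∑ N (λ b → v b * f b))
    form-gram u v = trans (sym (∑-*ˡ N C _)) (trans (∑-cong N λ a → trans (swap C (u a) _) (cong (u a *_) (gram-∑ v a))) (push L))
      where
      swap : ∀ c x y → c * (x * y) ≡ x * (c * y)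
      swap = solve-∀
      V : (ℕ → ℤ) → ℤ
      V f = ∑ N (λ b → v b * f b)
      push : ∀ fs → ∑ N (λ a → u a * ∑L fs (λ f → f a * V f)) ≡ ∑L fs (λ f → ∑ N (λ a → u a * f a) * V f)
      push []       = trans (∑-cong N λ b → ℤ.*-zeroʳ (u b)) (∑-zero N)
      push (f ∷ fs) = begin
        ∑ N (λ a → u a * (f a * V f + ∑L fs (λ f → f a * V f)))
          ≡⟨ ∑-cong N (λ a → distrib (u a) (f a) (V f) _) ⟩
        ∑ N (λ a → u a * f a * V f + u a * ∑L fs (λ f → f a * V f))
          ≡⟨ ∑-+ N _ _ ⟩
        ∑ N (λ a → u a * f a * V f) + ∑ N (λ a → u a * ∑L fs (λ f → f a * V f))
          ≡⟨ cong₂ _+_ (∑-*ʳ N (V f) _) (push fs) ⟩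
        ∑ N (λ a → u a * f a) * V f + ∑L fs (λ f → ∑ N (λ a → u a * f a) * V f) ∎
        where
        open ≡-Reasoning
        distrib : ∀ v x y s → v * (x * y + s) ≡ v * x * y + v * s
        distrib = solve-∀

    form-nonNeg : ∀ u → 0ℤ ≤ form N u u k
    form-nonNeg u = ℤ.*-cancelˡ-≤-pos 0ℤ (form N u u k) C {{positive 0<C}}
      (subst₂ _≤_ (sym (ℤ.*-zeroʳ C)) (sym (form-gram u u)) (∑L-nonNeg L _ λ f → square-nonNeg (∑ N λ a → u a * f a)))

    form-symm : ∀ u v → form N u v k ≡ form N v u k
    form-symm u v = begin
      ∑ N (λ a → u a * ∑ N (λ b → v b * K k a b))     ≡⟨ ∑-cong N (λ a → sym (∑-*ˡ N (u a) _)) ⟩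
      ∑ N (λ a → ∑ N (λ b → u a * (v b * K k a b)))   ≡⟨ ∑-swap N N _ ⟩
      ∑ N (λ b → ∑ N (λ a → u a * (v b * K k a b)))   ≡⟨ ∑-cong N (λ b → ∑-cong N λ a →
                                                           trans (cong (λ y → u a * (v b * y)) (symm a b)) (swap (u a) (v b) (K k b a))) ⟩
      ∑ N (λ b → ∑ N (λ a → v b * (u a * K k b a)))   ≡⟨ ∑-cong N (λ b → ∑-*ˡ N (v b) _) ⟩
      ∑ N (λ b → v b * ∑ N (λ a → u a * K k b a))     ∎
      where
      open ≡-Reasoning
      swap : ∀ c x y → c * (x * y) ≡ x * (c * y)
      swap = solve-∀

    -- Cauchy-Schwarz over the list of Gram vectors f, applied to f ↦ Σ u(a) f(a) and f ↦ f(0). This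
    -- takes the place of evaluating the absolute value of each Gauss sum.
    kernel-cauchy-schwarz : 0ℤ < K₀ k → ∀ u →
      ∑ N (λ a → u a * K k 0 a) * ∑ N (λ a → u a * K k 0 a) ≤ form N u u k * K₀ k
    kernel-cauchy-schwarz 0<K₀ u = ℤ.*-cancelˡ-≤-pos _ _ (C * C) {{positive 0<CC}}
      (subst₂ _≤_ (trans (cong₂ _*_ X-eq X-eq) (regroup C X X)) (trans (cong₂ _*_ (sym (form-gram u u)) (sym (gram 0 0))) (regroup C (form N u u k) (K₀ k)))
        (cauchy-schwarz L (λ f → ∑ N (λ a → u a * f a)) (λ f → f 0) (subst (0ℤ <_) (gram 0 0) 0<CK₀)))
      where
      X = ∑ N (λ a → u a * K k 0 a)
      0<CC : 0ℤ < C * C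
      0<CC = subst (_< C * C) (ℤ.*-zeroʳ C) (ℤ.*-monoˡ-<-pos C {{positive 0<C}} 0<C)
      0<CK₀ : 0ℤ < C * K₀ k
      0<CK₀ = subst (_< C * K₀ k) (ℤ.*-zeroʳ C) (ℤ.*-monoˡ-<-pos C {{positive 0<C}} 0<K₀)
      X-eq : ∑L L (λ f → ∑ N (λ a → u a * f a) * f 0) ≡ C * X
      X-eq = trans (∑L-cong L λ f → ℤ.*-comm _ (f 0)) (sym (gram-∑ u 0))
      regroup : ∀ c x y → (c * x) * (c * y) ≡ (c * c) * (x * y)
      regroup = solve-∀

-- Second moments of kernels over the fibres of the trace.

module SecondMoments where
  open RangeSums
  open PositiveKernels
  open import Data.Nat as ℕ using (ℕ; zero; suc)
  import Data.Nat.Properties as ℕ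
  open import Data.Integer using (ℤ; +_; -_; _+_; _-_; _*_; _≤_; _<_; 0ℤ; 1ℤ; +<+; positive; nonNegative)
  import Data.Integer.Properties as ℤ
  open import Data.Integer.Tactic.RingSolver using (solve-∀)
  open import Relation.Binary.PropositionalEquality using (_≡_; refl; sym; trans; cong; cong₂; subst; subst₂; module ≡-Reasoning)
  open Kernel using (K; K₀)

  -- What the second-moment computation needs to know about the trace: a ranges over
  -- exponents of a generator, z and w j are the indicators of trace 0 and of the j-th
  -- nonzero trace value, and Θ a b indicates equality of traces.
  record TraceData (N J Q Z Y : ℕ) : Set where
    field
      z       : ℕ → ℤ
      w       : ℕ → ℕ → ℤ
      Θ       : ℕ → ℕ → ℤ
      N>0     : 0 ℕ.< N
      J>0     : 0 ℕ.< J
      Θ-split : ∀ a b → Θ a b ≡ z a * z b + ∑ J (λ j → w j a * w j b)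
      Θ-diag  : ∀ a → Θ a a ≡ 1ℤ
      Θ-off   : ∀ t → 0 ℕ.< t → t ℕ.< N → ∑ N (λ a → Θ (t ℕ.+ a) a) ≡ + Z
      z-per   : Periodic N z
      w-per   : ∀ j → Periodic N (w j)
      w-scale : ∀ j a → w j (j ℕ.* Q ℕ.+ a) ≡ w 0 a
      z-count : ∑ N z ≡ + Z
      total   : ∀ a → z a + ∑ J (λ j → w j a) ≡ 1ℤ
      sizes   : + N - + Z ≡ + J * + Y

  module Moments {N J Q Z Y : ℕ} (td : TraceData N J Q Z Y)
    (k : Kernel) (k-per : ∀ b → Periodic N (λ a → K k a b)) (k-mean : ∑ N (λ a → K k a 0) ≡ 0ℤ) where
    open TraceData td
    open Kernel k using (shift; symm)
    open ≡-Reasoning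

    M₀ M : ℤ
    M₀ = form N z z k
    M  = form N (w 0) (w 0) k

    k-per₂ : ∀ a → Periodic N (λ b → K k a b)
    k-per₂ a b = trans (symm a (N ℕ.+ b)) (trans (k-per a b) (symm b a))

    -- Multiplication by g^(jQ), an element of the small field, carries the fibre of index 0 onto
    -- that of index `j`, and the kernel is invariant under shifting both arguments.
    form-w : ∀ j → form N (w j) (w j) k ≡ M
    form-w j = begin
      ∑ N (λ a → w j a * ∑ N (λ b → w j b * K k a b))
        ≡⟨ ∑-shift N t _ (λ a → cong₂ _*_ (w-per j a) (∑-cong N λ b → cong (w j b *_) (k-per b a))) ⟨
      ∑ N (λ a → w j (t ℕ.+ a) * ∑ N (λ b → w j b * K k (t ℕ.+ a) b))
        ≡⟨ ∑-cong N (λ a → cong (w j (t ℕ.+ a) *_)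
             (∑-shift N t _ (λ b → cong₂ _*_ (w-per j b) (k-per₂ (t ℕ.+ a) b)))) ⟨
      ∑ N (λ a → w j (t ℕ.+ a) * ∑ N (λ b → w j (t ℕ.+ b) * K k (t ℕ.+ a) (t ℕ.+ b)))
        ≡⟨ ∑-cong N (λ a → cong₂ _*_ (w-scale j a) (∑-cong N λ b → cong₂ _*_ (w-scale j b) (shift t a b))) ⟩
      M ∎
      where t = j ℕ.* Q

    Θ-per : ∀ a b → Θ (N ℕ.+ a) b ≡ Θ a b
    Θ-per a b = begin
      Θ (N ℕ.+ a) b                                     ≡⟨ Θ-split (N ℕ.+ a) b ⟩
      z (N ℕ.+ a) * z b + ∑ J (λ j → w j (N ℕ.+ a) * w j b) ≡⟨ cong₂ _+_ (cong (_* z b) (z-per a)) (∑-cong J λ j → cong (_* w j b) (w-per j a)) ⟩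
      z a * z b + ∑ J (λ j → w j a * w j b)             ≡⟨ Θ-split a b ⟨
      Θ a b                                             ∎

    correlation : ℤ
    correlation = ∑ N (λ b → ∑ N (λ a → Θ a b * K k a b))

    correlation-split : correlation ≡ M₀ + + J * M
    correlation-split = begin
      ∑ N (λ b → ∑ N (λ a → Θ a b * K k a b))
        ≡⟨ ∑-swap N N _ ⟩
      ∑ N (λ a → ∑ N (λ b → Θ a b * K k a b))
        ≡⟨ ∑-cong N (λ a → ∑-cong N λ b → trans (cong (_* K k a b) (Θ-split a b)) (ℤ.*-distribʳ-+ (K k a b) (z a * z b) (∑ J λ j → w j a * w j b))) ⟩
      ∑ N (λ a → ∑ N (λ b → z a * z b * K k a b + ∑ J (λ j → w j a * w j b) * K k a b))
        ≡⟨ ∑-cong N (λ a → ∑-+ N _ _) ⟩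
      ∑ N (λ a → ∑ N (λ b → z a * z b * K k a b) + ∑ N (λ b → ∑ J (λ j → w j a * w j b) * K k a b))
        ≡⟨ ∑-+ N _ _ ⟩
      ∑ N (λ a → ∑ N (λ b → z a * z b * K k a b)) + ∑ N (λ a → ∑ N (λ b → ∑ J (λ j → w j a * w j b) * K k a b))
        ≡⟨ cong₂ _+_ (∑-cong N λ a → pull z a) (∑-cong N λ a → w-part a) ⟩
      M₀ + ∑ N (λ a → ∑ J (λ j → w j a * ∑ N (λ b → w j b * K k a b)))
        ≡⟨ cong (_+_ M₀) (∑-swap N J _) ⟩
      M₀ + ∑ J (λ j → form N (w j) (w j) k)
        ≡⟨ cong (_+_ M₀) (trans (∑-cong J form-w) (∑-const J M)) ⟩
      M₀ + + J * M ∎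
      where
      pull : ∀ (u : ℕ → ℤ) a → ∑ N (λ b → u a * u b * K k a b) ≡ u a * ∑ N (λ b → u b * K k a b)
      pull u a = trans (∑-cong N λ b → ℤ.*-assoc (u a) (u b) (K k a b)) (∑-*ˡ N (u a) _)
      w-part : ∀ a → ∑ N (λ b → ∑ J (λ j → w j a * w j b) * K k a b) ≡ ∑ J (λ j → w j a * ∑ N (λ b → w j b * K k a b))
      w-part a = begin
        ∑ N (λ b → ∑ J (λ j → w j a * w j b) * K k a b)   ≡⟨ ∑-cong N (λ b → sym (∑-*ʳ J (K k a b) _)) ⟩
        ∑ N (λ b → ∑ J (λ j → w j a * w j b * K k a b))   ≡⟨ ∑-swap N J _ ⟩
        ∑ J (λ j → ∑ N (λ b → w j a * w j b * K k a b))   ≡⟨ ∑-cong J (λ j → pull (w j) a) ⟩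
        ∑ J (λ j → w j a * ∑ N (λ b → w j b * K k a b))   ∎

    -- Put a = t + b. For t ≠ 0 the number of b at which the two traces agree is always `Z`.
    -- Subtracting `Z` from every count changes nothing, because the kernel has mean zero, and
    -- leaves only the diagonal t = 0 with weight N - Z.
    correlation-value : correlation ≡ K₀ k * (+ J * + Y)
    correlation-value = begin
      ∑ N (λ b → ∑ N (λ a → Θ a b * K k a b))
        ≡⟨ ∑-cong N (λ b → ∑-shift N b _ (λ a → cong₂ _*_ (Θ-per a b) (k-per b a))) ⟨
      ∑ N (λ b → ∑ N (λ t → Θ (b ℕ.+ t) b * K k (b ℕ.+ t) b))
        ≡⟨ ∑-cong N (λ b → ∑-cong N λ t → cong₂ _*_ (cong (λ s → Θ s b) (ℕ.+-comm b t))
             (trans (cong (K k (b ℕ.+ t)) (sym (ℕ.+-identityʳ b))) (shift b t 0))) ⟩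
      ∑ N (λ b → ∑ N (λ t → Θ (t ℕ.+ b) b * K k t 0))
        ≡⟨ ∑-swap N N _ ⟩
      ∑ N (λ t → ∑ N (λ b → Θ (t ℕ.+ b) b * K k t 0))
        ≡⟨ ∑-cong N (λ t → trans (∑-*ʳ N (K k t 0) _) (centre (count t) (K k t 0) (+ Z))) ⟩
      ∑ N (λ t → (count t - + Z) * K k t 0 + + Z * K k t 0)
        ≡⟨ ∑-+ N _ _ ⟩
      ∑ N (λ t → (count t - + Z) * K k t 0) + ∑ N (λ t → + Z * K k t 0)
        ≡⟨ cong₂ _+_ (∑-only-first N _ (λ i i<N → trans (cong (λ c → (c - + Z) * K k (suc i) 0) (Θ-off (suc i) ℕ.z<s i<N)) (cancel (+ Z) (K k (suc i) 0))) N>0)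
                     (trans (∑-*ˡ N (+ Z) _) (cong (+ Z *_) k-mean)) ⟩
      (count 0 - + Z) * K₀ k + + Z * 0ℤ
        ≡⟨ cong (λ c → (c - + Z) * K₀ k + + Z * 0ℤ) (trans (∑-cong N Θ-diag) (trans (∑-const N 1ℤ) (ℤ.*-identityʳ (+ N)))) ⟩
      (+ N - + Z) * K₀ k + + Z * 0ℤ
        ≡⟨ cong (λ c → c * K₀ k + + Z * 0ℤ) sizes ⟩
      (+ J * + Y) * K₀ k + + Z * 0ℤ
        ≡⟨ tidy (+ J * + Y) (K₀ k) (+ Z) ⟩
      K₀ k * (+ J * + Y) ∎
      where
      count : ℕ → ℤ
      count t = ∑ N (λ b → Θ (t ℕ.+ b) b)
      centre : ∀ c x z → c * x ≡ (c - z) * x + z * x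
      centre = solve-∀
      cancel : ∀ z x → (z - z) * x ≡ 0ℤ
      cancel = solve-∀
      tidy : ∀ c x z → c * x + z * 0ℤ ≡ x * c
      tidy = solve-∀

    instance _ = positive (+<+ J>0)

    module _ (0<K₀ : 0ℤ < K₀ k) where
      U : ℤ
      U = ∑ N (λ a → w 0 a * K k 0 a)

      instance _ = nonNegative (ℤ.<⇒≤ 0<K₀)

      -- In `M₀ + J M = K₀ J Y` the form `M₀` over trace 0 is nonnegative and may be dropped.
      M-bound : M ≤ K₀ k * + Y
      M-bound = ℤ.*-cancelˡ-≤-pos _ _ (+ J) step
        where
        step : + J * M ≤ + J * (K₀ k * + Y)
        step = subst₂ _≤_ (ℤ.+-identityˡ _)
          (trans (sym correlation-split) (trans correlation-value (swap (K₀ k) (+ J) (+ Y))))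
          (ℤ.+-monoˡ-≤ (+ J * M) (form-nonNeg N k z))
          where
          swap : ∀ x j y → x * (j * y) ≡ j * (x * y)
          swap = solve-∀

      U-bound : U * U ≤ (K₀ k * K₀ k) * + Y
      U-bound = ℤ.≤-trans (kernel-cauchy-schwarz N k 0<K₀ (w 0))
        (subst (M * K₀ k ≤_) (swap (K₀ k) (+ Y)) (ℤ.*-monoʳ-≤-nonNeg (K₀ k) M-bound))
        where
        swap : ∀ x y → x * y * x ≡ x * x * y
        swap = solve-∀

      module _ (k-inv : ∀ b → Periodic Q (λ a → K k a b)) where
        k-inv* : ∀ j a b → K k (j ℕ.* Q ℕ.+ a) b ≡ K k a b
        k-inv* zero    a b = refl
        k-inv* (suc j) a b = trans (cong (λ x → K k x b) (ℕ.+-assoc Q (j ℕ.* Q) a)) (trans (k-inv b (j ℕ.* Q ℕ.+ a)) (k-inv* j a b))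

        V : ℕ → ℤ
        V b = ∑ N (λ a → w 0 a * K k b a)

        -- A kernel of period `Q` does not see factors from the small field, so single sections, and
        -- not only quadratic forms, agree on all nonzero trace values.
        w-section : ∀ j b → ∑ N (λ a → w j a * K k b a) ≡ V b
        w-section j b = begin
          ∑ N (λ a → w j a * K k b a)
            ≡⟨ ∑-shift N t _ (λ a → cong₂ _*_ (w-per j a) (k-per₂ b a)) ⟨
          ∑ N (λ a → w j (t ℕ.+ a) * K k b (t ℕ.+ a))
            ≡⟨ ∑-cong N (λ a → cong₂ _*_ (w-scale j a) (trans (symm b (t ℕ.+ a)) (trans (k-inv* j a b) (symm a b)))) ⟩
          V b ∎
          where t = j ℕ.* Q

        mean-at : ∀ b → ∑ N (λ a → K k b a) ≡ 0ℤ
        mean-at b = begin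
          ∑ N (λ a → K k b a)               ≡⟨ ∑-shift N b _ (k-per₂ b) ⟨
          ∑ N (λ a → K k b (b ℕ.+ a))       ≡⟨ ∑-cong N (λ a → trans (cong (λ c → K k c (b ℕ.+ a)) (sym (ℕ.+-identityʳ b))) (trans (shift b 0 a) (symm 0 a))) ⟩
          ∑ N (λ a → K k a 0)               ≡⟨ k-mean ⟩
          0ℤ                                ∎

        -- The sections over all trace values add up to the mean 0, and the `J` nonzero values
        -- contribute equally; this determines the section over trace 0.
        z-section : ∀ b → ∑ N (λ a → z a * K k b a) ≡ - (+ J * V b)
        z-section b = solve-for (∑ N (λ a → z a * K k b a)) (+ J * V b) (begin
          ∑ N (λ a → z a * K k b a) + + J * V b
            ≡⟨ cong (λ s → ∑ N (λ a → z a * K k b a) + s) (trans (∑-cong J λ j → w-section j b) (∑-const J (V b))) ⟨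
          ∑ N (λ a → z a * K k b a) + ∑ J (λ j → ∑ N (λ a → w j a * K k b a))
            ≡⟨ cong (λ s → ∑ N (λ a → z a * K k b a) + s) (∑-swap J N _) ⟩
          ∑ N (λ a → z a * K k b a) + ∑ N (λ a → ∑ J (λ j → w j a * K k b a))
            ≡⟨ ∑-+ N _ _ ⟨
          ∑ N (λ a → z a * K k b a + ∑ J (λ j → w j a * K k b a))
            ≡⟨ ∑-cong N (λ a → trans (cong (λ s → z a * K k b a + s) (∑-*ʳ J (K k b a) _))
                 (trans (sym (ℤ.*-distribʳ-+ (K k b a) (z a) (∑ J λ j → w j a))) (trans (cong (_* K k b a) (total a)) (ℤ.*-identityˡ _)))) ⟩
          ∑ N (λ a → K k b a)
            ≡⟨ mean-at b ⟩
          0ℤ ∎)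
          where
          solve-for : ∀ x y → x + y ≡ 0ℤ → x ≡ - y
          solve-for x y e = trans (lemma x y) (trans (cong (_- y) e) (ℤ.+-identityˡ (- y)))
            where
            lemma : ∀ x y → x ≡ (x + y) - y
            lemma = solve-∀

        half : ∀ u → form N u z k ≡ - (+ J * form N u (w 0) k)
        half u = begin
          ∑ N (λ a → u a * ∑ N (λ b → z b * K k a b))  ≡⟨ ∑-cong N (λ a → trans (cong (u a *_) (z-section a)) (flip (u a) (+ J) (V a))) ⟩
          ∑ N (λ a → (- + J) * (u a * V a))            ≡⟨ ∑-*ˡ N (- + J) _ ⟩
          (- + J) * form N u (w 0) k                   ≡⟨ ℤ.neg-distribˡ-* (+ J) _ ⟨
          - (+ J * form N u (w 0) k)                   ∎
          where
          flip : ∀ u j v → u * (- (j * v)) ≡ (- j) * (u * v)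
          flip = solve-∀

        M₀-value : M₀ ≡ + J * + J * M
        M₀-value = begin
          form N z z k                               ≡⟨ half z ⟩
          - (+ J * form N z (w 0) k)                 ≡⟨ cong (λ x → - (+ J * x)) (trans (form-symm N k z (w 0)) (half (w 0))) ⟩
          - (+ J * (- (+ J * M)))                    ≡⟨ tidy (+ J) M ⟩
          + J * + J * M                              ∎
          where
          tidy : ∀ j m → - (j * (- (j * m))) ≡ j * j * m
          tidy = solve-∀

        -- Now `M₀` is known to be J² M, so nothing is dropped: J M + J² M = K₀ J Y. The factor 1 +
        -- J, which stands for q, is the gain over `M-bound`.
        M-exact : (1ℤ + + J) * M ≡ K₀ k * + Y
        M-exact = ℤ.*-cancelˡ-≡ (+ J) _ _ (begin
          + J * ((1ℤ + + J) * M)        ≡⟨ expand (+ J) M ⟩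
          + J * + J * M + + J * M       ≡⟨ cong (_+ + J * M) M₀-value ⟨
          M₀ + + J * M                  ≡⟨ correlation-split ⟨
          correlation                   ≡⟨ correlation-value ⟩
          K₀ k * (+ J * + Y)            ≡⟨ swap (K₀ k) (+ J) (+ Y) ⟩
          + J * (K₀ k * + Y)            ∎)
          where
          instance _ = ℕ.>-nonZero J>0
          expand : ∀ j m → j * ((1ℤ + j) * m) ≡ j * j * m + j * m
          expand = solve-∀
          swap : ∀ x j y → x * (j * y) ≡ j * (x * y)
          swap = solve-∀

        U-bound-inv : (1ℤ + + J) * (U * U) ≤ (K₀ k * K₀ k) * + Y
        U-bound-inv = ℤ.≤-trans (ℤ.*-monoˡ-≤-nonNeg (1ℤ + + J) (kernel-cauchy-schwarz N k 0<K₀ (w 0)))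
          (ℤ.≤-reflexive (trans (sym (ℤ.*-assoc (1ℤ + + J) M (K₀ k))) (trans (cong (_* K₀ k) M-exact) (swap (K₀ k) (+ Y)))))
          where
          swap : ∀ x y → x * y * x ≡ x * x * y
          swap = solve-∀

-- Congruence indicators and Ramanujan sums of prime-power order.

module RamanujanKernels where
  open RangeSums
  open PositiveKernels
  open import Data.Nat as ℕ using (ℕ; zero; suc; NonZero)
  import Data.Nat.Properties as ℕ
  import Data.Nat.Divisibility as ℕ
  open import Data.Nat.Coprimality using (Coprime; coprime-Bézout)
  open import Data.Nat.GCD using (module Bézout)
  open import Data.Integer using (ℤ; +_; -_; _+_; _-_; _*_; _<_; 0ℤ; 1ℤ; +<+)
  import Data.Integer.Properties as ℤ
  open import Data.Integer.Divisibility.Signed using (_∣_; divides; _∣?_; ∣ᵤ⇒∣; ∣⇒∣ᵤ; ∣m∣n⇒∣m+n; ∣m⇒∣-m; ∣-trans)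
  open import Data.Integer.Tactic.RingSolver using (solve-∀)
  open import Data.List using (downFrom; map)
  open import Data.Product using (Σ; _×_; _,_)
  open import Relation.Nullary using (Dec)
  open import Relation.Nullary.Decidable using (map′)
  open import Relation.Binary.PropositionalEquality using (_≡_; refl; sym; trans; cong; cong₂; subst; module ≡-Reasoning)
  open Kernel using (K; K₀)

  -- Signed differences turn symmetry, transitivity and cancellation into ring identities. As a
  -- record type it lets unification recover `m`, `a` and `b`.
  record Cong (m a b : ℕ) : Set where
    constructor congruent
    field difference : + m ∣ (+ a - + b)

  open Cong

  cong? : ∀ m a b → Dec (Cong m a b)
  cong? m a b = map′ congruent difference (+ m ∣? (+ a - + b))

  Cong-reflexive : ∀ m {a b} → a ≡ b → Cong m a b
  Cong-reflexive m {a} refl = congruent (divides 0ℤ (ℤ.+-inverseʳ (+ a)))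

  Cong-sym : ∀ {m a b} → Cong m a b → Cong m b a
  Cong-sym {m} {a} {b} (congruent d) = congruent (subst (+ m ∣_) (lemma (+ a) (+ b)) (∣m⇒∣-m d))
    where
    lemma : ∀ x y → - (x - y) ≡ y - x
    lemma = solve-∀

  Cong-trans : ∀ {m a b c} → Cong m a b → Cong m b c → Cong m a c
  Cong-trans {m} {a} {b} {c} (congruent d) (congruent e) = congruent (subst (+ m ∣_) (lemma (+ a) (+ b) (+ c)) (∣m∣n⇒∣m+n d e))
    where
    lemma : ∀ x y z → (x - y) + (y - z) ≡ x - z
    lemma = solve-∀

  Cong-+ : ∀ {m a a′ b b′} → Cong m a a′ → Cong m b b′ → Cong m (a ℕ.+ b) (a′ ℕ.+ b′)
  Cong-+ {m} {a} {a′} {b} {b′} (congruent d) (congruent e) = congruent (subst (+ m ∣_)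
    (trans (lemma (+ a) (+ a′) (+ b) (+ b′)) (sym (cong₂ _-_ (ℤ.pos-+ a b) (ℤ.pos-+ a′ b′)))) (∣m∣n⇒∣m+n d e))
    where
    lemma : ∀ x x′ y y′ → (x - x′) + (y - y′) ≡ (x + y) - (x′ + y′)
    lemma = solve-∀

  Cong-cancel : ∀ {m} t {a b} → Cong m (t ℕ.+ a) (t ℕ.+ b) → Cong m a b
  Cong-cancel {m} t {a} {b} (congruent d) =
    congruent (subst (+ m ∣_) (trans (cong₂ _-_ (ℤ.pos-+ t a) (ℤ.pos-+ t b)) (lemma (+ t) (+ a) (+ b))) d)
    where
    lemma : ∀ t x y → (t + x) - (t + y) ≡ x - y
    lemma = solve-∀

  Cong-weaken : ∀ {m m′ a b} → m ℕ.∣ m′ → Cong m′ a b → Cong m a b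
  Cong-weaken d (congruent e) = congruent (∣-trans (∣ᵤ⇒∣ d) e)

  Cong0⇒∣ : ∀ {m a} → Cong m a 0 → m ℕ.∣ a
  Cong0⇒∣ {m} {a} (congruent d) = ∣⇒∣ᵤ (subst (+ m ∣_) (ℤ.+-identityʳ (+ a)) d)

  ∣⇒Cong0 : ∀ {m a} → m ℕ.∣ a → Cong m a 0
  ∣⇒Cong0 {m} {a} d = congruent (subst (+ m ∣_) (sym (ℤ.+-identityʳ (+ a))) (∣ᵤ⇒∣ d))

  Cong-*0 : ∀ {m} j {e} → Cong m e 0 → Cong m (j ℕ.* e) 0
  Cong-*0 j d = ∣⇒Cong0 (ℕ.∣n⇒∣m*n j (Cong0⇒∣ d))

  Cong-*1 : ∀ {m} j {e} → Cong m e 1 → Cong m (j ℕ.* e) j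
  Cong-*1 {m} zero    d = Cong-reflexive m refl
  Cong-*1     (suc j) d = Cong-+ d (Cong-*1 j d)

  Cong-period : ∀ m a → Cong m (m ℕ.+ a) a
  Cong-period m a = Cong-+ (∣⇒Cong0 ℕ.∣-refl) (Cong-reflexive m refl)

  δ : ℕ → ℕ → ℕ → ℤ
  δ m a b = 𝟙 (cong? m a b)

  δ-symm : ∀ m a b → δ m a b ≡ δ m b a
  δ-symm m a b = 𝟙-cong (cong? m a b) (cong? m b a) Cong-sym Cong-sym

  δ-shift : ∀ m t a b → δ m (t ℕ.+ a) (t ℕ.+ b) ≡ δ m a b
  δ-shift m t a b = 𝟙-cong (cong? m _ _) (cong? m a b) (Cong-cancel t) (Cong-+ (Cong-reflexive m {t} refl))

  δ-resp : ∀ m {a a′} b → Cong m a a′ → δ m a b ≡ δ m a′ b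
  δ-resp m {a} {a′} b e = 𝟙-cong (cong? m a b) (cong? m a′ b) (Cong-trans (Cong-sym e)) (Cong-trans e)

  δ-resp₂ : ∀ m a {b b′} → Cong m b b′ → δ m a b ≡ δ m a b′
  δ-resp₂ m a {b} {b′} e = trans (δ-symm m a b) (trans (δ-resp m a e) (δ-symm m b′ a))

  -- Exactly one residue modulo `m` is hit; shifting the summation by `a` moves it to index 0.
  ∑-δ : ∀ m .{{_ : NonZero m}} a (h : ℕ → ℤ) → (∀ i j → Cong m i j → h i ≡ h j) → ∑ m (λ i → δ m a i * h i) ≡ h a
  ∑-δ m a h resp = begin
    ∑ m (λ i → δ m a i * h i)
      ≡⟨ ∑-shift m a _ (λ i → cong₂ _*_ (δ-resp₂ m a (Cong-period m i)) (resp _ _ (Cong-period m i))) ⟨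
    ∑ m (λ i → δ m a (a ℕ.+ i) * h (a ℕ.+ i))
      ≡⟨ ∑-only-first m _ off (ℕ.>-nonZero⁻¹ m) ⟩
    δ m a (a ℕ.+ 0) * h (a ℕ.+ 0)
      ≡⟨ cong₂ _*_ (𝟙-yes (cong? m a (a ℕ.+ 0)) (Cong-reflexive m (sym (ℕ.+-identityʳ a)))) (cong h (ℕ.+-identityʳ a)) ⟩
    1ℤ * h a
      ≡⟨ ℤ.*-identityˡ (h a) ⟩
    h a ∎
    where
    open ≡-Reasoning
    off : ∀ i → suc i ℕ.< m → δ m a (a ℕ.+ suc i) * h (a ℕ.+ suc i) ≡ 0ℤ
    off i i<m = cong (_* h (a ℕ.+ suc i)) (𝟙-no (cong? m a (a ℕ.+ suc i)) λ d →
      ℕ.>⇒∤ i<m (Cong0⇒∣ (Cong-sym (Cong-cancel a (subst (λ x → Cong m x (a ℕ.+ suc i)) (sym (ℕ.+-identityʳ a)) d)))))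

  ∑-δ-1 : ∀ m .{{_ : NonZero m}} a → ∑ m (λ i → δ m a i) ≡ 1ℤ
  ∑-δ-1 m a = trans (∑-cong m λ i → sym (ℤ.*-identityʳ (δ m a i))) (∑-δ m a (λ _ → 1ℤ) λ _ _ _ → refl)

  -- In terms of characters: only those of order dividing `m` occur in `k`.
  Resp : ℕ → Kernel → Set
  Resp m k = ∀ {a a′} b → Cong m a a′ → K k a b ≡ K k a′ b

  Resp-weaken : ∀ {m m′} k → m ℕ.∣ m′ → Resp m k → Resp m′ k
  Resp-weaken k d r b e = r b (Cong-weaken d e)

  Resp-⊗ : ∀ {m} k k′ → Resp m k → Resp m k′ → Resp m (k ⊗ k′)
  Resp-⊗ k k′ r r′ b e = cong₂ _*_ (r b e) (r′ b e)

  -- The sum of the characters of order m = s m′ when m′ is the largest proper divisor of a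
  -- prime power m: for m prime (m′ = 1) and m = 4 (m′ = 2) this is the Ramanujan sum c_m.
  module _ (s m′ : ℕ) {{_ : NonZero s}} {{_ : NonZero m′}} where
    private
      m = s ℕ.* m′
      instance _ = ℕ.m*n≢0 s m′

    atomK : ℕ → ℕ → ℤ
    atomK a b = + m * δ m a b - + m′ * δ m′ a b

    private
      ∑L-downFrom : ∀ n (f : ℕ → ℕ → ℤ) (φ : (ℕ → ℤ) → ℤ) → ∑L (map f (downFrom n)) φ ≡ ∑ n (λ i → φ (f i))
      ∑L-downFrom zero    f φ = refl
      ∑L-downFrom (suc n) f φ = trans (cong (λ x → φ (f n) + x) (∑L-downFrom n f φ)) (ℤ.+-comm (φ (f n)) _)

      coarse : ∀ a a′ → Cong m a a′ → Cong m′ a a′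
      coarse a a′ = Cong-weaken (ℕ.n∣m*n s)

      -- As a matrix indexed by ℤ/m, `atomK` is `m` times a projection: it annihilates the functions
      -- of period `m′` and keeps their orthogonal complement. So its square is `m` times itself,
      -- and its own rows serve as Gram vectors.
      gram : ∀ a b → + m * atomK a b ≡ ∑ m (λ i → atomK a i * atomK b i)
      gram a b = sym (begin
        ∑ m (λ i → atomK a i * atomK b i)
          ≡⟨ ∑-cong m (λ i → expand (+ m) (+ m′) (δ m a i) (δ m b i) (δ m′ a i) (δ m′ b i)) ⟩
        ∑ m (λ i → (+ m * + m * (δ m a i * δ m b i) + + m′ * + m′ * (δ m′ a i * δ m′ b i))
                  + ((- (+ m * + m′)) * (δ m a i * δ m′ b i) + (- (+ m * + m′)) * (δ m b i * δ m′ a i)))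
          ≡⟨ trans (∑-+ m _ _) (cong₂ _+_ (∑-+ m _ _) (∑-+ m _ _)) ⟩
        (∑ m (λ i → + m * + m * (δ m a i * δ m b i)) + ∑ m (λ i → + m′ * + m′ * (δ m′ a i * δ m′ b i)))
          + (∑ m (λ i → (- (+ m * + m′)) * (δ m a i * δ m′ b i)) + ∑ m (λ i → (- (+ m * + m′)) * (δ m b i * δ m′ a i)))
          ≡⟨ cong₂ _+_ (cong₂ _+_ (trans (∑-*ˡ m (+ m * + m) _) (cong (+ m * + m *_) fine))
                                   (trans (∑-*ˡ m (+ m′ * + m′) _) (cong (+ m′ * + m′ *_) blocks)))
                       (cong₂ _+_ (trans (∑-*ˡ m (- (+ m * + m′)) _) (cong ((- (+ m * + m′)) *_) (mixed a b)))
                                   (trans (∑-*ˡ m (- (+ m * + m′)) _) (cong ((- (+ m * + m′)) *_) (trans (mixed b a) (δ-symm m′ a b))))) ⟩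
        (+ m * + m * δ m b a + + m′ * + m′ * (+ s * δ m′ b a))
          + ((- (+ m * + m′)) * δ m′ b a + (- (+ m * + m′)) * δ m′ b a)
          ≡⟨ cong₂ (λ x y → (+ m * + m * x + + m′ * + m′ * (+ s * y)) + ((- (+ m * + m′)) * y + (- (+ m * + m′)) * y)) (δ-symm m b a) (δ-symm m′ b a) ⟩
        (+ m * + m * δ m a b + + m′ * + m′ * (+ s * δ m′ a b))
          + ((- (+ m * + m′)) * δ m′ a b + (- (+ m * + m′)) * δ m′ a b)
          ≡⟨ cong (λ M → (M * M * δ m a b + + m′ * + m′ * (+ s * δ m′ a b)) + ((- (M * + m′)) * δ m′ a b + (- (M * + m′)) * δ m′ a b)) (ℤ.pos-* s m′) ⟩
        _ ≡⟨ collect (+ s) (+ m′) (δ m a b) (δ m′ a b) ⟩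
        (+ s * + m′) * ((+ s * + m′) * δ m a b - + m′ * δ m′ a b)
          ≡⟨ cong (λ M → M * (M * δ m a b - + m′ * δ m′ a b)) (ℤ.pos-* s m′) ⟨
        + m * atomK a b ∎)
        where
        open ≡-Reasoning
        expand : ∀ M N x y x′ y′ → (M * x - N * x′) * (M * y - N * y′)
          ≡ (M * M * (x * y) + N * N * (x′ * y′)) + ((- (M * N)) * (x * y′) + (- (M * N)) * (y * x′))
        expand = solve-∀
        collect : ∀ s n x y → ((s * n) * (s * n) * x + n * n * (s * y)) + ((- ((s * n) * n)) * y + (- ((s * n) * n)) * y)
          ≡ (s * n) * ((s * n) * x - n * y)
        collect = solve-∀
        fine : ∑ m (λ i → δ m a i * δ m b i) ≡ δ m b a
        fine = ∑-δ m a (δ m b) λ i j → δ-resp₂ m b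
        mixed : ∀ a b → ∑ m (λ i → δ m a i * δ m′ b i) ≡ δ m′ b a
        mixed a b = ∑-δ m a (δ m′ b) λ i j e → δ-resp₂ m′ b (coarse i j e)
        blocks : ∑ m (λ i → δ m′ a i * δ m′ b i) ≡ + s * δ m′ b a
        blocks = trans (∑-blocks s m′ _ λ i → cong₂ _*_ (δ-resp₂ m′ a (Cong-period m′ i)) (δ-resp₂ m′ b (Cong-period m′ i)))
          (cong (+ s *_) (∑-δ m′ a (δ m′ b) λ i j → δ-resp₂ m′ b))

    atom : Kernel
    atom = record
      { K = atomK
      ; C = + m
      ; 0<C = +<+ (ℕ.>-nonZero⁻¹ m)
      ; L = map (λ i a → atomK a i) (downFrom m)
      ; gram = λ a b → trans (gram a b) (sym (∑L-downFrom m (λ i a → atomK a i) (λ f → f a * f b)))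
      ; shift = λ t a b → cong₂ (λ x y → + m * x - + m′ * y) (δ-shift m t a b) (δ-shift m′ t a b)
      ; symm = λ a b → cong₂ (λ x y → + m * x - + m′ * y) (δ-symm m a b) (δ-symm m′ a b)
      }

    atom-resp : Resp m atom
    atom-resp {a} {a′} b e = cong₂ (λ x y → + m * x - + m′ * y) (δ-resp m b e) (δ-resp m′ b (coarse a a′ e))

    atom-mean : ∀ a → ∑ m (λ j → atomK (a ℕ.+ j) 0) ≡ 0ℤ
    atom-mean a = begin
      ∑ m (λ j → atomK (a ℕ.+ j) 0)
        ≡⟨ ∑-shift m a (λ j → atomK j 0) (λ i → atom-resp 0 (Cong-period m i)) ⟩
      ∑ m (λ j → + m * δ m j 0 + - (+ m′ * δ m′ j 0))
        ≡⟨ ∑-cong m (λ j → cong₂ _+_ (cong (+ m *_) (δ-symm m j 0)) (trans (cong (λ x → - (+ m′ * x)) (δ-symm m′ j 0)) (ℤ.neg-distribˡ-* (+ m′) (δ m′ 0 j)))) ⟩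
      ∑ m (λ j → + m * δ m 0 j + (- + m′) * δ m′ 0 j)
        ≡⟨ trans (∑-+ m _ _) (cong₂ _+_ (∑-*ˡ m (+ m) _) (∑-*ˡ m (- + m′) _)) ⟩
      + m * ∑ m (δ m 0) + (- + m′) * ∑ m (δ m′ 0)
        ≡⟨ cong₂ (λ x y → + m * x + (- + m′) * y) (∑-δ-1 m 0)
             (trans (∑-blocks s m′ _ λ i → δ-resp₂ m′ 0 (Cong-period m′ i)) (cong (+ s *_) (∑-δ-1 m′ 0))) ⟩
      + m * 1ℤ + (- + m′) * (+ s * 1ℤ)
        ≡⟨ cong (λ M → M * 1ℤ + (- + m′) * (+ s * 1ℤ)) (ℤ.pos-* s m′) ⟩
      (+ s * + m′) * 1ℤ + (- + m′) * (+ s * 1ℤ)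
        ≡⟨ cancel (+ s) (+ m′) ⟩
      0ℤ ∎
      where
      open ≡-Reasoning
      cancel : ∀ s m → (s * m) * 1ℤ + (- m) * (s * 1ℤ) ≡ 0ℤ
      cancel = solve-∀

    -- Shifting by an e that is 1 modulo m and 0 modulo M moves only the atom, so the sum
    -- equals its average over all shifts of the atom, which vanishes.
    module _ {M N : ℕ} (k : Kernel) (k-resp : Resp M k) (m∣N : m ℕ.∣ N) (M∣N : M ℕ.∣ N)
             (e : ℕ) (e≡1 : Cong m e 1) (e≡0 : Cong M e 0) where
      ⊗-mean : ∑ N (λ a → K (atom ⊗ k) a 0) ≡ 0ℤ
      ⊗-mean = ℤ.*-cancelˡ-≡ (+ m) S 0ℤ (begin
        + m * S
          ≡⟨ ∑-const m S ⟨
        ∑ m (λ j → S)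
          ≡⟨ ∑-cong m (λ j → ∑-shift N (j ℕ.* e) _ (λ a → Resp-⊗ atom k (Resp-weaken atom m∣N atom-resp) (Resp-weaken k M∣N k-resp) 0 (Cong-period N a))) ⟨
        ∑ m (λ j → ∑ N (λ a → atomK (j ℕ.* e ℕ.+ a) 0 * K k (j ℕ.* e ℕ.+ a) 0))
          ≡⟨ ∑-cong m (λ j → ∑-cong N λ a → cong₂ _*_
               (trans (atom-resp 0 (Cong-+ (Cong-*1 j e≡1) (Cong-reflexive m refl))) (cong (λ x → atomK x 0) (ℕ.+-comm j a)))
               (k-resp 0 (Cong-+ (Cong-*0 j e≡0) (Cong-reflexive M refl)))) ⟩
        ∑ m (λ j → ∑ N (λ a → atomK (a ℕ.+ j) 0 * K k a 0))
          ≡⟨ ∑-swap m N _ ⟩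
        ∑ N (λ a → ∑ m (λ j → atomK (a ℕ.+ j) 0 * K k a 0))
          ≡⟨ ∑-cong N (λ a → trans (∑-*ʳ m (K k a 0) _) (cong (_* K k a 0) (atom-mean a))) ⟩
        ∑ N (λ a → 0ℤ)
          ≡⟨ ∑-zero N ⟩
        0ℤ
          ≡⟨ ℤ.*-zeroʳ (+ m) ⟨
        + m * 0ℤ ∎)
        where
        open ≡-Reasoning
        S = ∑ N (λ a → K (atom ⊗ k) a 0)

  -- The Chinese remainder idempotent.
  coprime⇒crt : ∀ {m M} → Coprime m M → Σ ℕ λ e → Cong m e 1 × Cong M e 0
  coprime⇒crt {m} {M} c with coprime-Bézout c
  ... | Bézout.-+ x y eq = y ℕ.* M , congruent (divides (+ x) eq₁) , ∣⇒Cong0 (ℕ.n∣m*n y)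
    where
    lemma : ∀ t → (1ℤ + t) - 1ℤ ≡ t
    lemma = solve-∀
    eq₁ : + (y ℕ.* M) - 1ℤ ≡ + x * + m
    eq₁ = trans (cong (λ t → + t - 1ℤ) (sym eq)) (trans (cong (_- 1ℤ) (ℤ.pos-+ 1 (x ℕ.* m))) (trans (lemma (+ (x ℕ.* m))) (ℤ.pos-* x m)))
  -- Here y M ≡ -1 modulo m; squaring makes it 1 without leaving ℕ.
  ... | Bézout.+- x y eq = t ℕ.* t , congruent (divides (+ x * (+ t - 1ℤ)) eq₁) , ∣⇒Cong0 (ℕ.∣n⇒∣m*n t (ℕ.n∣m*n y))
    where
    t = y ℕ.* M
    lemma : ∀ t → t * t - 1ℤ ≡ (1ℤ + t) * (t - 1ℤ)
    lemma = solve-∀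
    swap : ∀ x m u → (x * m) * u ≡ (x * u) * m
    swap = solve-∀
    eq₁ : + (t ℕ.* t) - 1ℤ ≡ + x * (+ t - 1ℤ) * + m
    eq₁ = trans (cong (_- 1ℤ) (ℤ.pos-* t t)) (trans (lemma (+ t))
      (trans (cong (_* (+ t - 1ℤ)) (trans (sym (ℤ.pos-+ 1 t)) (trans (cong +_ eq) (ℤ.pos-* x m)))) (swap (+ x) (+ m) (+ t - 1ℤ))))

-- Ramanujan sums of squarefree order, with or without an extra factor of order 4.

module PrimeKernels where
  open RangeSums
  open PositiveKernels
  open RamanujanKernels
  open import Data.Nat as ℕ using (ℕ; zero; suc; pred; NonZero)
  import Data.Nat.Properties as ℕ
  import Data.Nat.Divisibility as ℕ
  open import Data.Nat.Coprimality using (Coprime)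
  open import Data.Nat.Primality using (Prime; prime[2]; prime⇒nonZero; prime⇒nonTrivial; prime⇒irreducible; euclidsLemma; ¬prime[1])
  open import Data.Nat.Primality.Factorisation using (factorisationHasAllPrimeFactors)
  open import Data.Integer using (ℤ; +_; -_; _+_; _-_; _*_; _≤_; _<_; 0ℤ; 1ℤ; ∣_∣)
  import Data.Integer.Properties as ℤ
  open import Data.Integer.Tactic.RingSolver using (solve-∀)
  open import Data.List using (List; []; _∷_; map)
  open import Data.List.Relation.Unary.All as All using (All; []; _∷_)
  open import Data.List.Relation.Unary.Any using (here; there)
  open import Data.List.Relation.Unary.AllPairs using ([]; _∷_)
  open import Data.List.Relation.Unary.Unique.Propositional using (Unique)
  open import Data.List.Membership.Propositional using (_∈_; _∉_)
  open import Data.List.Relation.Binary.Permutation.Propositional as Perm using (_↭_)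
  open import Data.Nat.ListAction using (product)
  open import Data.Nat.ListAction.Properties using (∈⇒∣product)
  open import Data.Product using (_,_)
  open import Data.Sum using (inj₁; inj₂)
  open import Data.Empty using (⊥-elim)
  open import Relation.Nullary using (¬_)
  open import Relation.Binary.PropositionalEquality using (_≡_; _≢_; refl; sym; trans; cong; cong₂; subst; module ≡-Reasoning)
  open Kernel using (K; K₀)

  prime∤⇒coprime : ∀ {l M} → Prime l → ¬ l ℕ.∣ M → Coprime l M
  prime∤⇒coprime pl l∤M {d} (d∣l , d∣M) with prime⇒irreducible pl d∣l
  ... | inj₁ d≡1 = d≡1
  ... | inj₂ refl = ⊥-elim (l∤M d∣M)

  prime∤product : ∀ {l D} → Prime l → All Prime D → l ∉ D → ¬ l ℕ.∣ product D
  prime∤product pl pD l∉D l∣ = l∉D (factorisationHasAllPrimeFactors pl l∣ pD)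

  All≢⇒∉ : ∀ {l : ℕ} {D} → All (l ≢_) D → l ∉ D
  All≢⇒∉ l≢ l∈D = All.lookup l≢ l∈D refl

  product-distinct-primes-∣ : ∀ {N D} → All Prime D → Unique D → All (ℕ._∣ N) D → product D ℕ.∣ N
  product-distinct-primes-∣ {N} [] [] [] = ℕ.1∣ N
  product-distinct-primes-∣ {N} {l ∷ D} (pl ∷ pD) (l≢ ∷ uD) (l∣N ∷ D∣N)
    with ℕ.divides c eq ← product-distinct-primes-∣ pD uD D∣N
    with euclidsLemma c (product D) pl (subst (l ℕ.∣_) eq l∣N)
  ... | inj₁ l∣c = subst (l ℕ.* product D ℕ.∣_) (sym eq) (ℕ.*-monoˡ-∣ (product D) l∣c)
  ... | inj₂ l∣Π = ⊥-elim (prime∤product pl pD (All≢⇒∉ l≢) l∣Π)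

  coprime-4 : ∀ {M} → ¬ 2 ℕ.∣ M → Coprime 4 M
  coprime-4 2∤M {0} (d∣4 , _) = ⊥-elim (ℕ.1+n≢0 (ℕ.0∣⇒≡0 d∣4))
  coprime-4 2∤M {1} _ = refl
  coprime-4 2∤M {2} (_ , d∣M) = ⊥-elim (2∤M d∣M)
  coprime-4 2∤M {3} (d∣4 , _) with () ← ℕ.n∣m⇒m%n≡0 4 3 d∣4
  coprime-4 2∤M {4} (_ , d∣M) = ⊥-elim (2∤M (ℕ.∣-trans (ℕ.divides 2 refl) d∣M))
  coprime-4 2∤M {suc (suc (suc (suc (suc _))))} (d∣4 , _) with ℕ.s≤s (ℕ.s≤s (ℕ.s≤s (ℕ.s≤s ()))) ← ℕ.∣⇒≤ d∣4

  -- The value at 0 is a filler, since `atom` wants a nonzero modulus; the indices that matter are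
  -- primes.
  primeKernel : ℕ → Kernel
  primeKernel zero    = one
  primeKernel (suc l) = atom (suc l) 1

  ker : List ℕ → Kernel
  ker []      = one
  ker (l ∷ D) = primeKernel l ⊗ ker D

  -- For distinct primes this is Euler's function of their product: the number of characters of that
  -- exact order, and hence the value of `ker D` on the diagonal.
  φ : List ℕ → ℕ
  φ D = product (map pred D)

  primeKernel-value : ∀ l .{{_ : NonZero l}} a → K (primeKernel l) 0 a ≡ + l * 𝟙 (l ℕ.∣? a) - 1ℤ
  primeKernel-value l@(suc _) a = cong₂ (λ x y → x - y)
    (trans (cong (λ m → + m * δ m 0 a) (ℕ.*-identityʳ l))
           (cong (+ l *_) (𝟙-cong (cong? l 0 a) (l ℕ.∣? a) (λ e → Cong0⇒∣ (Cong-sym e)) (λ d → Cong-sym (∣⇒Cong0 d)))))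
    (cong (1ℤ *_) (𝟙-yes (cong? 1 0 a) (Cong-sym (∣⇒Cong0 (ℕ.1∣ a)))))

  K₀-primeKernel : ∀ l .{{_ : NonZero l}} → K₀ (primeKernel l) ≡ + pred l
  K₀-primeKernel l@(suc l′) = trans (primeKernel-value l 0)
    (trans (cong (λ x → + l * x - 1ℤ) (𝟙-yes (l ℕ.∣? 0) (l ℕ.∣0))) (trans (cong (λ x → x * 1ℤ - 1ℤ) (ℤ.pos-+ 1 l′)) (lemma (+ l′))))
    where
    lemma : ∀ x → (1ℤ + x) * 1ℤ - 1ℤ ≡ x
    lemma = solve-∀

  K₀-ker : ∀ {D} → All Prime D → K₀ (ker D) ≡ + φ D
  K₀-ker []                = refl
  K₀-ker {l ∷ D} (pl ∷ pD) = trans (cong₂ _*_ (K₀-primeKernel l {{prime⇒nonZero pl}}) (K₀-ker pD)) (sym (ℤ.pos-* (pred l) (φ D)))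

  φ>0 : ∀ {D} → All Prime D → 0 ℕ.< φ D
  φ>0 []                      = ℕ.z<s
  φ>0 {l ∷ D} (pl ∷ pD) = ℕ.*-mono-< (ℕ.<⇒≤pred (ℕ.nonTrivial⇒n>1 l {{prime⇒nonTrivial pl}})) (φ>0 pD)

  ker-↭ : ∀ {D D′} → D ↭ D′ → ∀ a b → K (ker D) a b ≡ K (ker D′) a b
  ker-↭ Perm.refl         a b = refl
  ker-↭ (Perm.prep l p)   a b = cong (K (primeKernel l) a b *_) (ker-↭ p a b)
  ker-↭ {l ∷ m ∷ D} (Perm.swap l m p) a b =
    trans (cong (λ x → K (primeKernel l) a b * (K (primeKernel m) a b * x)) (ker-↭ p a b)) (lemma (K (primeKernel l) a b) (K (primeKernel m) a b) _)
    where
    lemma : ∀ x y z → x * (y * z) ≡ y * (x * z)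
    lemma = solve-∀
  ker-↭ (Perm.trans p p′) a b = trans (ker-↭ p a b) (ker-↭ p′ a b)

  primeKernel-resp : ∀ {M} l → l ℕ.∣ M → Resp M (primeKernel l)
  primeKernel-resp zero    _ = λ _ _ → refl
  primeKernel-resp {M} l@(suc _) d = Resp-weaken (primeKernel l) (subst (ℕ._∣ M) (sym (ℕ.*-identityʳ l)) d) (atom-resp l 1)

  ker-resp : ∀ {M D} → All (ℕ._∣ M) D → Resp M (ker D)
  ker-resp []                  = λ _ _ → refl
  ker-resp {D = l ∷ D} (d ∷ ds) = Resp-⊗ (primeKernel l) (ker D) (primeKernel-resp l d) (ker-resp ds)

  ker-resp-product : ∀ D → Resp (product D) (ker D)
  ker-resp-product D = ker-resp {D = D} (All.tabulate ∈⇒∣product)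

  resp₂ : ∀ {M} k → Resp M k → ∀ a {b b′} → Cong M b b′ → K k a b ≡ K k a b′
  resp₂ k r a {b} {b′} e = trans (Kernel.symm k a b) (trans (r a e) (Kernel.symm k b′ a))

  -- The list must be nonempty: `ker []` is the trivial character, with sum `N`. The remainder
  -- idempotent for `l` against the other primes supplies the shift that moves the first factor
  -- alone.
  ker-mean : ∀ {N l D} → All Prime (l ∷ D) → Unique (l ∷ D) → All (ℕ._∣ N) (l ∷ D) → ∑ N (λ a → K (ker (l ∷ D)) a 0) ≡ 0ℤ
  ker-mean {N} {l@(suc _)} {D} (pl ∷ pD) (l≢ ∷ uD) (l∣N ∷ D∣N)
    with e , e≡1 , e≡0 ← coprime⇒crt (prime∤⇒coprime pl (prime∤product pl pD (All≢⇒∉ l≢))) =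
    ⊗-mean l 1 (ker D) (ker-resp-product D) (subst (ℕ._∣ N) (sym (ℕ.*-identityʳ l)) l∣N) (product-distinct-primes-∣ pD uD D∣N)
      e (subst (λ m → Cong m e 1) (sym (ℕ.*-identityʳ l)) e≡1) e≡0
  ker-mean {l = zero} (pl ∷ _) with () ← prime⇒nonZero pl

  ker4 : List ℕ → Kernel
  ker4 D = atom 2 2 ⊗ ker D

  ker4-mean : ∀ {N D} → All Prime D → Unique D → 2 ∉ D → 4 ℕ.∣ N → All (ℕ._∣ N) D → ∑ N (λ a → K (ker4 D) a 0) ≡ 0ℤ
  ker4-mean {N} {D} pD uD 2∉D 4∣N D∣N
    with e , e≡1 , e≡0 ← coprime⇒crt (coprime-4 (prime∤product prime[2] pD 2∉D)) =
    ⊗-mean 2 2 (ker D) (ker-resp-product D) 4∣N (product-distinct-primes-∣ pD uD D∣N) e e≡1 e≡0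

  2∣n+n : ∀ n → 2 ℕ.∣ n ℕ.+ n
  2∣n+n n = ℕ.divides n (trans (cong (n ℕ.+_) (sym (ℕ.+-identityʳ n))) (ℕ.*-comm 2 n))

  2∤1+n+n : ∀ n → ¬ 2 ℕ.∣ suc (n ℕ.+ n)
  2∤1+n+n n d = ℕ.1+n≢n {1} (sym (ℕ.∣-antisym (ℕ.1∣ 2) (ℕ.∣m+n∣m⇒∣n (subst (2 ℕ.∣_) (ℕ.+-comm 1 (n ℕ.+ n)) d) (2∣n+n n))))

  odd-prime-∣-double : ∀ {l} → Prime l → l ≢ 2 → ∀ a → l ℕ.∣ a ℕ.+ a → l ℕ.∣ a
  odd-prime-∣-double {l} pl l≢2 a d with euclidsLemma 2 a pl (subst (λ x → l ℕ.∣ a ℕ.+ x) (sym (ℕ.+-identityʳ a)) d)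
  ... | inj₂ l∣a = l∣a
  ... | inj₁ l∣2 with prime⇒irreducible prime[2] l∣2
  ...   | inj₁ refl = ⊥-elim (¬prime[1] pl)
  ...   | inj₂ l≡2  = ⊥-elim (l≢2 l≡2)

  -- Doubling is invertible modulo an odd prime, so c_d(ξ²) = c_d(ξ) for odd d.
  ker-double : ∀ {D} → All Prime D → 2 ∉ D → ∀ a → K (ker D) 0 (a ℕ.+ a) ≡ K (ker D) 0 a
  ker-double [] _ a = refl
  ker-double {l ∷ D} (pl ∷ pD) 2∉ a = cong₂ _*_
    (trans (primeKernel-value l (a ℕ.+ a)) (trans
      (cong (λ x → + l * x - 1ℤ) (𝟙-cong (l ℕ.∣? (a ℕ.+ a)) (l ℕ.∣? a) (odd-prime-∣-double pl (λ e → 2∉ (here (sym e))) a) (λ d → ℕ.∣m∣n⇒∣m+n d d)))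
      (sym (primeKernel-value l a))))
    (ker-double pD (λ i → 2∉ (there i)) a)
    where instance _ = prime⇒nonZero pl

  c₂-even : ∀ a → K (primeKernel 2) 0 (a ℕ.+ a) ≡ 1ℤ
  c₂-even a = trans (primeKernel-value 2 (a ℕ.+ a)) (cong (λ x → + 2 * x - 1ℤ) (𝟙-yes (2 ℕ.∣? (a ℕ.+ a)) (2∣n+n a)))

  c₂-odd : ∀ a → K (primeKernel 2) 0 (suc (a ℕ.+ a)) ≡ - 1ℤ
  c₂-odd a = trans (primeKernel-value 2 (suc (a ℕ.+ a))) (cong (λ x → + 2 * x - 1ℤ) (𝟙-no (2 ℕ.∣? suc (a ℕ.+ a)) (2∤1+n+n a)))

  -- At x = ξ² this reads c₄(x) = 2 c₂(ξ), while c₄ vanishes off the squares; this is how an even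
  -- order in ξ turns into twice that order in x.
  c₄-even : ∀ a → K (atom 2 2) 0 (a ℕ.+ a) ≡ + 2 * K (primeKernel 2) 0 a
  c₄-even a = trans (cong₂ (λ x y → + 4 * x - + 2 * y)
      (𝟙-cong (cong? 4 0 (a ℕ.+ a)) (2 ℕ.∣? a)
        (λ e → ℕ.*-cancelˡ-∣ 2 (subst (4 ℕ.∣_) (cong (a ℕ.+_) (sym (ℕ.+-identityʳ a))) (Cong0⇒∣ (Cong-sym e))))
        (λ d → Cong-sym (∣⇒Cong0 (subst (4 ℕ.∣_) (cong (a ℕ.+_) (ℕ.+-identityʳ a)) (ℕ.*-monoʳ-∣ 2 d)))))
      (𝟙-yes (cong? 2 0 (a ℕ.+ a)) (Cong-sym (∣⇒Cong0 (2∣n+n a)))))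
    (trans (lemma (𝟙 (2 ℕ.∣? a))) (cong (+ 2 *_) (sym (primeKernel-value 2 a))))
    where
    lemma : ∀ x → + 4 * x - + 2 * 1ℤ ≡ + 2 * (+ 2 * x - 1ℤ)
    lemma = solve-∀

  c₄-odd : ∀ a → K (atom 2 2) 0 (suc (a ℕ.+ a)) ≡ 0ℤ
  c₄-odd a = cong₂ (λ x y → + 4 * x - + 2 * y)
    (𝟙-no (cong? 4 0 (suc (a ℕ.+ a))) λ e → 2∤1+n+n a (ℕ.∣-trans (ℕ.divides 2 refl) (Cong0⇒∣ (Cong-sym e))))
    (𝟙-no (cong? 2 0 (suc (a ℕ.+ a))) λ e → 2∤1+n+n a (Cong0⇒∣ (Cong-sym e)))

-- Bounds for the sums of c_d over Tr(x) = β and over Tr(ξ²) = β.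

module TraceSumBounds where
  open import Relation.Binary.PropositionalEquality using (_≡_; _≢_; setoid; refl; sym; trans; cong; cong₂; subst; subst₂; module ≡-Reasoning)
  open RangeSums
  open PositiveKernels
  open SecondMoments
  open RamanujanKernels
  open PrimeKernels
  open import Data.Nat as ℕ using (ℕ; zero; suc; pred)
  import Data.Nat.Properties as ℕ
  open import Algebra.Properties.CommutativeSemigroup ℕ.+-commutativeSemigroup using () renaming (interchange to ℕ-interchange)
  import Data.Nat.Divisibility as ℕ
  open import Data.Nat.Primality using (Prime; prime[2])
  open import Data.Integer using (ℤ; +_; -[1+_]; -_; _+_; _-_; _*_; _≤_; _<_; 0ℤ; 1ℤ; +≤+; +<+; -≤+; ∣_∣)
  import Data.Integer.Properties as ℤ
  open import Data.Integer.Tactic.RingSolver using (solve-∀)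
  open import Data.List using (List; []; _∷_; _++_)
  open import Data.List.Relation.Unary.All as All using (All; []; _∷_)
  open import Data.List.Relation.Unary.AllPairs using ([]; _∷_; head; tail)
  open import Data.List.Relation.Unary.Unique.Propositional using (Unique)
  open import Data.List.Membership.Propositional using (_∈_; _∉_)
  open import Data.List.Membership.Propositional.Properties using (∈-∃++)
  open import Data.List.Membership.DecPropositional ℕ._≟_ using (_∈?_)
  open import Data.List.Relation.Binary.Permutation.Propositional as Perm using (_↭_; ↭-trans; ↭-reflexive; ↭⇒↭ₛ)
  open import Data.List.Relation.Binary.Permutation.Setoid.Properties (setoid ℕ) using (Unique-resp-↭)
  open import Data.List.Relation.Binary.Permutation.Propositional.Properties using (All-resp-↭; shift; map⁺)
  open import Data.Nat.ListAction.Properties using (product-↭)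
  open import Data.Product using (_×_; _,_)
  open import Data.Empty using (⊥-elim)
  open import Relation.Nullary using (¬_; yes; no)
  open Kernel using (K; K₀)

  square-≤⇒≤ : ∀ {x y} → x ℕ.* x ℕ.≤ y ℕ.* y → x ℕ.≤ y
  square-≤⇒≤ {x} {y} le with x ℕ.≤? y
  ... | yes x≤y = x≤y
  ... | no  x≰y = ⊥-elim (ℕ.<⇒≱ (ℕ.*-mono-< (ℕ.≰⇒> x≰y) (ℕ.≰⇒> x≰y)) le)

  ∣∣-square : ∀ i → i * i ≡ + (∣ i ∣ ℕ.* ∣ i ∣)
  ∣∣-square (+ n)    = sym (ℤ.pos-* n n)
  ∣∣-square -[1+ n ] = refl

  -- u / v is a rational upper bound for q^(-1/2), where q = suc J: 1/3 for q ≥ 9 and 56/125 for q = 5.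
  module TraceSums {N J Q Z Y P H u v : ℕ} (td : TraceData N J Q Z Y) (Y≡P² : Y ≡ P ℕ.* P)
    (N≡H+H : N ≡ H ℕ.+ H) (2∣H : 2 ℕ.∣ H) (2∤Q : ¬ 2 ℕ.∣ Q) (v²≤u²q : v ℕ.* v ℕ.≤ (u ℕ.* u) ℕ.* suc J) where
    open TraceData td

    Admissible : List ℕ → Set
    Admissible D = All Prime D × Unique D × All (ℕ._∣ N) D

    U : Kernel → ℤ
    U k = ∑ N (λ b → w 0 b * K k 0 b)

    -- Sums over ξ with Tr(ξ²) = β: `a` is the exponent of ξ and `a + a` that of ξ². The sums `U`
    -- run over x with Tr(x) = β instead.
    T : List ℕ → ℤ
    T D = ∑ N (λ a → w 0 (a ℕ.+ a) * K (ker D) 0 a)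

    4∣N : 4 ℕ.∣ N
    4∣N = subst (4 ℕ.∣_) (trans (cong (H ℕ.+_) (ℕ.+-identityʳ H)) (sym N≡H+H)) (ℕ.*-monoʳ-∣ 2 2∣H)

    2∣N : 2 ℕ.∣ N
    2∣N = ℕ.∣-trans (ℕ.divides 2 refl) 4∣N

    prime-∣H : ∀ {l} → Prime l → l ℕ.∣ N → l ℕ.∣ H
    prime-∣H {l} pl l∣N with l ℕ.≟ 2
    ... | yes refl = 2∣H
    ... | no  l≢2  = odd-prime-∣-double pl l≢2 H (subst (l ℕ.∣_) N≡H+H l∣N)

    module _ {D : List ℕ} (pD : All Prime D) (D∣N : All (ℕ._∣ N) D) where
      D∣H : All (ℕ._∣ H) D
      D∣H = All.zipWith (λ (p , d) → prime-∣H p d) (pD , D∣N)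

      -- The elements ξ and -ξ = g^H ξ have the same square, and c_d does not distinguish them
      -- because every prime in `D` divides `H`. For the prime 2 this rests on 4 dividing `N`.
      T-half : T D ≡ + 2 * ∑ H (λ a → w 0 (a ℕ.+ a) * K (ker D) 0 a)
      T-half = begin
        ∑ N f                                    ≡⟨ cong (λ n → ∑ n f) N≡H+H ⟩
        ∑ (H ℕ.+ H) f                            ≡⟨ ∑-split H H f ⟩
        ∑ H f + ∑ H (λ a → f (H ℕ.+ a))          ≡⟨ cong (λ x → ∑ H f + x) (∑-cong H per) ⟩
        ∑ H f + ∑ H f                            ≡⟨ lemma (∑ H f) ⟩
        + 2 * ∑ H f                              ∎
        where
        open ≡-Reasoning
        f : ℕ → ℤ
        f a = w 0 (a ℕ.+ a) * K (ker D) 0 a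
        lemma : ∀ x → x + x ≡ + 2 * x
        lemma = solve-∀
        index : ∀ a → (H ℕ.+ a) ℕ.+ (H ℕ.+ a) ≡ N ℕ.+ (a ℕ.+ a)
        index a = trans (ℕ-interchange H a H a) (cong (ℕ._+ (a ℕ.+ a)) (sym N≡H+H))
        per : ∀ a → f (H ℕ.+ a) ≡ f a
        per a = cong₂ _*_ (trans (cong (w 0) (index a)) (w-per 0 (a ℕ.+ a))) (resp₂ (ker D) (ker-resp D∣H) 0 (Cong-period H a))

      -- The right side sums (1 + c₂(x)) c_d(x) over Tr(x) = β, and 1 + c₂(x) is the number of
      -- square roots of x.
      T-odd : 2 ∉ D → T D ≡ U (ker D) + U (ker (2 ∷ D))
      T-odd 2∉D = sym (begin
        U (ker D) + U (ker (2 ∷ D))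
          ≡⟨ ∑-+ N _ _ ⟨
        ∑ N f
          ≡⟨ cong (λ n → ∑ n f) N≡H+H ⟩
        ∑ (H ℕ.+ H) f
          ≡⟨ ∑-pairs H f ⟩
        ∑ H (λ a → f (a ℕ.+ a) + f (suc (a ℕ.+ a)))
          ≡⟨ ∑-cong H step ⟩
        ∑ H (λ a → + 2 * (w 0 (a ℕ.+ a) * K (ker D) 0 a))
          ≡⟨ ∑-*ˡ H (+ 2) _ ⟩
        + 2 * ∑ H (λ a → w 0 (a ℕ.+ a) * K (ker D) 0 a)
          ≡⟨ T-half ⟨
        T D ∎)
        where
        open ≡-Reasoning
        f : ℕ → ℤ
        f b = w 0 b * K (ker D) 0 b + w 0 b * (K (primeKernel 2) 0 b * K (ker D) 0 b)
        lemma : ∀ x k y k′ → (x * k + x * (1ℤ * k)) + (y * k′ + y * ((- 1ℤ) * k′)) ≡ + 2 * (x * k)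
        lemma = solve-∀
        step : ∀ a → f (a ℕ.+ a) + f (suc (a ℕ.+ a)) ≡ + 2 * (w 0 (a ℕ.+ a) * K (ker D) 0 a)
        step a = trans
          (cong₂ _+_ (cong₂ (λ c k → w 0 (a ℕ.+ a) * k + w 0 (a ℕ.+ a) * (c * k)) (c₂-even a) (ker-double pD 2∉D a))
                     (cong (λ c → w 0 (suc (a ℕ.+ a)) * K (ker D) 0 (suc (a ℕ.+ a)) + w 0 (suc (a ℕ.+ a)) * (c * K (ker D) 0 (suc (a ℕ.+ a)))) (c₂-odd a)))
          (lemma (w 0 (a ℕ.+ a)) (K (ker D) 0 a) (w 0 (suc (a ℕ.+ a))) (K (ker D) 0 (suc (a ℕ.+ a))))

    T-even : ∀ {D} → All Prime (2 ∷ D) → All (ℕ._∣ N) (2 ∷ D) → 2 ∉ D → T (2 ∷ D) ≡ U (ker4 D)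
    T-even {D} pD D∣N 2∉D = sym (begin
      ∑ N f
        ≡⟨ cong (λ n → ∑ n f) N≡H+H ⟩
      ∑ (H ℕ.+ H) f
        ≡⟨ ∑-pairs H f ⟩
      ∑ H (λ a → f (a ℕ.+ a) + f (suc (a ℕ.+ a)))
        ≡⟨ ∑-cong H step ⟩
      ∑ H (λ a → + 2 * (w 0 (a ℕ.+ a) * K (ker (2 ∷ D)) 0 a))
        ≡⟨ ∑-*ˡ H (+ 2) _ ⟩
      + 2 * ∑ H (λ a → w 0 (a ℕ.+ a) * K (ker (2 ∷ D)) 0 a)
        ≡⟨ T-half pD D∣N ⟨
      T (2 ∷ D) ∎)
      where
      open ≡-Reasoning
      f : ℕ → ℤ
      f b = w 0 b * (K (atom 2 2) 0 b * K (ker D) 0 b)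
      lemma : ∀ x c k y k′ → x * ((+ 2 * c) * k) + y * (0ℤ * k′) ≡ + 2 * (x * (c * k))
      lemma = solve-∀
      step : ∀ a → f (a ℕ.+ a) + f (suc (a ℕ.+ a)) ≡ + 2 * (w 0 (a ℕ.+ a) * K (ker (2 ∷ D)) 0 a)
      step a = trans
        (cong₂ _+_ (cong₂ (λ c k → w 0 (a ℕ.+ a) * (c * k)) (c₄-even a) (ker-double (All.tail pD) 2∉D a))
                   (cong (λ c → w 0 (suc (a ℕ.+ a)) * (c * K (ker D) 0 (suc (a ℕ.+ a)))) (c₄-odd a)))
        (lemma (w 0 (a ℕ.+ a)) (K (primeKernel 2) 0 a) (K (ker D) 0 a) (w 0 (suc (a ℕ.+ a))) (K (ker D) 0 (suc (a ℕ.+ a))))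

    module _ (k : Kernel) (k-resp : Resp N k) (k-mean : ∑ N (λ a → K k a 0) ≡ 0ℤ) (f : ℕ) (K₀≡f : K₀ k ≡ + f) (f>0 : 0 ℕ.< f) where
      private
        module M = Moments td k (λ b a → k-resp b (Cong-period N a)) k-mean
        0<K₀ : 0ℤ < K₀ k
        0<K₀ = subst (0ℤ <_) (sym K₀≡f) (+<+ f>0)
        rhs : K₀ k * K₀ k * + Y ≡ + ((f ℕ.* P) ℕ.* (f ℕ.* P))
        rhs = trans (cong₂ (λ x y → x * x * + y) K₀≡f Y≡P²) (trans (cong (_* + (P ℕ.* P)) (sym (ℤ.pos-* f f)))
          (trans (sym (ℤ.pos-* (f ℕ.* f) (P ℕ.* P))) (cong +_ (ℕ.[m*n]*[o*p]≡[m*o]*[n*p] f f P P))))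

      ∣U∣-bound : ∣ U k ∣ ℕ.≤ f ℕ.* P
      ∣U∣-bound = square-≤⇒≤ (ℤ.drop‿+≤+ (subst₂ _≤_ (∣∣-square (U k)) rhs (M.U-bound 0<K₀)))

      -- The factor q = `suc J` in the exact second moment is replaced by its lower bound v² / u²,
      -- so that the square root can be taken in ℕ.
      ∣U∣-bound-inv : Resp Q k → v ℕ.* ∣ U k ∣ ℕ.≤ u ℕ.* (f ℕ.* P)
      ∣U∣-bound-inv k-inv = square-≤⇒≤ (begin
        (v ℕ.* x) ℕ.* (v ℕ.* x)          ≡⟨ ℕ.[m*n]*[o*p]≡[m*o]*[n*p] v x v x ⟩
        (v ℕ.* v) ℕ.* (x ℕ.* x)          ≤⟨ ℕ.*-monoˡ-≤ (x ℕ.* x) v²≤u²q ⟩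
        (u ℕ.* u) ℕ.* suc J ℕ.* (x ℕ.* x) ≡⟨ ℕ.*-assoc (u ℕ.* u) (suc J) (x ℕ.* x) ⟩
        (u ℕ.* u) ℕ.* (suc J ℕ.* (x ℕ.* x)) ≤⟨ ℕ.*-monoʳ-≤ (u ℕ.* u) q∣U∣² ⟩
        (u ℕ.* u) ℕ.* ((f ℕ.* P) ℕ.* (f ℕ.* P)) ≡⟨ ℕ.[m*n]*[o*p]≡[m*o]*[n*p] u u (f ℕ.* P) (f ℕ.* P) ⟩
        (u ℕ.* (f ℕ.* P)) ℕ.* (u ℕ.* (f ℕ.* P)) ∎)
        where
        open ℕ.≤-Reasoning
        x = ∣ U k ∣
        q∣U∣² : suc J ℕ.* (x ℕ.* x) ℕ.≤ (f ℕ.* P) ℕ.* (f ℕ.* P)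
        q∣U∣² = ℤ.drop‿+≤+ (subst₂ _≤_ (trans (cong ((1ℤ + + J) *_) (∣∣-square (U k))) (sym (ℤ.pos-* (suc J) (x ℕ.* x)))) rhs
          (M.U-bound-inv 0<K₀ (λ b a → k-inv b (Cong-period Q a))))

    U-ker-bound : ∀ {l D} → Admissible (l ∷ D) → ∣ U (ker (l ∷ D)) ∣ ℕ.≤ φ (l ∷ D) ℕ.* P
    U-ker-bound {l} {D} (pD , uD , D∣N) = ∣U∣-bound (ker (l ∷ D)) (ker-resp D∣N) (ker-mean pD uD D∣N) (φ (l ∷ D)) (K₀-ker pD) (φ>0 pD)

    U-ker-bound-Q : ∀ {l D} → Admissible (l ∷ D) → All (ℕ._∣ Q) (l ∷ D) → v ℕ.* ∣ U (ker (l ∷ D)) ∣ ℕ.≤ u ℕ.* (φ (l ∷ D) ℕ.* P)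
    U-ker-bound-Q {l} {D} (pD , uD , D∣N) D∣Q = ∣U∣-bound-inv (ker (l ∷ D)) (ker-resp D∣N) (ker-mean pD uD D∣N) (φ (l ∷ D)) (K₀-ker pD) (φ>0 pD) (ker-resp D∣Q)

    cons-2 : ∀ {D} → Admissible D → 2 ∉ D → Admissible (2 ∷ D)
    cons-2 (pD , uD , D∣N) 2∉D = prime[2] ∷ pD , All.tabulate (λ i e → 2∉D (subst (_∈ _) (sym e) i)) ∷ uD , 2∣N ∷ D∣N

    U-ker₂-bound : ∀ {D} → Admissible D → 2 ∉ D → ∣ U (ker (2 ∷ D)) ∣ ℕ.≤ φ D ℕ.* P
    U-ker₂-bound {D} ad 2∉D = subst (λ x → ∣ U (ker (2 ∷ D)) ∣ ℕ.≤ x ℕ.* P) (ℕ.*-identityˡ (φ D)) (U-ker-bound (cons-2 ad 2∉D))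

    U-ker4-bound : ∀ {D} → Admissible D → 2 ∉ D → ∣ U (ker4 D) ∣ ℕ.≤ 2 ℕ.* φ D ℕ.* P
    U-ker4-bound {D} (pD , uD , D∣N) 2∉D = ∣U∣-bound (ker4 D) (Resp-⊗ (atom 2 2) (ker D) (Resp-weaken (atom 2 2) 4∣N (atom-resp 2 2)) (ker-resp D∣N))
      (ker4-mean pD uD 2∉D 4∣N D∣N) (2 ℕ.* φ D) (trans (cong (+ 2 *_) (K₀-ker pD)) (sym (ℤ.pos-* 2 (φ D)))) (ℕ.*-mono-< {0} {2} ℕ.z<s (φ>0 pD))

    T-↭ : ∀ {D D′} → D ↭ D′ → T D ≡ T D′
    T-↭ p = ∑-cong N λ a → cong (w 0 (a ℕ.+ a) *_) (ker-↭ p 0 a)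

    -- If 2 is not in the list, the orders d and 2d contribute φ(d) each. If it is, it is permuted
    -- to the front, and the single order 4d′ with d = 2d′ contributes φ(4d′) = 2 φ(d). Either way
    -- the total is 2 φ(d) P.
    T-bound : ∀ {l D} → Admissible (l ∷ D) → ∣ T (l ∷ D) ∣ ℕ.≤ 2 ℕ.* φ (l ∷ D) ℕ.* P
    T-bound {l} {D} ad@(pD , uD , D∣N) with 2 ∈? (l ∷ D)
    ... | no 2∉ = begin
      ∣ T (l ∷ D) ∣                                ≡⟨ cong ∣_∣ (T-odd pD D∣N 2∉) ⟩
      ∣ U (ker (l ∷ D)) + U (ker (2 ∷ l ∷ D)) ∣    ≤⟨ ℤ.∣i+j∣≤∣i∣+∣j∣ (U (ker (l ∷ D))) _ ⟩
      ∣ U (ker (l ∷ D)) ∣ ℕ.+ ∣ U (ker (2 ∷ l ∷ D)) ∣ ≤⟨ ℕ.+-mono-≤ (U-ker-bound ad) (U-ker₂-bound ad 2∉) ⟩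
      φ (l ∷ D) ℕ.* P ℕ.+ φ (l ∷ D) ℕ.* P          ≡⟨ cong (φ (l ∷ D) ℕ.* P ℕ.+_) (ℕ.+-identityʳ _) ⟨
      2 ℕ.* (φ (l ∷ D) ℕ.* P)                      ≡⟨ ℕ.*-assoc 2 (φ (l ∷ D)) P ⟨
      2 ℕ.* φ (l ∷ D) ℕ.* P                        ∎
      where open ℕ.≤-Reasoning
    ... | yes 2∈ with xs , ys , eq ← ∈-∃++ 2∈ = begin
      ∣ T (l ∷ D) ∣              ≡⟨ cong ∣_∣ (trans (T-↭ perm) (T-even pD′ D′∣N 2∉)) ⟩
      ∣ U (ker4 (xs ++ ys)) ∣    ≤⟨ U-ker4-bound (All.tail pD′ , tail uD′ , All.tail D′∣N) 2∉ ⟩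
      2 ℕ.* φ (xs ++ ys) ℕ.* P   ≡⟨ cong (λ x → 2 ℕ.* x ℕ.* P) (trans (sym (ℕ.*-identityˡ _)) (sym (product-↭ (map⁺ pred perm)))) ⟩
      2 ℕ.* φ (l ∷ D) ℕ.* P      ∎
      where
      open ℕ.≤-Reasoning
      perm : l ∷ D ↭ 2 ∷ xs ++ ys
      perm = ↭-trans (↭-reflexive eq) (shift 2 xs ys)
      pD′ = All-resp-↭ perm pD
      D′∣N = All-resp-↭ perm D∣N
      uD′ : Unique (2 ∷ xs ++ ys)
      uD′ = Unique-resp-↭ (↭⇒↭ₛ perm) uD
      2∉ : 2 ∉ xs ++ ys
      2∉ = All≢⇒∉ (head uD′)

    -- The saving q^(-1/2) applies to the order d, which divides `Q`, but not to 2d, because `Q` is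
    -- odd. Hence the factor u / v + 1 in place of 2.
    T-bound-Q : ∀ {l D} → Admissible (l ∷ D) → All (ℕ._∣ Q) (l ∷ D) → v ℕ.* ∣ T (l ∷ D) ∣ ℕ.≤ (u ℕ.+ v) ℕ.* (φ (l ∷ D) ℕ.* P)
    T-bound-Q {l} {D} ad@(pD , uD , D∣N) D∣Q = begin
      v ℕ.* ∣ T (l ∷ D) ∣                              ≡⟨ cong (λ x → v ℕ.* ∣ x ∣) (T-odd pD D∣N 2∉) ⟩
      v ℕ.* ∣ U (ker (l ∷ D)) + U (ker (2 ∷ l ∷ D)) ∣  ≤⟨ ℕ.*-monoʳ-≤ v (ℤ.∣i+j∣≤∣i∣+∣j∣ (U (ker (l ∷ D))) _) ⟩
      v ℕ.* (∣ U (ker (l ∷ D)) ∣ ℕ.+ ∣ U (ker (2 ∷ l ∷ D)) ∣) ≡⟨ ℕ.*-distribˡ-+ v _ _ ⟩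
      v ℕ.* ∣ U (ker (l ∷ D)) ∣ ℕ.+ v ℕ.* ∣ U (ker (2 ∷ l ∷ D)) ∣ ≤⟨ ℕ.+-mono-≤ (U-ker-bound-Q ad D∣Q) (ℕ.*-monoʳ-≤ v (U-ker₂-bound ad 2∉)) ⟩
      u ℕ.* (φ (l ∷ D) ℕ.* P) ℕ.+ v ℕ.* (φ (l ∷ D) ℕ.* P) ≡⟨ ℕ.*-distribʳ-+ (φ (l ∷ D) ℕ.* P) u v ⟨
      (u ℕ.+ v) ℕ.* (φ (l ∷ D) ℕ.* P)                  ∎
      where
      open ℕ.≤-Reasoning
      2∉ : 2 ∉ l ∷ D
      2∉ i = 2∤Q (All.lookup D∣Q i)

    -- Scaling shows that all nonzero trace values are taken equally often, so each is taken (N - Z)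
    -- / J = Y times.
    U-one : U one ≡ + (P ℕ.* P)
    U-one = ℤ.*-cancelˡ-≡ (+ J) _ _ (begin
      + J * U one                                ≡⟨ ∑-const J (U one) ⟨
      ∑ J (λ j → U one)                          ≡⟨ ∑-cong J level ⟩
      ∑ J (λ j → ∑ N (w j))                      ≡⟨ lemma (∑ N z) _ ⟩
      (∑ N z + ∑ J (λ j → ∑ N (w j))) - ∑ N z    ≡⟨ cong₂ _-_ all z-count ⟩
      + N - + Z                                  ≡⟨ sizes ⟩
      + J * + Y                                  ≡⟨ cong (λ y → + J * + y) Y≡P² ⟩
      + J * + (P ℕ.* P)                          ∎)
      where
      open ≡-Reasoning
      instance _ = ℕ.>-nonZero J>0
      lemma : ∀ x y → y ≡ (x + y) - x
      lemma = solve-∀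
      level : ∀ j → U one ≡ ∑ N (w j)
      level j = trans (∑-cong N λ a → trans (ℤ.*-identityʳ (w 0 a)) (sym (w-scale j a))) (∑-shift N (j ℕ.* Q) (w j) (w-per j))
      all : ∑ N z + ∑ J (λ j → ∑ N (w j)) ≡ + N
      all = trans (cong (λ x → ∑ N z + x) (∑-swap J N _)) (trans (sym (∑-+ N _ _)) (trans (∑-cong N total) (trans (∑-const N 1ℤ) (ℤ.*-identityʳ (+ N)))))

    -- `T []` is the main term P² plus the sum of c₂, whose absolute value is at most P.
    T-empty : + (P ℕ.* P) ≤ T [] + + P
    T-empty = subst (λ x → + (P ℕ.* P) ≤ x + + P) (sym (trans (T-odd [] [] (λ ())) (cong (_+ U (ker (2 ∷ []))) U-one)))
      (subst₂ _≤_ (ℤ.+-identityʳ _) (sym (ℤ.+-assoc (+ (P ℕ.* P)) (U (ker (2 ∷ []))) (+ P))) (ℤ.+-monoʳ-≤ (+ (P ℕ.* P)) (lower (U (ker (2 ∷ []))) (U-ker₂-bound ([] , [] , []) (λ ())))))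
      where
      lower : ∀ i → ∣ i ∣ ℕ.≤ 1 ℕ.* P → 0ℤ ≤ i + + P
      lower i le = subst (_≤ i + + P) (ℤ.+-inverseʳ i)
        (ℤ.+-monoʳ-≤ i (ℤ.≤-trans (neg≤abs i) (+≤+ (subst (∣ i ∣ ℕ.≤_) (ℕ.*-identityˡ P) le))))
        where
        neg≤abs : ∀ i → - i ≤ + ∣ i ∣
        neg≤abs (+ zero)  = ℤ.≤-refl
        neg≤abs (+ suc n) = -≤+
        neg≤abs -[1+ n ]  = ℤ.≤-refl

-- Sums restricted to elements free at given primes, and the prime sieve.

module SievedSums where
  open import Relation.Binary.PropositionalEquality using (_≡_; _≢_; refl; sym; trans; cong; cong₂; subst; module ≡-Reasoning)
  open RangeSums
  open PositiveKernels
  open SecondMoments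
  open PrimeKernels
  open TraceSumBounds
  open import Data.Nat as ℕ using (ℕ; suc; pred; NonZero)
  import Data.Nat.Properties as ℕ
  import Data.Nat.Divisibility as ℕ
  import Data.Nat.Tactic.RingSolver as ℕR
  open import Data.List.Relation.Unary.All.Properties using (++⁺)
  open import Data.Empty using (⊥)
  open import Data.Nat.Primality using (Prime; prime⇒nonZero)
  open import Data.Integer using (ℤ; +_; -[1+_]; -_; _+_; _-_; _*_; _≤_; _<_; 0ℤ; 1ℤ; +≤+; -≤+; ∣_∣; nonNegative)
  import Data.Integer.Properties as ℤ
  open import Data.Integer.Tactic.RingSolver using (solve-∀)
  open import Data.List using (List; []; _∷_; _++_; length; filter)
  open import Data.List.Relation.Unary.All as All using (All; []; _∷_)
  open import Data.List.Relation.Unary.Any using (here; there)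
  open import Data.List.Relation.Unary.AllPairs using ([]; _∷_)
  open import Data.List.Membership.Propositional using (_∈_; _∉_)
  open import Data.Product using (_×_; _,_)
  open import Data.Sum using (_⊎_; inj₁; inj₂)
  open import Data.Bool using (Bool; true; false; _∧_; if_then_else_)
  open import Data.Empty using (⊥-elim)
  open import Relation.Nullary using (Dec; ¬_; yes; no; does)
  open Kernel using (K; K₀)

  module Sieve {N J Q Z Y P H u v : ℕ} (td : TraceData N J Q Z Y) (Y≡P² : Y ≡ P ℕ.* P)
    (N≡H+H : N ≡ H ℕ.+ H) (2∣H : 2 ℕ.∣ H) (2∤Q : ¬ 2 ℕ.∣ Q) (v²≤u²q : v ℕ.* v ℕ.≤ (u ℕ.* u) ℕ.* suc J) where
    open TraceData td
    open TraceSums {P = P} {u = u} {v = v} td Y≡P² N≡H+H 2∣H 2∤Q v²≤u²q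

    c : ℕ → ℕ → ℤ
    c l a = K (primeKernel l) 0 a

    -- Each factor is l times the indicator of l ∤ a.
    free : List ℕ → ℕ → ℤ
    free []       a = 1ℤ
    free (l ∷ Ls) a = (+ pred l - c l a) * free Ls a

    -- For empty `D` this is the product of the primes in `Ls` times the number of ξ that are free
    -- at `Ls` and satisfy Tr(ξ²) = β.
    G : List ℕ → List ℕ → ℤ
    G Ls D = ∑ N (λ a → w 0 (a ℕ.+ a) * (K (ker D) 0 a * free Ls a))

    G-[] : ∀ D → G [] D ≡ T D
    G-[] D = ∑-cong N λ a → cong (w 0 (a ℕ.+ a) *_) (ℤ.*-identityʳ (K (ker D) 0 a))

    G-∷ : ∀ l Ls D → G (l ∷ Ls) D ≡ + pred l * G Ls D - G Ls (l ∷ D)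
    G-∷ l Ls D = begin
      ∑ N (λ a → w 0 (a ℕ.+ a) * (K (ker D) 0 a * ((+ pred l - c l a) * free Ls a)))
        ≡⟨ ∑-cong N (λ a → expand (w 0 (a ℕ.+ a)) (K (ker D) 0 a) (+ pred l) (c l a) (free Ls a)) ⟩
      ∑ N (λ a → + pred l * (w 0 (a ℕ.+ a) * (K (ker D) 0 a * free Ls a)) + (- 1ℤ) * (w 0 (a ℕ.+ a) * ((c l a * K (ker D) 0 a) * free Ls a)))
        ≡⟨ trans (∑-+ N _ _) (cong₂ _+_ (∑-*ˡ N (+ pred l) _) (∑-*ˡ N (- 1ℤ) _)) ⟩
      + pred l * G Ls D + (- 1ℤ) * G Ls (l ∷ D)
        ≡⟨ cong (λ x → + pred l * G Ls D + x) (ℤ.-1*i≡-i (G Ls (l ∷ D))) ⟩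
      + pred l * G Ls D - G Ls (l ∷ D) ∎
      where
      open ≡-Reasoning
      expand : ∀ w k p c f → w * (k * ((p - c) * f)) ≡ p * (w * (k * f)) + (- 1ℤ) * (w * ((c * k) * f))
      expand = solve-∀

    -- Expanding the product over `Ls` yields one sum `T` for each subset. After removal of the
    -- common factor φ(Ls) φ(D) P, and with everything multiplied by `v`, a subset costs `u + v` if
    -- all primes involved divide `Q` and `2 v` otherwise. The flag says whether all primes chosen
    -- so far divide `Q`.
    bnd : Bool → List ℕ → ℕ
    bnd b []       = if b then u ℕ.+ v else 2 ℕ.* v
    bnd b (l ∷ Ls) = bnd b Ls ℕ.+ bnd (b ∧ does (l ℕ.∣? Q)) Ls

    -- Follows the recursion `G-∷`: every list reached from `D` by adjoining some of the primes in
    -- `Ls` is admissible.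
    AdmissibleOver : List ℕ → List ℕ → Set
    AdmissibleOver []       D = Admissible D
    AdmissibleOver (l ∷ Ls) D = AdmissibleOver Ls D × AdmissibleOver Ls (l ∷ D)

    extend : ∀ b m {D} → (b ≡ true → All (ℕ._∣ Q) D) → b ∧ does (m ℕ.∣? Q) ≡ true → All (ℕ._∣ Q) (m ∷ D)
    extend true m D∣Q e with m ℕ.∣? Q
    ... | yes m∣Q = m∣Q ∷ D∣Q refl

    G-bound : ∀ Ls {l D} b → AdmissibleOver Ls (l ∷ D) → (b ≡ true → All (ℕ._∣ Q) (l ∷ D)) →
      v ℕ.* ∣ G Ls (l ∷ D) ∣ ℕ.≤ φ Ls ℕ.* (φ (l ∷ D) ℕ.* P) ℕ.* bnd b Ls
    G-bound [] {l} {D} false ad _ = begin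
      v ℕ.* ∣ G [] (l ∷ D) ∣          ≡⟨ cong (λ x → v ℕ.* ∣ x ∣) (G-[] (l ∷ D)) ⟩
      v ℕ.* ∣ T (l ∷ D) ∣             ≤⟨ ℕ.*-monoʳ-≤ v (T-bound ad) ⟩
      v ℕ.* (2 ℕ.* φ (l ∷ D) ℕ.* P)   ≡⟨ lemma v (φ (l ∷ D)) P ⟩
      1 ℕ.* (φ (l ∷ D) ℕ.* P) ℕ.* (2 ℕ.* v) ∎
      where
      open ℕ.≤-Reasoning
      lemma : ∀ v f P → v ℕ.* (2 ℕ.* f ℕ.* P) ≡ 1 ℕ.* (f ℕ.* P) ℕ.* (2 ℕ.* v)
      lemma = ℕR.solve-∀
    G-bound [] {l} {D} true ad D∣Q = begin
      v ℕ.* ∣ G [] (l ∷ D) ∣          ≡⟨ cong (λ x → v ℕ.* ∣ x ∣) (G-[] (l ∷ D)) ⟩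
      v ℕ.* ∣ T (l ∷ D) ∣             ≤⟨ T-bound-Q ad (D∣Q refl) ⟩
      (u ℕ.+ v) ℕ.* (φ (l ∷ D) ℕ.* P) ≡⟨ lemma (u ℕ.+ v) (φ (l ∷ D) ℕ.* P) ⟩
      1 ℕ.* (φ (l ∷ D) ℕ.* P) ℕ.* (u ℕ.+ v) ∎
      where
      open ℕ.≤-Reasoning
      lemma : ∀ x y → x ℕ.* y ≡ 1 ℕ.* y ℕ.* x
      lemma = ℕR.solve-∀
    G-bound (m ∷ Ls) {l} {D} b (ad , ad′) D∣Q = begin
      v ℕ.* ∣ G (m ∷ Ls) (l ∷ D) ∣
        ≡⟨ cong (λ x → v ℕ.* ∣ x ∣) (G-∷ m Ls (l ∷ D)) ⟩
      v ℕ.* ∣ + pred m * G Ls (l ∷ D) - G Ls (m ∷ l ∷ D) ∣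
        ≤⟨ ℕ.*-monoʳ-≤ v (ℤ.∣i-j∣≤∣i∣+∣j∣ (+ pred m * G Ls (l ∷ D)) _) ⟩
      v ℕ.* (∣ + pred m * G Ls (l ∷ D) ∣ ℕ.+ ∣ G Ls (m ∷ l ∷ D) ∣)
        ≡⟨ cong (λ x → v ℕ.* (x ℕ.+ ∣ G Ls (m ∷ l ∷ D) ∣)) (ℤ.∣i*j∣≡∣i∣*∣j∣ (+ pred m) (G Ls (l ∷ D))) ⟩
      v ℕ.* (pred m ℕ.* ∣ G Ls (l ∷ D) ∣ ℕ.+ ∣ G Ls (m ∷ l ∷ D) ∣)
        ≡⟨ distrib v (pred m) ∣ G Ls (l ∷ D) ∣ ∣ G Ls (m ∷ l ∷ D) ∣ ⟩
      pred m ℕ.* (v ℕ.* ∣ G Ls (l ∷ D) ∣) ℕ.+ v ℕ.* ∣ G Ls (m ∷ l ∷ D) ∣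
        ≤⟨ ℕ.+-mono-≤ (ℕ.*-monoʳ-≤ (pred m) (G-bound Ls b ad D∣Q)) (G-bound Ls (b ∧ does (m ℕ.∣? Q)) ad′ (extend b m D∣Q)) ⟩
      pred m ℕ.* (φ Ls ℕ.* (φ (l ∷ D) ℕ.* P) ℕ.* bnd b Ls) ℕ.+ φ Ls ℕ.* (pred m ℕ.* φ (l ∷ D) ℕ.* P) ℕ.* bnd (b ∧ does (m ℕ.∣? Q)) Ls
        ≡⟨ collect (pred m) (φ Ls) (φ (l ∷ D)) P (bnd b Ls) _ ⟩
      pred m ℕ.* φ Ls ℕ.* (φ (l ∷ D) ℕ.* P) ℕ.* (bnd b Ls ℕ.+ bnd (b ∧ does (m ℕ.∣? Q)) Ls) ∎
      where
      open ℕ.≤-Reasoning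
      distrib : ∀ v p x y → v ℕ.* (p ℕ.* x ℕ.+ y) ≡ p ℕ.* (v ℕ.* x) ℕ.+ v ℕ.* y
      distrib = ℕR.solve-∀
      collect : ∀ m f d P x y → m ℕ.* (f ℕ.* (d ℕ.* P) ℕ.* x) ℕ.+ f ℕ.* (m ℕ.* d ℕ.* P) ℕ.* y ≡ m ℕ.* f ℕ.* (d ℕ.* P) ℕ.* (x ℕ.+ y)
      collect = ℕR.solve-∀

    flag : ℕ → Bool
    flag l = does (l ℕ.∣? Q)

    flag-sound : ∀ l → flag l ≡ true → All (ℕ._∣ Q) (l ∷ [])
    flag-sound l e with l ℕ.∣? Q | e
    ... | yes d | _ = d ∷ []

    G-bound₁ : ∀ Ls p → AdmissibleOver Ls (p ∷ []) → + v * G Ls (p ∷ []) ≤ + (φ Ls ℕ.* P) * (+ pred p * + bnd (flag p) Ls)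
    G-bound₁ Ls p ad = begin
      + v * G Ls (p ∷ [])              ≤⟨ ℤ.*-monoˡ-≤-nonNeg (+ v) (≤abs (G Ls (p ∷ []))) ⟩
      + v * + ∣ G Ls (p ∷ []) ∣        ≡⟨ ℤ.pos-* v _ ⟨
      + (v ℕ.* ∣ G Ls (p ∷ []) ∣)      ≤⟨ +≤+ (G-bound Ls (flag p) ad (flag-sound p)) ⟩
      + (φ Ls ℕ.* (pred p ℕ.* 1 ℕ.* P) ℕ.* B) ≡⟨ cong +_ (lemma (φ Ls) (pred p) P B) ⟩
      + (φ Ls ℕ.* P ℕ.* (pred p ℕ.* B)) ≡⟨ ℤ.pos-* (φ Ls ℕ.* P) _ ⟩
      + (φ Ls ℕ.* P) * + (pred p ℕ.* B) ≡⟨ cong (+ (φ Ls ℕ.* P) *_) (ℤ.pos-* (pred p) B) ⟩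
      + (φ Ls ℕ.* P) * (+ pred p * + B) ∎
      where
      open ℤ.≤-Reasoning
      B = bnd (flag p) Ls
      lemma : ∀ f p P B → f ℕ.* (p ℕ.* 1 ℕ.* P) ℕ.* B ≡ f ℕ.* P ℕ.* (p ℕ.* B)
      lemma = ℕR.solve-∀
      ≤abs : ∀ i → i ≤ + ∣ i ∣
      ≤abs (+ n)    = ℤ.≤-refl
      ≤abs -[1+ n ] = -≤+

    -- The empty subset has error at most P, costing only `v`, yet `bnd true []` charges `u + v` for
    -- it. The extra `u` on the left refunds the difference, so that one function `bnd` can serve
    -- for all subsets.
    G-lower : ∀ Ls → AdmissibleOver Ls [] →
      + (φ Ls ℕ.* P) * (+ v * + P + + u) ≤ + v * G Ls [] + + (φ Ls ℕ.* P) * + bnd true Ls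
    G-lower [] ad = begin
      + (1 ℕ.* P) * (+ v * + P + + u)      ≡⟨ cong (λ x → + x * (+ v * + P + + u)) (ℕ.*-identityˡ P) ⟩
      + P * (+ v * + P + + u)              ≡⟨ lemma₁ (+ P) (+ v) (+ u) ⟩
      + v * (+ P * + P) + + P * + u        ≡⟨ cong (λ x → + v * x + + P * + u) (ℤ.pos-* P P) ⟨
      + v * + (P ℕ.* P) + + P * + u        ≤⟨ ℤ.+-monoˡ-≤ (+ P * + u) (ℤ.*-monoˡ-≤-nonNeg (+ v) T-empty) ⟩
      + v * (T [] + + P) + + P * + u       ≡⟨ lemma₂ (+ P) (+ v) (+ u) (T []) ⟩
      + v * T [] + + P * (+ u + + v)       ≡⟨ cong₂ (λ x y → + v * x + y) (sym (G-[] [])) (cong₂ _*_ (cong +_ (sym (ℕ.*-identityˡ P))) (sym (ℤ.pos-+ u v))) ⟩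
      + v * G [] [] + + (1 ℕ.* P) * + (u ℕ.+ v) ∎
      where
      open ℤ.≤-Reasoning
      lemma₁ : ∀ P v u → P * (v * P + u) ≡ v * (P * P) + P * u
      lemma₁ = solve-∀
      lemma₂ : ∀ P v u T → v * (T + P) + P * u ≡ v * T + P * (u + v)
      lemma₂ = solve-∀
    G-lower (l ∷ Ls) (ad , ad′) = begin
      + (pred l ℕ.* φ Ls ℕ.* P) * S
        ≡⟨ cong (_* S) A-eq ⟩
      (+ pred l * A) * S
        ≡⟨ ℤ.*-assoc (+ pred l) A S ⟩
      + pred l * (A * S)
        ≤⟨ ℤ.*-monoˡ-≤-nonNeg (+ pred l) (G-lower Ls ad) ⟩
      + pred l * (+ v * G Ls [] + A * B)
        ≡⟨ lemma₁ (+ pred l) (+ v) (G Ls []) (G Ls (l ∷ [])) (A * B) ⟩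
      (+ v * (+ pred l * G Ls [] - G Ls (l ∷ [])) + + pred l * (A * B)) + + v * G Ls (l ∷ [])
        ≤⟨ ℤ.+-monoʳ-≤ (+ v * (+ pred l * G Ls [] - G Ls (l ∷ [])) + + pred l * (A * B)) (G-bound₁ Ls l ad′) ⟩
      (+ v * (+ pred l * G Ls [] - G Ls (l ∷ [])) + + pred l * (A * B)) + A * (+ pred l * B′)
        ≡⟨ lemma₂ (+ v * (+ pred l * G Ls [] - G Ls (l ∷ []))) (+ pred l) A B B′ ⟩
      + v * (+ pred l * G Ls [] - G Ls (l ∷ [])) + (+ pred l * A) * (B + B′)
        ≡⟨ cong₂ (λ x y → + v * x + y) (sym (G-∷ l Ls [])) (cong₂ _*_ (sym A-eq) (sym (ℤ.pos-+ (bnd true Ls) _))) ⟩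
      + v * G (l ∷ Ls) [] + + (pred l ℕ.* φ Ls ℕ.* P) * + (bnd true Ls ℕ.+ bnd (flag l) Ls) ∎
      where
      open ℤ.≤-Reasoning
      A = + (φ Ls ℕ.* P)
      S = + v * + P + + u
      B = + bnd true Ls
      B′ = + bnd (flag l) Ls
      A-eq : + (pred l ℕ.* φ Ls ℕ.* P) ≡ + pred l * A
      A-eq = trans (cong +_ (ℕ.*-assoc (pred l) (φ Ls) P)) (ℤ.pos-* (pred l) (φ Ls ℕ.* P))
      lemma₁ : ∀ p v g g′ x → p * (v * g + x) ≡ (v * (p * g - g′) + p * x) + v * g′
      lemma₁ = solve-∀
      lemma₂ : ∀ x p a b b′ → (x + p * (a * b)) + a * (p * b′) ≡ x + (p * a) * (b + b′)
      lemma₂ = solve-∀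

    bnd-false : ∀ Ls → bnd false Ls ≡ 2 ℕ.* v ℕ.* 2 ℕ.^ length Ls
    bnd-false []       = sym (ℕ.*-identityʳ (2 ℕ.* v))
    bnd-false (l ∷ Ls) = trans (cong₂ ℕ._+_ (bnd-false Ls) (bnd-false Ls)) (double (2 ℕ.* v) (2 ℕ.^ length Ls))
      where
      double : ∀ a b → a ℕ.* b ℕ.+ a ℕ.* b ≡ a ℕ.* (2 ℕ.* b)
      double = ℕR.solve-∀

    -- Of all subsets of `Ls`, those consisting of divisors of `Q` cost u + v = 2v - t, the rest 2v.
    bnd-true : ∀ {t} → v ≡ u ℕ.+ t → ∀ Ls → bnd true Ls ℕ.+ t ℕ.* 2 ℕ.^ length (filter (λ l → l ℕ.∣? Q) Ls) ≡ 2 ℕ.* v ℕ.* 2 ℕ.^ length Ls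
    bnd-true {t} refl [] = base u t
      where
      base : ∀ u t → (u ℕ.+ (u ℕ.+ t)) ℕ.+ t ℕ.* 1 ≡ 2 ℕ.* (u ℕ.+ t) ℕ.* 1
      base = ℕR.solve-∀
    bnd-true {t} v≡ (l ∷ Ls) with l ℕ.∣? Q
    ... | yes _ = trans (double (bnd true Ls) t _) (trans (cong (2 ℕ.*_) (bnd-true v≡ Ls)) (swap (2 ℕ.* v) (2 ℕ.^ length Ls)))
      where
      double : ∀ a t w → (a ℕ.+ a) ℕ.+ t ℕ.* (2 ℕ.* w) ≡ 2 ℕ.* (a ℕ.+ t ℕ.* w)
      double = ℕR.solve-∀
      swap : ∀ a b → 2 ℕ.* (a ℕ.* b) ≡ a ℕ.* (2 ℕ.* b)
      swap = ℕR.solve-∀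
    ... | no _ = trans (swap (bnd true Ls) (bnd false Ls) _) (trans (cong₂ ℕ._+_ (bnd-true v≡ Ls) (bnd-false Ls)) (double (2 ℕ.* v) (2 ℕ.^ length Ls)))
      where
      swap : ∀ a b c → (a ℕ.+ b) ℕ.+ c ≡ (a ℕ.+ c) ℕ.+ b
      swap = ℕR.solve-∀
      double : ∀ a b → a ℕ.* b ℕ.+ a ℕ.* b ≡ a ℕ.* (2 ℕ.* b)
      double = ℕR.solve-∀

    admissibleOver : ∀ {Ls D} → Admissible Ls → Admissible D → (∀ {l} → l ∈ Ls → l ∉ D) → AdmissibleOver Ls D
    admissibleOver {[]} _ adD _ = adD
    admissibleOver {l ∷ Ls} {D} (pl ∷ pL , l≢ ∷ uL , l∣N ∷ L∣N) adD@(pD , uD , D∣N) disj =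
      admissibleOver (pL , uL , L∣N) adD (λ i → disj (there i)) ,
      admissibleOver (pL , uL , L∣N) (pl ∷ pD , All.tabulate (λ i e → disj (here refl) (subst (_∈ D) (sym e) i)) ∷ uD , l∣N ∷ D∣N) disj′
      where
      disj′ : ∀ {m} → m ∈ Ls → m ∉ l ∷ D
      disj′ i (here e)  = All.lookup l≢ i (sym e)
      disj′ i (there j) = disj (there i) j

    module _ (Ls ps : List ℕ) (pL : All Prime Ls) (pp : All Prime ps)
      (w01 : ∀ b → w 0 b ≡ 0ℤ ⊎ w 0 b ≡ 1ℤ)
      (none : ∀ a → a ℕ.< N → w 0 (a ℕ.+ a) ≡ 1ℤ → All (λ l → ¬ l ℕ.∣ a) (Ls ++ ps) → ⊥) where

      Jp : ℕ → ℤ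
      Jp p = ∑ N (λ a → w 0 (a ℕ.+ a) * free Ls a * 𝟙 (p ℕ.∣? a))

      factor : ∀ l .{{_ : NonZero l}} a → + pred l - c l a ≡ + l * (1ℤ - 𝟙 (l ℕ.∣? a))
      factor l@(suc l′) a = trans (cong (λ x → + l′ - x) (primeKernel-value l a))
        (trans (cong (λ x → + l′ - (x * 𝟙 (l ℕ.∣? a) - 1ℤ)) (ℤ.pos-+ 1 l′))
          (trans (lemma (+ l′) (𝟙 (l ℕ.∣? a))) (cong (_* (1ℤ - 𝟙 (l ℕ.∣? a))) (sym (ℤ.pos-+ 1 l′)))))
        where
        lemma : ∀ x d → x - ((1ℤ + x) * d - 1ℤ) ≡ (1ℤ + x) * (1ℤ - d)
        lemma = solve-∀

      free-nonNeg : ∀ {Ls} → All Prime Ls → ∀ a → 0ℤ ≤ free Ls a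
      free-nonNeg [] a = +≤+ ℕ.z≤n
      free-nonNeg {l ∷ Ls} (pl ∷ pL) a = *-nonNeg (subst (0ℤ ≤_) (sym (factor l {{prime⇒nonZero pl}} a)) (*-nonNeg {+ l} (+≤+ ℕ.z≤n) (lemma (l ℕ.∣? a)))) (free-nonNeg pL a)
        where
        lemma : ∀ {P : Set} (d : Dec P) → 0ℤ ≤ 1ℤ - 𝟙 d
        lemma (yes _) = ℤ.≤-refl
        lemma (no _)  = +≤+ ℕ.z≤n

      free-cases : ∀ {Ls} → All Prime Ls → ∀ a → free Ls a ≡ 0ℤ ⊎ All (λ l → ¬ l ℕ.∣ a) Ls
      free-cases [] a = inj₂ []
      free-cases {l ∷ Ls} (pl ∷ pL) a with l ℕ.∣? a in eq
      ... | yes _ = inj₁ (cong (_* free Ls a) (trans (factor l {{prime⇒nonZero pl}} a) (trans (cong (λ d → + l * (1ℤ - 𝟙 d)) eq) (ℤ.*-zeroʳ (+ l)))))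
      ... | no l∤a with free-cases pL a
      ...   | inj₁ e = inj₁ (trans (cong ((+ pred l - c l a) *_) e) (ℤ.*-zeroʳ (+ pred l - c l a)))
      ...   | inj₂ n = inj₂ (l∤a ∷ n)

      hits-nonNeg : ∀ ps a → 0ℤ ≤ ∑L ps (λ p → 𝟙 (p ℕ.∣? a))
      hits-nonNeg ps a = ∑L-nonNeg ps _ λ p → 𝟙-nonNeg (p ℕ.∣? a)

      hits : ∀ ps a → All (λ p → ¬ p ℕ.∣ a) ps ⊎ 1ℤ ≤ ∑L ps (λ p → 𝟙 (p ℕ.∣? a))
      hits [] a = inj₁ []
      hits (p ∷ ps) a with p ℕ.∣? a
      ... | yes _ = inj₂ (ℤ.+-monoʳ-≤ 1ℤ (hits-nonNeg ps a))
      ... | no p∤a with hits ps a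
      ...   | inj₁ n = inj₁ (p∤a ∷ n)
      ...   | inj₂ h = inj₂ (subst (1ℤ ≤_) (sym (ℤ.+-identityˡ _)) h)

      pointwise : ∀ a → a ℕ.< N → w 0 (a ℕ.+ a) * free Ls a ≤ w 0 (a ℕ.+ a) * free Ls a * ∑L ps (λ p → 𝟙 (p ℕ.∣? a))
      pointwise a a<N with w01 (a ℕ.+ a)
      ... | inj₁ w≡0 rewrite w≡0 = ℤ.≤-refl
      ... | inj₂ w≡1 with free-cases pL a
      ...   | inj₁ f≡0 rewrite f≡0 | ℤ.*-zeroʳ (w 0 (a ℕ.+ a)) = ℤ.≤-refl
      ...   | inj₂ Ls∤a with hits ps a
      ...     | inj₁ ps∤a = ⊥-elim (none a a<N w≡1 (++⁺ Ls∤a ps∤a))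
      ...     | inj₂ 1≤h = subst (_≤ w 0 (a ℕ.+ a) * free Ls a * ∑L ps (λ p → 𝟙 (p ℕ.∣? a))) (ℤ.*-identityʳ _)
                  (ℤ.*-monoˡ-≤-nonNeg (w 0 (a ℕ.+ a) * free Ls a)
                    {{nonNegative (*-nonNeg (subst (0ℤ ≤_) (sym w≡1) (+≤+ ℕ.z≤n)) (free-nonNeg pL a))}} 1≤h)

      -- If there is no solution, every element counted on the left has an exponent divisible by
      -- some sieving prime; the union bound does the rest.
      sieve : G Ls [] ≤ ∑L ps Jp
      sieve = begin
        G Ls []                                ≡⟨ ∑-cong N (λ a → cong (w 0 (a ℕ.+ a) *_) (ℤ.*-identityˡ (free Ls a))) ⟩
        ∑ N (λ a → w 0 (a ℕ.+ a) * free Ls a)  ≤⟨ ∑-mono N pointwise ⟩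
        ∑ N (λ a → w 0 (a ℕ.+ a) * free Ls a * ∑L ps (λ p → 𝟙 (p ℕ.∣? a))) ≡⟨ pull ps ⟩
        ∑L ps Jp                               ∎
        where
        open ℤ.≤-Reasoning
        pull : ∀ ps → ∑ N (λ a → w 0 (a ℕ.+ a) * free Ls a * ∑L ps (λ p → 𝟙 (p ℕ.∣? a))) ≡ ∑L ps Jp
        pull []       = trans (∑-cong N λ a → ℤ.*-zeroʳ (w 0 (a ℕ.+ a) * free Ls a)) (∑-zero N)
        pull (p ∷ ps) = trans (∑-cong N λ a → ℤ.*-distribˡ-+ (w 0 (a ℕ.+ a) * free Ls a) (𝟙 (p ℕ.∣? a)) _)
          (trans (∑-+ N _ _) (cong (λ x → Jp p + x) (pull ps)))

      -- Because p times the indicator of p ∣ a is 1 + c_p(a).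
      Jp-value : ∀ p .{{_ : NonZero p}} → + p * Jp p ≡ G Ls [] + G Ls (p ∷ [])
      Jp-value p = begin
        + p * Jp p
          ≡⟨ ∑-*ˡ N (+ p) _ ⟨
        ∑ N (λ a → + p * (w 0 (a ℕ.+ a) * free Ls a * 𝟙 (p ℕ.∣? a)))
          ≡⟨ ∑-cong N (λ a → trans (lemma (+ p) (w 0 (a ℕ.+ a)) (free Ls a) (𝟙 (p ℕ.∣? a)))
               (cong (λ x → w 0 (a ℕ.+ a) * (1ℤ * free Ls a) + w 0 (a ℕ.+ a) * ((x * 1ℤ) * free Ls a)) (sym (primeKernel-value p a)))) ⟩
        ∑ N (λ a → w 0 (a ℕ.+ a) * (1ℤ * free Ls a) + w 0 (a ℕ.+ a) * ((c p a * 1ℤ) * free Ls a))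
          ≡⟨ ∑-+ N _ _ ⟩
        G Ls [] + G Ls (p ∷ []) ∎
        where
        open ≡-Reasoning
        lemma : ∀ p w f d → p * (w * f * d) ≡ w * (1ℤ * f) + w * (((p * d - 1ℤ) * 1ℤ) * f)
        lemma = solve-∀

      Jp-bound : ∀ p .{{_ : NonZero p}} → AdmissibleOver Ls (p ∷ []) →
        + p * (+ v * Jp p) ≤ + v * G Ls [] + + (φ Ls ℕ.* P) * (+ pred p * + bnd (flag p) Ls)
      Jp-bound p ad = begin
        + p * (+ v * Jp p)                     ≡⟨ swap (+ p) (+ v) (Jp p) ⟩
        + v * (+ p * Jp p)                     ≡⟨ cong (+ v *_) (Jp-value p) ⟩
        + v * (G Ls [] + G Ls (p ∷ []))        ≡⟨ ℤ.*-distribˡ-+ (+ v) (G Ls []) _ ⟩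
        + v * G Ls [] + + v * G Ls (p ∷ [])    ≤⟨ ℤ.+-monoʳ-≤ (+ v * G Ls []) (G-bound₁ Ls p ad) ⟩
        + v * G Ls [] + + (φ Ls ℕ.* P) * (+ pred p * + bnd (flag p) Ls) ∎
        where
        open ℤ.≤-Reasoning
        swap : ∀ p v x → p * (v * x) ≡ v * (p * x)
        swap = solve-∀

-- The p-th power of a sum, with its remainder.

module FreshmansDream where
  open import Algebra.Bundles using (CommutativeSemiring)
  open import Data.Nat as ℕ using (ℕ; zero; suc; _!; NonZero)
  import Data.Nat.Properties as ℕ
  import Data.Nat.Divisibility as ℕ
  import Data.Nat.DivMod as ℕ
  open import Data.Nat.Combinatorics using (_C_; nCn≡1; nCk≡n!/k![n-k]!; k![n∸k]!∣n!)
  open import Data.Nat.Primality using (Prime; prime⇒nonZero; prime⇒nonTrivial; euclidsLemma)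
  open import Data.Fin as Fin using (Fin; zero; suc; toℕ; inject₁; fromℕ)
  import Data.Fin.Properties as Fin
  open import Data.Product using (Σ; _,_; proj₁; proj₂)
  open import Data.Sum using (inj₁; inj₂)
  open import Data.Empty using (⊥-elim)
  open import Relation.Nullary using (¬_)
  open import Relation.Binary.PropositionalEquality as ≡ using (_≡_; cong; cong₂; subst)

  prime∤! : ∀ {p} → Prime p → ∀ k → k ℕ.< p → ¬ p ℕ.∣ k !
  prime∤! {p} pp zero    _   d = ℕ.<⇒≱ (ℕ.nonTrivial⇒n>1 p {{prime⇒nonTrivial pp}}) (ℕ.∣⇒≤ d)
  prime∤! pp (suc k) k<p d with euclidsLemma (suc k) (k !) pp d
  ... | inj₁ d′ = ℕ.<⇒≱ k<p (ℕ.∣⇒≤ d′)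
  ... | inj₂ d′ = prime∤! pp k (ℕ.<-trans (ℕ.n<1+n k) k<p) d′

  -- The prime divides p! but neither k! nor (p - k)!.
  prime∣C : ∀ {p} → Prime p → ∀ k → 0 ℕ.< k → k ℕ.< p → p ℕ.∣ p C k
  prime∣C {p} pp k 0<k k<p with euclidsLemma (p C k) (k ! ℕ.* (p ℕ.∸ k) !) pp p∣
    where
    k≤p = ℕ.<⇒≤ k<p
    instance _ = k ℕ.!* (p ℕ.∸ k) !≢0
    fact : (p C k) ℕ.* (k ! ℕ.* (p ℕ.∸ k) !) ≡ p !
    fact = ≡.trans (cong (ℕ._* (k ! ℕ.* (p ℕ.∸ k) !)) (nCk≡n!/k![n-k]! k≤p)) (ℕ.m/n*n≡m (k![n∸k]!∣n! k≤p))
    p∣p! : ∀ {p} → NonZero p → p ℕ.∣ p !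
    p∣p! {suc p} _ = ℕ.m∣m*n (p !)
    p∣ : p ℕ.∣ (p C k) ℕ.* (k ! ℕ.* (p ℕ.∸ k) !)
    p∣ = subst (p ℕ.∣_) (≡.sym fact) (p∣p! (prime⇒nonZero pp))
  ... | inj₁ d = d
  ... | inj₂ d with euclidsLemma (k !) ((p ℕ.∸ k) !) pp d
  ...   | inj₁ d′ = ⊥-elim (prime∤! pp k k<p d′)
  ...   | inj₂ d′ = ⊥-elim (prime∤! pp (p ℕ.∸ k) (ℕ.∸-monoʳ-< 0<k (ℕ.<⇒≤ k<p)) d′)

  module Freshman {a ℓ} (R : CommutativeSemiring a ℓ) where
    open CommutativeSemiring R hiding (zero)
    open import Algebra.Properties.Semiring.Sum semiring using (sum; sum-init-last)
    open import Algebra.Properties.Semiring.Mult semiring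
    open import Algebra.Properties.Semiring.Exp semiring
    open import Algebra.Properties.CommutativeMonoid.Mult +-commutativeMonoid using (×-distrib-+)
    import Algebra.Properties.CommutativeSemiring.Binomial R as Binomial
    open import Algebra.Properties.Semiring.Binomial semiring using (binomialTerm)
    open import Relation.Binary.Reasoning.Setoid setoid

    sum-multiple : ∀ p {n} (t : Fin n → Carrier) → (∀ i → Σ Carrier λ c → t i ≈ p × c) → Σ Carrier λ c → sum t ≈ p × c
    sum-multiple p {zero}  t mult = 0# , sym (×-zero p)
      where
      ×-zero : ∀ p → p × 0# ≈ 0#
      ×-zero zero    = refl
      ×-zero (suc p) = trans (+-identityˡ _) (×-zero p)
    sum-multiple p {suc n} t mult with mult zero | sum-multiple p (λ i → t (suc i)) (λ i → mult (suc i))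
    ... | c , e | c′ , e′ = c + c′ , trans (+-cong e e′) (sym (×-distrib-+ c c′ p))

    -- Stated over semirings with the remainder kept, so as to serve twice: in the field the
    -- multiple of p vanishes and Frobenius is additive, and in ℕ it gives Fermat's little theorem.
    freshman : ∀ {p} → Prime p → ∀ x y → Σ Carrier λ c → (x + y) ^ p ≈ (x ^ p + y ^ p) + p × c
    freshman {suc p′} pp x y = c , (begin
      (x + y) ^ p                                     ≈⟨ Binomial.theorem p x y ⟩
      t zero + sum (λ i → t (suc i))                  ≈⟨ +-congˡ (sum-init-last (λ i → t (suc i))) ⟩
      t zero + (sum mid + t (suc (fromℕ p′)))         ≈⟨ +-cong first (+-cong (proj₂ middle) last) ⟩
      y ^ p + (p × c + x ^ p)                         ≈⟨ +-comm _ _ ⟩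
      (p × c + x ^ p) + y ^ p                         ≈⟨ +-assoc _ _ _ ⟩
      p × c + (x ^ p + y ^ p)                         ≈⟨ +-comm _ _ ⟩
      (x ^ p + y ^ p) + p × c                         ∎)
      where
      p = suc p′
      t = binomialTerm x y p
      mid : Fin p′ → Carrier
      mid i = t (suc (inject₁ i))
      multiple : ∀ i → Σ Carrier λ c → mid i ≈ p × c
      multiple i with ℕ.divides m eq ← prime∣C pp (suc (toℕ (inject₁ i))) ℕ.z<s (subst (λ j → suc j ℕ.< p) (≡.sym (Fin.toℕ-inject₁ i)) (ℕ.s<s (Fin.toℕ<n i)))
        = m × b , trans (×-congˡ (≡.trans eq (ℕ.*-comm m p))) (sym (×-assocˡ b p m))
        where b = (x ^ suc (toℕ (inject₁ i))) * (y ^ (p ℕ.∸ suc (toℕ (inject₁ i))))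
      middle = sum-multiple p mid multiple
      c = proj₁ middle
      first : t zero ≈ y ^ p
      first = trans (+-identityʳ _) (*-identityˡ _)
      last : t (suc (fromℕ p′)) ≈ x ^ p
      last = begin
        (p C suc (toℕ (fromℕ p′))) × ((x ^ suc (toℕ (fromℕ p′))) * (y ^ (p′ ℕ.∸ toℕ (fromℕ p′))))
          ≡⟨ cong (λ j → (p C suc j) × ((x ^ suc j) * (y ^ (p′ ℕ.∸ j)))) (Fin.toℕ-fromℕ p′) ⟩
        (p C p) × ((x ^ p) * (y ^ (p′ ℕ.∸ p′)))
          ≡⟨ cong₂ (λ m j → m × ((x ^ p) * (y ^ j))) (nCn≡1 p) (ℕ.n∸n≡0 p′) ⟩
        1 × ((x ^ p) * 1#)
          ≈⟨ trans (+-identityʳ _) (*-identityʳ _) ⟩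
        x ^ p ∎

-- Finite fields and polynomial functions on them.

module FiniteFields where
  open import Defs
  open import Level using (_⊔_)
  open import Algebra.Bundles using (CommutativeRing)
  open import Data.Nat as ℕ using (ℕ; zero; suc)
  import Data.Nat.Properties as ℕ
  open import Data.Nat.GCD using (module Bézout)
  open import Data.Fin as Fin using (Fin; zero; suc; punchIn)
  import Data.Fin.Properties as Fin
  open import Data.Fin.Permutation using (Permutation′; permutation)
  open import Data.Vec using (lookup)
  open import Data.List using ([]; _∷_; length; tabulate)
  open import Data.List.Properties using (length-tabulate)
  open import Data.List.Relation.Unary.All as All using (All; []; _∷_)
  import Data.List.Relation.Unary.All.Properties as All
  open import Data.List.Relation.Unary.AllPairs using (AllPairs; []; _∷_)
  import Data.List.Relation.Unary.AllPairs.Properties as AllPairs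
  open import Data.Product using (Σ; _×_; _,_; proj₁; proj₂)
  open import Data.Sum using (inj₁; inj₂)
  open import Data.Empty using (⊥-elim)
  open import Function using (_∘_)
  open import Relation.Nullary using (¬_; Dec; yes; no)
  open import Relation.Nullary.Decidable using (map′; ¬?; decidable-stable)
  open import Relation.Binary.PropositionalEquality as ≡ using (_≡_; _≢_; cong; subst)

  module FiniteField {c ℓ} (F : CommutativeRing c ℓ) {N : ℕ} (ff : IsFiniteFieldOfSize F (suc N)) where
    open CommutativeRing F hiding (zero)
    open IsFiniteFieldOfSize ff
    open import Algebra.Properties.Ring ring using ([y-z]x≈yx-zx)
    open import Algebra.Properties.AbelianGroup +-abelianGroup using () renaming (x∙y⁻¹≈ε⇒x≈y to x-y≈0⇒x≈y; x≈y⇒x∙y⁻¹≈ε to x≈y⇒x-y≈0; ∙-cancelˡ to +-cancelˡ)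
    open import Algebra.Properties.Semiring.Mult semiring using (×1-homo-*) renaming (_×_ to _⋆_)
    open import Algebra.Solver.Ring.NaturalCoefficients.Default commutativeSemiring using (solve; _:+_; _:*_; _:=_)
    import Algebra.Properties.CommutativeMonoid.Sum as CMSum
    module Σ⁺ = CMSum +-commutativeMonoid
    module Π* = CMSum *-commutativeMonoid
    open import Relation.Binary.Reasoning.Setoid setoid

    el : Fin (suc N) → Carrier
    el = lookup enum

    idx : Carrier → Fin (suc N)
    idx x = proj₁ (enum-onto x)

    el-idx : ∀ x → el (idx x) ≈ x
    el-idx x = proj₂ (enum-onto x)

    idx-el : ∀ i {x} → x ≈ el i → idx x ≡ i
    idx-el i e = enum-inj _ _ (trans (el-idx _) e)

    infix 4 _≟_
    abstract
      _≟_ : ∀ x y → Dec (x ≈ y)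
      x ≟ y = map′ (λ e → trans (sym (el-idx x)) (trans (reflexive (cong el e)) (el-idx y)))
        (λ e → idx-el (idx y) (trans e (sym (el-idx y)))) (idx x Fin.≟ idx y)

    cancelʳ : ∀ {x y z} → ¬ z ≈ 0# → x * z ≈ y * z → x ≈ y
    cancelʳ {x} {y} {z} z≉0 e with w , zw≈1 ← inverse z z≉0 = begin
      x             ≈⟨ *-identityʳ x ⟨
      x * 1#        ≈⟨ *-congˡ zw≈1 ⟨
      x * (z * w)   ≈⟨ *-assoc x z w ⟨
      (x * z) * w   ≈⟨ *-congʳ e ⟩
      (y * z) * w   ≈⟨ *-assoc y z w ⟩
      y * (z * w)   ≈⟨ *-congˡ zw≈1 ⟩
      y * 1#        ≈⟨ *-identityʳ y ⟩
      y             ∎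

    cancelˡ : ∀ {x y z} → ¬ z ≈ 0# → z * x ≈ z * y → x ≈ y
    cancelˡ z≉0 e = cancelʳ z≉0 (trans (*-comm _ _) (trans e (*-comm _ _)))

    no-zero-divisors : ∀ {x y} → x * y ≈ 0# → ¬ x ≈ 0# → y ≈ 0#
    no-zero-divisors {x} e x≉0 = cancelˡ x≉0 (trans e (sym (zeroʳ x)))

    *-≉0 : ∀ {x y} → ¬ x ≈ 0# → ¬ y ≈ 0# → ¬ x * y ≈ 0#
    *-≉0 x≉0 y≉0 e = y≉0 (no-zero-divisors e x≉0)

    1≉0 : ¬ 1# ≈ 0#
    1≉0 e = nontrivial (sym e)

    infixr 8 _^_
    _^_ : Carrier → ℕ → Carrier
    x ^ k = pow F x k

    ^-cong : ∀ k {x y} → x ≈ y → x ^ k ≈ y ^ k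
    ^-cong zero    e = refl
    ^-cong (suc k) e = *-cong e (^-cong k e)

    ^-+ : ∀ x a b → x ^ (a ℕ.+ b) ≈ x ^ a * x ^ b
    ^-+ x zero    b = sym (*-identityˡ _)
    ^-+ x (suc a) b = trans (*-congˡ (^-+ x a b)) (sym (*-assoc x _ _))

    ^-* : ∀ x a b → x ^ (a ℕ.* b) ≈ (x ^ b) ^ a
    ^-* x zero    b = refl
    ^-* x (suc a) b = trans (^-+ x b (a ℕ.* b)) (*-congˡ (^-* x a b))

    ^-*′ : ∀ x a b → x ^ (a ℕ.* b) ≈ (x ^ a) ^ b
    ^-*′ x a b = trans (reflexive (cong (x ^_) (ℕ.*-comm a b))) (^-* x b a)

    1^ : ∀ k → 1# ^ k ≈ 1#
    1^ zero    = refl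
    1^ (suc k) = trans (*-identityˡ _) (1^ k)

    0^ : ∀ k → 0 ℕ.< k → 0# ^ k ≈ 0#
    0^ (suc k) _ = zeroˡ _

    *-^ : ∀ x y k → (x * y) ^ k ≈ x ^ k * y ^ k
    *-^ x y zero    = sym (*-identityˡ 1#)
    *-^ x y (suc k) = trans (*-congˡ (*-^ x y k)) (solve 4 (λ x y u v → (x :* y) :* (u :* v) := (x :* u) :* (y :* v)) refl x y (x ^ k) (y ^ k))

    ^-≉0 : ∀ {x} → ¬ x ≈ 0# → ∀ k → ¬ x ^ k ≈ 0#
    ^-≉0 x≉0 zero    = 1≉0
    ^-≉0 x≉0 (suc k) = *-≉0 x≉0 (^-≉0 x≉0 k)

    bijection : (f f⁻¹ : Carrier → Carrier) → (∀ {x y} → x ≈ y → f x ≈ f y) → (∀ {x y} → x ≈ y → f⁻¹ x ≈ f⁻¹ y) →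
      (∀ x → f (f⁻¹ x) ≈ x) → (∀ x → f⁻¹ (f x) ≈ x) → Permutation′ (suc N)
    bijection f f⁻¹ cf cf⁻¹ inv inv′ = permutation (λ i → idx (f (el i))) (λ i → idx (f⁻¹ (el i)))
      (λ i → idx-el i (trans (cf (el-idx _)) (inv (el i)))) (λ i → idx-el i (trans (cf⁻¹ (el-idx _)) (inv′ (el i))))

    -- Translation by 1 permutes the field, so adding 1 to every element does not change their sum.
    size⋆1≈0 : suc N ⋆ 1# ≈ 0#
    size⋆1≈0 = +-cancelˡ (Σ⁺.sum el) _ _ (begin
      Σ⁺.sum el + suc N ⋆ 1#                        ≈⟨ +-congˡ (Σ⁺.sum-replicate (suc N)) ⟨
      Σ⁺.sum el + Σ⁺.sum (λ (_ : Fin (suc N)) → 1#) ≈⟨ Σ⁺.∑-distrib-+ el (λ _ → 1#) ⟨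
      Σ⁺.sum (λ i → el i + 1#)                      ≈⟨ Σ⁺.sum-cong-≋ (λ i → el-idx (el i + 1#)) ⟨
      Σ⁺.sum (λ i → el (idx (el i + 1#)))           ≈⟨ Σ⁺.sum-permute el (bijection (_+ 1#) (_- 1#) +-congʳ +-congʳ
                                                         (λ x → trans (+-assoc _ _ _) (trans (+-congˡ (-‿inverseˡ 1#)) (+-identityʳ x)))
                                                         (λ x → trans (+-assoc _ _ _) (trans (+-congˡ (-‿inverseʳ 1#)) (+-identityʳ x)))) ⟨
      Σ⁺.sum el                                     ≈⟨ +-identityʳ _ ⟨
      Σ⁺.sum el + 0#                                ∎)

    characteristic : ∀ p k → (p ℕ.^ k) ⋆ 1# ≈ 0# → p ⋆ 1# ≈ 0#
    characteristic p zero    e = ⊥-elim (1≉0 (trans (sym (+-identityʳ 1#)) e))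
    characteristic p (suc k) e with p ⋆ 1# ≟ 0#
    ... | yes e′ = e′
    ... | no  ne = characteristic p k (no-zero-divisors (trans (sym (×1-homo-* p (p ℕ.^ k))) e) ne)

    nonzero : Fin N → Carrier
    nonzero j = el (punchIn (idx 0#) j)

    nonzero-≉0 : ∀ j → ¬ nonzero j ≈ 0#
    nonzero-≉0 j e = Fin.punchInᵢ≢i (idx 0#) j (enum-inj _ _ (trans e (sym (el-idx 0#))))

    nonzero-injective : ∀ {i j} → nonzero i ≈ nonzero j → i ≡ j
    nonzero-injective e = Fin.punchIn-injective (idx 0#) _ _ (enum-inj _ _ e)

    -- Multiplication by x permutes the nonzero elements, so their product is multiplied by x ^ N.
    lagrange : ∀ {x} → ¬ x ≈ 0# → x ^ N ≈ 1#
    lagrange {x} x≉0 with y , xy≈1 ← inverse x x≉0 = trans (sym scale) (cancelʳ Π≉0 (begin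
      Π*.sum (λ i → h (el i)) * Π                  ≈⟨ Π*.∑-distrib-+ (λ i → h (el i)) (λ i → nz (el i)) ⟨
      Π*.sum (λ i → h (el i) * nz (el i))          ≈⟨ Π*.sum-cong-≋ (λ i → nz-* (el i)) ⟨
      Π*.sum (λ i → nz (x * el i))                 ≈⟨ Π*.sum-cong-≋ (λ i → nz-cong (el-idx (x * el i))) ⟨
      Π*.sum (λ i → nz (el (idx (x * el i))))      ≈⟨ Π*.sum-permute (λ i → nz (el i)) (bijection (x *_) (y *_) *-congˡ *-congˡ
                                                        (λ z → trans (sym (*-assoc x y z)) (trans (*-congʳ xy≈1) (*-identityˡ z)))
                                                        (λ z → trans (sym (*-assoc y x z)) (trans (*-congʳ (trans (*-comm y x) xy≈1)) (*-identityˡ z)))) ⟨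
      Π                                            ≈⟨ *-identityˡ Π ⟨
      1# * Π                                       ∎))
      where
      -- Replacing the factor at 0 by 1 turns the product over nonzero elements into one over the
      -- whole enumeration, where the permutation acts.
      nz h : Carrier → Carrier
      nz z with z ≟ 0#
      ... | yes _ = 1#
      ... | no  _ = z
      h z with z ≟ 0#
      ... | yes _ = 1#
      ... | no  _ = x
      nz-cong : ∀ {z z′} → z ≈ z′ → nz z ≈ nz z′
      nz-cong {z} {z′} e with z ≟ 0# | z′ ≟ 0#
      ... | yes _ | yes _ = refl
      ... | no  _ | no  _ = e
      ... | yes p | no ¬p = ⊥-elim (¬p (trans (sym e) p))
      ... | no ¬p | yes p = ⊥-elim (¬p (trans e p))
      nz-≉0 : ∀ z → ¬ nz z ≈ 0#
      nz-≉0 z with z ≟ 0#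
      ... | yes _  = 1≉0
      ... | no z≉0 = z≉0
      nz-* : ∀ z → nz (x * z) ≈ h z * nz z
      nz-* z with z ≟ 0# | (x * z) ≟ 0#
      ... | yes _ | yes _ = sym (*-identityˡ 1#)
      ... | no  _ | no  _ = refl
      ... | yes p | no ¬p = ⊥-elim (¬p (trans (*-congˡ p) (zeroʳ x)))
      ... | no ¬p | yes p = ⊥-elim (*-≉0 x≉0 ¬p p)
      Π = Π*.sum (λ i → nz (el i))
      product-≉0 : ∀ {n} (t : Fin n → Carrier) → (∀ i → ¬ t i ≈ 0#) → ¬ Π*.sum t ≈ 0#
      product-≉0 {zero}  t _  = 1≉0
      product-≉0 {suc n} t ne = *-≉0 (ne zero) (product-≉0 (t ∘ suc) (λ i → ne (suc i)))
      Π≉0 : ¬ Π ≈ 0#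
      Π≉0 = product-≉0 _ (λ i → nz-≉0 (el i))
      h-0 : ∀ z → z ≈ 0# → h z ≈ 1#
      h-0 z e with z ≟ 0#
      ... | yes _ = refl
      ... | no ¬p = ⊥-elim (¬p e)
      h-≉0 : ∀ z → ¬ z ≈ 0# → h z ≈ x
      h-≉0 z ne with z ≟ 0#
      ... | yes p = ⊥-elim (ne p)
      ... | no  _ = refl
      product-const : ∀ n → Π*.sum (λ (_ : Fin n) → x) ≈ x ^ n
      product-const zero    = refl
      product-const (suc n) = *-congˡ (product-const n)
      scale : Π*.sum (λ i → h (el i)) ≈ x ^ N
      scale = begin
        Π*.sum (λ i → h (el i))                           ≈⟨ Π*.sum-remove {i = idx 0#} (λ i → h (el i)) ⟩
        h (el (idx 0#)) * Π*.sum (λ j → h (nonzero j))    ≈⟨ *-cong (h-0 _ (el-idx 0#)) (Π*.sum-cong-≋ λ j → h-≉0 _ (nonzero-≉0 j)) ⟩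
        1# * Π*.sum (λ (_ : Fin N) → x)                   ≈⟨ trans (*-identityˡ _) (product-const N) ⟩
        x ^ N                                             ∎

    -- Polynomial functions in Horner form; the top coefficient l may be 0#.
    data Poly (l : Carrier) : ℕ → (Carrier → Carrier) → Set (c ⊔ ℓ) where
      const  : ∀ {f} → (∀ x → f x ≈ l) → Poly l 0 f
      horner : ∀ {d f g} k → Poly l d g → (∀ x → f x ≈ x * g x + k) → Poly l (suc d) f

    -- Synthetic division, f(x) - f(r) = (x - r) g(x), arranged without subtraction so that it
    -- reduces to semiring identities. The leading coefficient is preserved.
    quotient : ∀ {l d f} → Poly l (suc d) f → ∀ r → Σ (Carrier → Carrier) λ g → Poly l d g × (∀ x → f x + r * g x ≈ x * g x + f r)
    quotient {l} {f = f} (horner {g = g} k (const e) fe) r = (λ _ → l) , const (λ _ → refl) , λ x → begin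
      f x + r * l            ≈⟨ +-congʳ (trans (fe x) (+-congʳ (*-congˡ (e x)))) ⟩
      (x * l + k) + r * l    ≈⟨ solve 4 (λ x l k r → (x :* l :+ k) :+ r :* l := x :* l :+ (r :* l :+ k)) refl x l k r ⟩
      x * l + (r * l + k)    ≈⟨ +-congˡ (trans (fe r) (+-congʳ (*-congˡ (e r)))) ⟨
      x * l + f r            ∎
    quotient {l} {f = f} (horner {g = g} k pg@(horner _ _ _) fe) r with h , ph , he ← quotient pg r =
      (λ x → x * h x + g r) , horner (g r) ph (λ _ → refl) , λ x → begin
      f x + r * (x * h x + g r)                 ≈⟨ +-congʳ (fe x) ⟩
      (x * g x + k) + r * (x * h x + g r)       ≈⟨ solve 6 (λ x gx k r hx gr → (x :* gx :+ k) :+ r :* (x :* hx :+ gr) := x :* (gx :+ r :* hx) :+ (r :* gr :+ k)) refl x (g x) k r (h x) (g r) ⟩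
      x * (g x + r * h x) + (r * g r + k)       ≈⟨ +-cong (*-congˡ (he x)) (sym (fe r)) ⟩
      x * (x * h x + g r) + f r                 ∎

    roots-≤-degree : ∀ {d f} → Poly 1# d f → ∀ xs → AllPairs (λ x y → ¬ x ≈ y) xs → All (λ x → f x ≈ 0#) xs → length xs ℕ.≤ d
    roots-≤-degree pf        []       _        _        = ℕ.z≤n
    roots-≤-degree (const e) (x ∷ xs) _        (z ∷ _)  = ⊥-elim (1≉0 (trans (sym (e x)) z))
    roots-≤-degree {suc d} {f} pf@(horner _ _ _) (r ∷ xs) (ne ∷ nes) (z ∷ zs) with g , pg , ge ← quotient pf r =
      ℕ.s≤s (roots-≤-degree pg xs nes (All.zipWith root (ne , zs)))
      where
      root : ∀ {x} → (¬ r ≈ x) × (f x ≈ 0#) → g x ≈ 0#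
      root {x} (r≉x , fx≈0) = no-zero-divisors (begin
        (x - r) * g x        ≈⟨ [y-z]x≈yx-zx (g x) x r ⟩
        x * g x - r * g x    ≈⟨ x≈y⇒x-y≈0 (begin
            x * g x            ≈⟨ +-identityʳ _ ⟨
            x * g x + 0#       ≈⟨ +-congˡ z ⟨
            x * g x + f r      ≈⟨ ge x ⟨
            f x + r * g x      ≈⟨ +-congʳ fx≈0 ⟩
            0# + r * g x       ≈⟨ +-identityˡ _ ⟩
            r * g x            ∎) ⟩
        0#                   ∎) (λ e → r≉x (sym (x-y≈0⇒x≈y x r e)))

    Poly-cong : ∀ {l l′ d f f′} → l ≈ l′ → (∀ x → f′ x ≈ f x) → Poly l d f → Poly l′ d f′
    Poly-cong e fe (const ef)       = const (λ x → trans (fe x) (trans (ef x) e))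
    Poly-cong e fe (horner k pg ef) = horner k (Poly-cong e (λ _ → refl) pg) (λ x → trans (fe x) (ef x))

    Poly-+ : ∀ {l l′ d f f′} → Poly l d f → Poly l′ d f′ → Poly (l + l′) d (λ x → f x + f′ x)
    Poly-+ (const e) (const e′) = const (λ x → +-cong (e x) (e′ x))
    Poly-+ (horner {g = g} k pg e) (horner {g = g′} k′ pg′ e′) = horner (k + k′) (Poly-+ pg pg′) λ x →
      trans (+-cong (e x) (e′ x)) (solve 5 (λ x g k g′ k′ → (x :* g :+ k) :+ (x :* g′ :+ k′) := x :* (g :+ g′) :+ (k :+ k′)) refl x (g x) k (g′ x) k′)

    Poly-suc : ∀ {l d f} → Poly l d f → Poly 0# (suc d) f
    Poly-suc {l} (const e)        = horner l (const {f = λ _ → 0#} λ _ → refl) (λ x → trans (e x) (sym (trans (+-congʳ (zeroʳ x)) (+-identityˡ l))))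
    Poly-suc     (horner k pg ef) = horner k (Poly-suc pg) ef

    -- Pads with zero leading coefficients, because `Poly-+` adds polynomials of the same formal
    -- degree.
    Poly-raise : ∀ {d f} m {l} → d ℕ.< m → Poly l d f → Poly 0# m f
    Poly-raise (suc m) (ℕ.s≤s d≤m) pf with ℕ.m≤n⇒m<n∨m≡n d≤m
    ... | inj₁ d<m    = Poly-suc (Poly-raise m d<m pf)
    ... | inj₂ ≡.refl = Poly-suc pf

    Poly-^ : ∀ d → Poly 1# d (_^ d)
    Poly-^ zero    = const (λ _ → refl)
    Poly-^ (suc d) = horner 0# (Poly-^ d) (λ x → sym (+-identityʳ _))

    -- Otherwise X^m - 1 would have N > m roots.
    exists-non-root-of-unity : ∀ m → 0 ℕ.< m → m ℕ.< N → Σ Carrier λ x → ¬ x ≈ 0# × ¬ x ^ m ≈ 1#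
    exists-non-root-of-unity m 0<m m<N with Fin.any? (λ j → ¬? (nonzero j ^ m ≟ 1#))
    ... | yes (j , ne) = nonzero j , nonzero-≉0 j , ne
    ... | no none = ⊥-elim (ℕ.<⇒≱ m<N (subst (ℕ._≤ m) (length-tabulate nonzero)
        (roots-≤-degree poly (tabulate nonzero) (AllPairs.tabulate⁺ (λ i≢j e → i≢j (nonzero-injective e)))
          (All.tabulate⁺ λ j → x≈y⇒x-y≈0 (decidable-stable (nonzero j ^ m ≟ 1#) λ ne → none (j , ne))))))
      where
      poly : Poly 1# m (λ x → x ^ m - 1#)
      poly = Poly-cong (+-identityʳ 1#) (λ _ → refl) (Poly-+ (Poly-^ m) (Poly-raise m 0<m (const {f = λ _ → - 1#} λ _ → refl)))

-- Existence of a generator, discrete logarithms and freeness.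

module PrimitiveElements where
  open import Defs
  open RangeSums using (∑; 𝟙; ∑-const)
  open FiniteFields
  open PrimeKernels using (prime∤⇒coprime)
  open import Algebra.Bundles using (CommutativeRing)
  open import Data.Nat as ℕ using (ℕ; zero; suc)
  import Data.Nat.Properties as ℕ
  import Data.Nat.Divisibility as ℕ
  open import Data.Nat.Coprimality using (Coprime; coprime-divisor) renaming (sym to coprime-sym)
  open import Data.Nat.GCD using (module Bézout; gcd; gcd-GCD; gcd[m,n]∣m; gcd[m,n]∣n)
  open import Data.Nat.Primality using (Prime; prime⇒nonZero; prime⇒nonTrivial)
  open import Data.Nat.Primality.Factorisation using (factorise)
  open import Data.Nat.Induction using (<-rec)
  open import Data.Nat.ListAction using (product)
  import Data.Integer as ℤ
  import Data.Integer.Properties as ℤ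
  open import Data.Unit using (⊤; tt)
  open import Data.Fin as Fin using (zero; suc)
  open import Data.List using (List; []; _∷_; length)
  open import Data.List.Relation.Unary.All as All using (All; []; _∷_)
  open import Data.List.Relation.Unary.AllPairs using (AllPairs; []; _∷_)
  open import Data.Product using (Σ; _×_; _,_; proj₁; proj₂)
  open import Data.Sum using (_⊎_; inj₁; inj₂)
  open import Data.Empty using (⊥-elim)
  open import Relation.Nullary using (¬_; Dec; yes; no)
  open import Relation.Binary.PropositionalEquality as ≡ using (_≡_; _≢_; cong; subst)

  coprime-^ : ∀ {l m} → Coprime l m → ∀ a → Coprime (l ℕ.^ a) m
  coprime-^ c zero    (d∣1 , _) = ℕ.∣1⇒≡1 d∣1
  coprime-^ {l} {m} c (suc a) {d} (d∣ , d∣m) =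
    coprime-^ c a (coprime-divisor {d} {l} (λ (i , j) → c (j , ℕ.∣-trans i d∣m)) d∣ , d∣m)

  coprime-*-∣ : ∀ {m m′ k} → Coprime m m′ → m ℕ.∣ k → m′ ℕ.∣ k → m ℕ.* m′ ℕ.∣ k
  coprime-*-∣ {m} {m′} cop m∣k (ℕ.divides c ≡.refl) = ℕ.*-monoˡ-∣ m′ (coprime-divisor cop (subst (m ℕ.∣_) (ℕ.*-comm c m′) m∣k))

  ∣-prime-power : ∀ {l} → Prime l → ∀ a {d} → d ℕ.∣ l ℕ.^ suc a → d ≡ l ℕ.^ suc a ⊎ d ℕ.∣ l ℕ.^ a
  ∣-prime-power {l} pl a {d} (ℕ.divides c eq) with l ℕ.∣? c
  ... | yes (ℕ.divides c′ ≡.refl) = inj₂ (ℕ.divides c′ (ℕ.*-cancelˡ-≡ _ _ l {{prime⇒nonZero pl}}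
          (≡.trans eq (≡.trans (cong (ℕ._* d) (ℕ.*-comm c′ l)) (ℕ.*-assoc l c′ d)))))
  ... | no l∤c with ≡.refl ← coprime-^ (prime∤⇒coprime pl l∤c) (suc a) (ℕ.divides d (≡.trans eq (ℕ.*-comm c d)) , ℕ.∣-refl) =
    inj₁ (≡.trans (≡.sym (ℕ.*-identityˡ d)) (≡.sym eq))

  prime-power-part : ∀ {l} → Prime l → ∀ m → 0 ℕ.< m → Σ ℕ λ a → Σ ℕ λ m′ → m ≡ l ℕ.^ a ℕ.* m′ × ¬ l ℕ.∣ m′
  prime-power-part {l} pl = <-rec _ λ m rec 0<m → step m rec 0<m
    where
    step : ∀ m → (∀ {k} → k ℕ.< m → 0 ℕ.< k → Σ ℕ λ a → Σ ℕ λ m′ → k ≡ l ℕ.^ a ℕ.* m′ × ¬ l ℕ.∣ m′) →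
      0 ℕ.< m → Σ ℕ λ a → Σ ℕ λ m′ → m ≡ l ℕ.^ a ℕ.* m′ × ¬ l ℕ.∣ m′
    step m rec 0<m with l ℕ.∣? m
    ... | no l∤m = 0 , m , ≡.sym (ℕ.*-identityˡ m) , l∤m
    ... | yes (ℕ.divides zero ≡.refl) = ⊥-elim (ℕ.<-irrefl ≡.refl 0<m)
    ... | yes (ℕ.divides k@(suc _) ≡.refl) with a , m′ , eq , n ← rec (ℕ.m<m*n k l (ℕ.nonTrivial⇒n>1 l {{prime⇒nonTrivial pl}})) ℕ.z<s =
      suc a , m′ , ≡.trans (ℕ.*-comm k l) (≡.trans (cong (l ℕ.*_) eq) (≡.sym (ℕ.*-assoc l (l ℕ.^ a) m′))) , n

  prime-divisor : ∀ m → 1 ℕ.< m → Σ ℕ λ l → Prime l × l ℕ.∣ m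
  prime-divisor m 1<m with factorise m {{ℕ.>-nonZero (ℕ.<-trans ℕ.z<s 1<m)}}
  ... | record { factors = [] ; isFactorisation = eq } = ⊥-elim (ℕ.<-irrefl (≡.sym eq) 1<m)
  ... | record { factors = l ∷ ls ; isFactorisation = eq ; factorsPrime = pl ∷ _ } = l , pl , ℕ.divides (product ls) (≡.trans eq (ℕ.*-comm l (product ls)))

  module Generator {c ℓ} (F : CommutativeRing c ℓ) {N : ℕ} (ff : IsFiniteFieldOfSize F (suc N)) where
    open CommutativeRing F hiding (zero)
    open FiniteField F ff
    open import Algebra.Properties.AbelianGroup +-abelianGroup using () renaming (x≈y⇒x∙y⁻¹≈ε to x≈y⇒x-y≈0)
    open import Relation.Binary.Reasoning.Setoid setoid

    HasOrder : Carrier → ℕ → Set ℓ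
    HasOrder x m = x ^ m ≈ 1# × (∀ k → x ^ k ≈ 1# → m ℕ.∣ k)

    ^-multiple : ∀ {x m} → x ^ m ≈ 1# → ∀ j → x ^ (j ℕ.* m) ≈ 1#
    ^-multiple {x} {m} e j = trans (^-* x j m) (trans (^-cong j e) (1^ j))

    ^-∣ : ∀ {x m k} → x ^ m ≈ 1# → m ℕ.∣ k → x ^ k ≈ 1#
    ^-∣ e (ℕ.divides j ≡.refl) = ^-multiple e j

    ^-gcd : ∀ {x} m k → x ^ m ≈ 1# → x ^ k ≈ 1# → x ^ gcd m k ≈ 1#
    ^-gcd {x} m k e e′ with Bézout.identity (gcd-GCD m k)
    ... | Bézout.+- u v eq = begin
      x ^ gcd m k                        ≈⟨ *-identityʳ _ ⟨
      x ^ gcd m k * 1#                   ≈⟨ *-congˡ (^-multiple e′ v) ⟨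
      x ^ gcd m k * x ^ (v ℕ.* k)        ≈⟨ ^-+ x (gcd m k) (v ℕ.* k) ⟨
      x ^ (gcd m k ℕ.+ v ℕ.* k)          ≡⟨ cong (x ^_) eq ⟩
      x ^ (u ℕ.* m)                      ≈⟨ ^-multiple e u ⟩
      1#                                 ∎
    ... | Bézout.-+ u v eq = begin
      x ^ gcd m k                        ≈⟨ *-identityʳ _ ⟨
      x ^ gcd m k * 1#                   ≈⟨ *-congˡ (^-multiple e u) ⟨
      x ^ gcd m k * x ^ (u ℕ.* m)        ≈⟨ ^-+ x (gcd m k) (u ℕ.* m) ⟨
      x ^ (gcd m k ℕ.+ u ℕ.* m)          ≡⟨ cong (x ^_) eq ⟩
      x ^ (v ℕ.* k)                      ≈⟨ ^-multiple e′ v ⟩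
      1#                                 ∎

    -- Choose x with x^(N/l) ≠ 1 and let z = x^k, where N = k l^(a+1); then z^(l^a) ≠ 1. If z^j = 1,
    -- the gcd of j and l^(a+1) also kills z, so it cannot divide l^a and must be l^(a+1).
    order-prime-power : ∀ {l} → Prime l → 0 ℕ.< N → ∀ a → l ℕ.^ a ℕ.∣ N → Σ Carrier λ x → ¬ x ≈ 0# × HasOrder x (l ℕ.^ a)
    order-prime-power pl 0<N zero    _ = 1# , 1≉0 , *-identityʳ 1# , λ k _ → ℕ.1∣ k
    order-prime-power {l} pl 0<N (suc a) (ℕ.divides k eq) =
      z , ^-≉0 x≉0 k , z^≈1 , divides-exponent
      where
      instance _ = prime⇒nonZero pl
      m = k ℕ.* l ℕ.^ a
      N≡ : N ≡ m ℕ.* l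
      N≡ = ≡.trans eq (≡.trans (cong (k ℕ.*_) (ℕ.*-comm l (l ℕ.^ a))) (≡.sym (ℕ.*-assoc k (l ℕ.^ a) l)))
      0<m : 0 ℕ.< m
      0<m = ℕ.n≢0⇒n>0 λ m≡0 → ℕ.<-irrefl (≡.sym (≡.trans N≡ (cong (ℕ._* l) m≡0))) 0<N
      m<N : m ℕ.< N
      m<N = subst (m ℕ.<_) (≡.sym N≡) (ℕ.m<m*n m l {{ℕ.>-nonZero 0<m}} (ℕ.nonTrivial⇒n>1 l {{prime⇒nonTrivial pl}}))
      found = exists-non-root-of-unity m 0<m m<N
      x = proj₁ found
      x≉0 = proj₁ (proj₂ found)
      z = x ^ k
      z^≈1 : z ^ (l ℕ.^ suc a) ≈ 1#
      z^≈1 = trans (sym (^-*′ x k (l ℕ.^ suc a))) (trans (reflexive (cong (x ^_) (≡.sym eq))) (lagrange x≉0))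
      divides-exponent : ∀ j → z ^ j ≈ 1# → l ℕ.^ suc a ℕ.∣ j
      divides-exponent j e with ∣-prime-power pl a (gcd[m,n]∣n j (l ℕ.^ suc a))
      ... | inj₁ d≡ = subst (ℕ._∣ j) d≡ (gcd[m,n]∣m j (l ℕ.^ suc a))
      ... | inj₂ d∣ = ⊥-elim (proj₂ (proj₂ found) (trans (^-*′ x k (l ℕ.^ a)) (^-∣ (^-gcd j (l ℕ.^ suc a) e z^≈1) d∣)))

    order-* : ∀ {x y m m′} → Coprime m m′ → HasOrder x m → HasOrder y m′ → HasOrder (x * y) (m ℕ.* m′)
    order-* {x} {y} {m} {m′} cop (xm , xd) (ym , yd) = power , divides-exponent
      where
      power : (x * y) ^ (m ℕ.* m′) ≈ 1#
      power = trans (*-^ x y (m ℕ.* m′)) (trans (*-cong (^-∣ {x} {m} xm (ℕ.m∣m*n m′)) (^-∣ {y} {m′} ym (ℕ.n∣m*n m))) (*-identityˡ 1#))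
      m∣ : ∀ k → (x * y) ^ k ≈ 1# → m ℕ.∣ k
      m∣ k e = coprime-divisor cop (xd (m′ ℕ.* k) (begin
        x ^ (m′ ℕ.* k)                     ≈⟨ *-identityʳ _ ⟨
        x ^ (m′ ℕ.* k) * 1#                ≈⟨ *-congˡ (^-∣ {y} {m′} ym (ℕ.m∣m*n k)) ⟨
        x ^ (m′ ℕ.* k) * y ^ (m′ ℕ.* k)    ≈⟨ *-^ x y (m′ ℕ.* k) ⟨
        (x * y) ^ (m′ ℕ.* k)               ≈⟨ ^-multiple {x * y} {k} e m′ ⟩
        1#                                 ∎))
      m′∣ : ∀ k → (x * y) ^ k ≈ 1# → m′ ℕ.∣ k
      m′∣ k e = coprime-divisor (coprime-sym cop) (yd (m ℕ.* k) (begin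
        y ^ (m ℕ.* k)                      ≈⟨ *-identityˡ _ ⟨
        1# * y ^ (m ℕ.* k)                 ≈⟨ *-congʳ (^-∣ {x} {m} xm (ℕ.m∣m*n k)) ⟨
        x ^ (m ℕ.* k) * y ^ (m ℕ.* k)      ≈⟨ *-^ x y (m ℕ.* k) ⟨
        (x * y) ^ (m ℕ.* k)                ≈⟨ ^-multiple {x * y} {k} e m ⟩
        1#                                 ∎))
      divides-exponent : ∀ k → (x * y) ^ k ≈ 1# → m ℕ.* m′ ℕ.∣ k
      divides-exponent k e = coprime-*-∣ cop (m∣ k e) (m′∣ k e)

    order-exists : 0 ℕ.< N → ∀ m → 0 ℕ.< m → m ℕ.∣ N → Σ Carrier λ x → ¬ x ≈ 0# × HasOrder x m
    order-exists 0<N = <-rec _ step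
      where
      step : ∀ m → (∀ {k} → k ℕ.< m → 0 ℕ.< k → k ℕ.∣ N → Σ Carrier λ x → ¬ x ≈ 0# × HasOrder x k) →
        0 ℕ.< m → m ℕ.∣ N → Σ Carrier λ x → ¬ x ≈ 0# × HasOrder x m
      module _ {m l a m′} (pl : Prime l) (eq : m ≡ l ℕ.^ suc a ℕ.* m′) (l∤m′ : ¬ l ℕ.∣ m′) where
        instance _ = prime⇒nonZero pl
        0<m′ : 0 ℕ.< m′
        0<m′ = ℕ.n≢0⇒n>0 λ { ≡.refl → l∤m′ (l ℕ.∣0) }
        m′<m : m′ ℕ.< m
        m′<m = subst (m′ ℕ.<_) (≡.trans (ℕ.*-comm m′ _) (≡.sym eq)) (ℕ.m<m*n m′ (l ℕ.^ suc a) {{ℕ.>-nonZero 0<m′}}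
          (ℕ.<-≤-trans (ℕ.nonTrivial⇒n>1 l {{prime⇒nonTrivial pl}}) (ℕ.m≤m*n l (l ℕ.^ a) {{ℕ.m^n≢0 l a}})))
        combine : (Σ Carrier λ x → ¬ x ≈ 0# × HasOrder x (l ℕ.^ suc a)) → (Σ Carrier λ x → ¬ x ≈ 0# × HasOrder x m′) →
          Σ Carrier λ x → ¬ x ≈ 0# × HasOrder x m
        combine (x , x≉0 , ox) (y , y≉0 , oy) = x * y , *-≉0 x≉0 y≉0 ,
          subst (HasOrder (x * y)) (≡.sym eq) (order-* (coprime-^ (prime∤⇒coprime pl l∤m′) (suc a)) ox oy)
      split : ∀ m → (∀ {k} → k ℕ.< m → 0 ℕ.< k → k ℕ.∣ N → Σ Carrier λ x → ¬ x ≈ 0# × HasOrder x k) →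
        m ℕ.∣ N → ∀ {l} → Prime l → l ℕ.∣ m → (Σ ℕ λ a → Σ ℕ λ m′ → m ≡ l ℕ.^ a ℕ.* m′ × ¬ l ℕ.∣ m′) →
        Σ Carrier λ x → ¬ x ≈ 0# × HasOrder x m
      split m rec m∣N {l} pl l∣m (zero , m′ , eq , l∤m′) = ⊥-elim (l∤m′ (subst (l ℕ.∣_) (≡.trans eq (ℕ.*-identityˡ m′)) l∣m))
      split m rec m∣N {l} pl l∣m (suc a , m′ , eq , l∤m′) = combine {a = a} pl eq l∤m′
        (order-prime-power pl 0<N (suc a) (ℕ.∣-trans (ℕ.divides m′ (≡.trans eq (ℕ.*-comm _ m′))) m∣N))
        (rec (m′<m {a = a} pl eq l∤m′) (0<m′ {a = a} pl eq l∤m′) (ℕ.∣-trans (ℕ.divides (l ℕ.^ suc a) eq) m∣N))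
      step 1 _ _ _ = 1# , 1≉0 , *-identityʳ 1# , λ k _ → ℕ.1∣ k
      step m@(suc (suc _)) rec 0<m m∣N = pick (prime-divisor m (ℕ.s<s ℕ.z<s))
        where
        pick : (Σ ℕ λ l → Prime l × l ℕ.∣ m) → Σ Carrier λ x → ¬ x ≈ 0# × HasOrder x m
        pick (l , pl , l∣m) = split m rec m∣N pl l∣m (prime-power-part pl m 0<m)

    module Log (0<N : 0 ℕ.< N) where
      abstract
        generator : Σ Carrier λ g → ¬ g ≈ 0# × HasOrder g N
        generator = order-exists 0<N N 0<N ℕ.∣-refl

      g : Carrier
      g = proj₁ generator

      g≉0 : ¬ g ≈ 0#
      g≉0 = proj₁ (proj₂ generator)

      g^N : g ^ N ≈ 1#
      g^N = proj₁ (proj₂ (proj₂ generator))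

      g^-∣ : ∀ k → g ^ k ≈ 1# → N ℕ.∣ k
      g^-∣ = proj₂ (proj₂ (proj₂ generator))

      g^-period : ∀ a → g ^ (N ℕ.+ a) ≈ g ^ a
      g^-period a = trans (^-+ g N a) (trans (*-congʳ g^N) (*-identityˡ _))

      g^-injective-≤ : ∀ {a b} → a ℕ.≤ b → b ℕ.< N → g ^ a ≈ g ^ b → a ≡ b
      g^-injective-≤ {a} {b} a≤b b<N e with b ℕ.∸ a in eq
      ... | zero  = ℕ.≤-antisym a≤b (ℕ.m∸n≡0⇒m≤n eq)
      ... | suc k = ⊥-elim (ℕ.>⇒∤ (ℕ.≤-<-trans (subst (ℕ._≤ b) eq (ℕ.m∸n≤m b a)) b<N) (g^-∣ (suc k) (cancelˡ (^-≉0 g≉0 a) (begin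
        g ^ a * g ^ suc k           ≈⟨ ^-+ g a (suc k) ⟨
        g ^ (a ℕ.+ suc k)           ≡⟨ cong (g ^_) (≡.trans (cong (a ℕ.+_) (≡.sym eq)) (ℕ.m+[n∸m]≡n a≤b)) ⟩
        g ^ b                       ≈⟨ e ⟨
        g ^ a                       ≈⟨ *-identityʳ _ ⟨
        g ^ a * 1#                  ∎))))

      g^-injective : ∀ {a b} → a ℕ.< N → b ℕ.< N → g ^ a ≈ g ^ b → a ≡ b
      g^-injective {a} {b} a<N b<N e with ℕ.≤-total a b
      ... | inj₁ a≤b = g^-injective-≤ a≤b b<N e
      ... | inj₂ b≤a = ≡.sym (g^-injective-≤ b≤a a<N (sym e))

      module _ {p} {P : ℕ → Set p} (P? : ∀ a → Dec (P a)) where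
        -- Turns a sum of indicators over exponents into the length of a list of distinct field
        -- elements, to which `roots-≤-degree` applies.
        powersWhere : ℕ → List Carrier
        powersWhere zero = []
        powersWhere (suc m) with P? m
        ... | yes _ = g ^ m ∷ powersWhere m
        ... | no  _ = powersWhere m

        powersWhere-length : ∀ m → ℤ.+ length (powersWhere m) ≡ ∑ m (λ a → 𝟙 (P? a))
        powersWhere-length zero = ≡.refl
        powersWhere-length (suc m) with P? m
        ... | yes _ = ≡.trans (ℤ.pos-+ 1 _) (≡.trans (ℤ.+-comm (ℤ.+ 1) (ℤ.+ length (powersWhere m))) (cong (ℤ._+ ℤ.1ℤ) (powersWhere-length m)))
        ... | no  _ = ≡.trans (powersWhere-length m) (≡.sym (ℤ.+-identityʳ _))

        powersWhere-All : ∀ {r} {R : Carrier → Set r} → ∀ m → (∀ a → a ℕ.< m → P a → R (g ^ a)) → All R (powersWhere m)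
        powersWhere-All zero    _ = []
        powersWhere-All (suc m) f with P? m
        ... | yes p = f m ℕ.≤-refl p ∷ powersWhere-All m (λ a a<m → f a (ℕ.m<n⇒m<1+n a<m))
        ... | no  _ = powersWhere-All m (λ a a<m → f a (ℕ.m<n⇒m<1+n a<m))

        powersWhere-distinct : ∀ m → m ℕ.≤ N → AllPairs (λ x y → ¬ x ≈ y) (powersWhere m)
        powersWhere-distinct zero    _ = []
        powersWhere-distinct (suc m) m<N with P? m
        ... | yes _ = powersWhere-All m (λ a a<m _ e → ℕ.<-irrefl (≡.sym (g^-injective m<N (ℕ.<-trans a<m m<N) e)) a<m) ∷ powersWhere-distinct m (ℕ.<⇒≤ m<N)
        ... | no  _ = powersWhere-distinct m (ℕ.<⇒≤ m<N)

      -- The `N` powers of `g` are already roots of X^N - 1; an element outside them would be one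
      -- root too many.
      log : ∀ {x} → ¬ x ≈ 0# → Σ ℕ λ a → a ℕ.< N × g ^ a ≈ x
      log {x} x≉0 with ℕ.anyUpTo? (λ a → g ^ a ≟ x) N
      ... | yes found = found
      ... | no none = ⊥-elim (ℕ.<-irrefl ≡.refl (subst (λ k → suc k ℕ.≤ N) count
          (roots-≤-degree poly (x ∷ all) (powersWhere-All always N (λ a a<N _ e → none (a , a<N , sym e)) ∷ powersWhere-distinct always N ℕ.≤-refl)
            (x≈y⇒x-y≈0 (lagrange x≉0) ∷ powersWhere-All always N (λ a _ _ → x≈y⇒x-y≈0 (lagrange (^-≉0 g≉0 a)))))))
        where
        always : ∀ (a : ℕ) → Dec ⊤
        always _ = yes tt
        all = powersWhere always N
        count : length all ≡ N
        count = ℤ.+-injective (≡.trans (powersWhere-length always N) (≡.trans (∑-const N ℤ.1ℤ) (ℤ.*-identityʳ (ℤ.+ N))))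
        poly : Poly 1# N (λ x → x ^ N - 1#)
        poly = Poly-cong (+-identityʳ 1#) (λ _ → refl) (Poly-+ (Poly-^ N) (Poly-raise N 0<N (const {f = λ _ → - 1#} λ _ → refl)))

      exponent-∣ : ∀ {l x y} → l ℕ.∣ N → g ^ x ≈ g ^ y → l ℕ.∣ y → l ℕ.∣ x
      -- The exponent y (N - 1) + x stands for x - y modulo `N`.
      exponent-∣ {l} {x} {y} l∣N e l∣y = ℕ.∣m+n∣m⇒∣n (ℕ.∣-trans l∣N (g^-∣ (y ℕ.* ℕ.pred N ℕ.+ x) (begin
        g ^ (y ℕ.* ℕ.pred N ℕ.+ x)           ≈⟨ trans (^-+ g (y ℕ.* ℕ.pred N) x) (*-congˡ e) ⟩
        g ^ (y ℕ.* ℕ.pred N) * g ^ y         ≈⟨ ^-+ g (y ℕ.* ℕ.pred N) y ⟨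
        g ^ (y ℕ.* ℕ.pred N ℕ.+ y)           ≡⟨ cong (g ^_) exponent ⟩
        g ^ (y ℕ.* N)                        ≈⟨ ^-multiple {g} {N} g^N y ⟩
        1#                                   ∎))) (ℕ.∣m⇒∣m*n (ℕ.pred N) l∣y)
        where
        exponent : y ℕ.* ℕ.pred N ℕ.+ y ≡ y ℕ.* N
        exponent = ≡.trans (ℕ.+-comm (y ℕ.* ℕ.pred N) y) (≡.trans (≡.sym (ℕ.*-suc y (ℕ.pred N))) (cong (y ℕ.*_) (ℕ.suc-pred N {{ℕ.>-nonZero 0<N}})))

      -- If g^a = ζ^d with d > 1, take a prime l dividing d and write ζ as a power of `g`: then a is
      -- a multiple of d modulo N, hence divisible by l.
      g^-free : ∀ {a} → (∀ {l} → Prime l → l ℕ.∣ N → ¬ l ℕ.∣ a) → Free F N (g ^ a)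
      g^-free {a} avoids = ^-≉0 g≉0 a , d≡1
        where
        d≡1 : ∀ d ζ → d ℕ.∣ N → ¬ ζ ≈ 0# → g ^ a ≈ ζ ^ d → d ≡ 1
        d≡1 zero ζ d∣N _ _ = ⊥-elim (ℕ.<-irrefl (≡.sym (ℕ.0∣⇒≡0 d∣N)) 0<N)
        d≡1 1 ζ _ _ _ = ≡.refl
        d≡1 d@(suc (suc _)) ζ d∣N ζ≉0 e =
          let l , pl , l∣d = prime-divisor d (ℕ.s<s ℕ.z<s)
              b , _ , g^b≈ζ = log ζ≉0
              l∣N = ℕ.∣-trans l∣d d∣N
          in ⊥-elim (avoids pl l∣N (exponent-∣ l∣N (trans e (trans (^-cong d (sym g^b≈ζ)) (sym (^-* g d b)))) (ℕ.∣m⇒∣m*n b l∣d)))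

-- The trace map and the distribution of its values.

module TraceDistribution where
  open import Defs
  open RangeSums
  open FreshmansDream
  open FiniteFields
  open PrimitiveElements
  open SecondMoments
  open import Algebra.Bundles using (CommutativeRing)
  open import Data.Nat as ℕ using (ℕ; zero; suc)
  import Data.Nat.Properties as ℕ
  import Data.Nat.Divisibility as ℕ
  open import Data.Nat.GCD using (module Bézout)
  open import Data.Nat.Primality using (Prime)
  import Data.Integer as ℤ
  import Data.Integer.Properties as ℤ
  open import Data.Integer.Tactic.RingSolver using (solve-∀)
  open import Data.Fin as Fin using (zero; suc)
  open import Data.List using (_∷_)
  open import Data.List.Relation.Unary.All as All using (_∷_)
  open import Data.List.Relation.Unary.AllPairs using (_∷_)
  open import Data.Product using (Σ; _×_; _,_; proj₁; proj₂)
  open import Data.Sum using (_⊎_; inj₁; inj₂)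
  open import Relation.Nullary using (¬_; Dec; yes; no)
  open import Relation.Binary.PropositionalEquality as ≡ using (_≡_; _≢_; cong; cong₂; subst)

  module TraceField {c ℓ} (F : CommutativeRing c ℓ) {N : ℕ} (ff : IsFiniteFieldOfSize F (suc N)) (0<N : 0 ℕ.< N)
    {p e J n Q : ℕ} (pp : Prime p) (q≡ : suc J ≡ p ℕ.^ e) (size : suc N ≡ suc J ℕ.^ suc n) (0<J : 0 ℕ.< J) (QJ≡N : Q ℕ.* J ≡ N)
    (β : CommutativeRing.Carrier F) (β∈ : InSubfield F (suc J) β) (β≉0 : ¬ CommutativeRing._≈_ F β (CommutativeRing.0# F)) where
    open CommutativeRing F hiding (zero)
    open FiniteField F ff
    open Generator F ff
    open Log 0<N
    open IsFiniteFieldOfSize ff using (inverse)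
    open import Algebra.Properties.AbelianGroup +-abelianGroup using () renaming (x∙y⁻¹≈ε⇒x≈y to x-y≈0⇒x≈y; x≈y⇒x∙y⁻¹≈ε to x≈y⇒x-y≈0; ∙-cancelˡ to +-cancelˡ; ∙-cancelʳ to +-cancelʳ)
    open import Algebra.Properties.Semiring.Mult semiring using (×-assoc-*; ×-congʳ) renaming (_×_ to _⋆_)
    import Algebra.Properties.Semiring.Exp semiring as Exp
    open import Algebra.Solver.Ring.NaturalCoefficients.Default commutativeSemiring using (solve; _:+_; _:=_)
    open Freshman commutativeSemiring using (freshman)
    open import Relation.Binary.Reasoning.Setoid setoid

    -- The extension has degree `suc n`, so `Y` is q to the degree minus one, the size of each fibre
    -- of the trace.
    q Y : ℕ
    q = suc J
    Y = q ℕ.^ n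

    ^≡Exp : ∀ x k → x ^ k ≡ x Exp.^ k
    ^≡Exp x zero    = ≡.refl
    ^≡Exp x (suc k) = cong (x *_) (^≡Exp x k)

    p⋆≈0 : ∀ x → p ⋆ x ≈ 0#
    p⋆≈0 x = begin
      p ⋆ x           ≈⟨ ×-congʳ p (*-identityˡ x) ⟨
      p ⋆ (1# * x)    ≈⟨ ×-assoc-* p 1# x ⟨
      (p ⋆ 1#) * x    ≈⟨ *-congʳ (characteristic p (e ℕ.* suc n) (trans (reflexive (cong (_⋆ 1#) p^≡)) size⋆1≈0)) ⟩
      0# * x          ≈⟨ zeroˡ x ⟩
      0#              ∎
      where
      p^≡ : p ℕ.^ (e ℕ.* suc n) ≡ suc N
      p^≡ = ≡.trans (≡.sym (ℕ.^-*-assoc p e (suc n))) (≡.trans (cong (ℕ._^ suc n) (≡.sym q≡)) (≡.sym size))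

    frobenius-p : ∀ x y → (x + y) ^ p ≈ x ^ p + y ^ p
    frobenius-p x y with z , eq ← freshman pp x y = begin
      (x + y) ^ p                            ≡⟨ ^≡Exp (x + y) p ⟩
      (x + y) Exp.^ p                        ≈⟨ eq ⟩
      (x Exp.^ p + y Exp.^ p) + p ⋆ z        ≈⟨ trans (+-congˡ (p⋆≈0 z)) (+-identityʳ _) ⟩
      x Exp.^ p + y Exp.^ p                  ≡⟨ cong₂ _+_ (^≡Exp x p) (^≡Exp y p) ⟨
      x ^ p + y ^ p                          ∎

    frobenius-p^ : ∀ k x y → (x + y) ^ (p ℕ.^ k) ≈ x ^ (p ℕ.^ k) + y ^ (p ℕ.^ k)
    frobenius-p^ zero    x y = trans (*-identityʳ _) (sym (+-cong (*-identityʳ x) (*-identityʳ y)))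
    frobenius-p^ (suc k) x y = begin
      (x + y) ^ (p ℕ.* p ℕ.^ k)              ≈⟨ ^-*′ (x + y) p (p ℕ.^ k) ⟩
      ((x + y) ^ p) ^ (p ℕ.^ k)              ≈⟨ ^-cong (p ℕ.^ k) (frobenius-p x y) ⟩
      (x ^ p + y ^ p) ^ (p ℕ.^ k)            ≈⟨ frobenius-p^ k (x ^ p) (y ^ p) ⟩
      (x ^ p) ^ (p ℕ.^ k) + (y ^ p) ^ (p ℕ.^ k) ≈⟨ +-cong (^-*′ x p (p ℕ.^ k)) (^-*′ y p (p ℕ.^ k)) ⟨
      x ^ (p ℕ.* p ℕ.^ k) + y ^ (p ℕ.* p ℕ.^ k) ∎

    frobenius : ∀ i x y → (x + y) ^ (q ℕ.^ i) ≈ x ^ (q ℕ.^ i) + y ^ (q ℕ.^ i)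
    frobenius i x y = subst (λ m → (x + y) ^ m ≈ x ^ m + y ^ m) (≡.sym (≡.trans (cong (ℕ._^ i) q≡) (ℕ.^-*-assoc p e i))) (frobenius-p^ (e ℕ.* i) x y)

    frobenius₁ : ∀ x y → (x + y) ^ q ≈ x ^ q + y ^ q
    frobenius₁ x y = subst (λ m → (x + y) ^ m ≈ x ^ m + y ^ m) (ℕ.*-identityʳ q) (frobenius 1 x y)

    tr : ℕ → Carrier → Carrier
    tr = Tr F q

    tr-cong : ∀ i {x y} → x ≈ y → tr i x ≈ tr i y
    tr-cong zero    e = refl
    tr-cong (suc i) e = +-cong (^-cong (q ℕ.^ i) e) (tr-cong i e)

    tr-+ : ∀ i x y → tr i (x + y) ≈ tr i x + tr i y
    tr-+ zero    x y = sym (+-identityˡ 0#)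
    tr-+ (suc i) x y = trans (+-cong (frobenius i x y) (tr-+ i x y))
      (solve 4 (λ a b c d → (a :+ b) :+ (c :+ d) := (a :+ c) :+ (b :+ d)) refl (x ^ (q ℕ.^ i)) (y ^ (q ℕ.^ i)) (tr i x) (tr i y))

    subfield-^ : ∀ {y} → y ^ q ≈ y → ∀ i → y ^ (q ℕ.^ i) ≈ y
    subfield-^ {y} e zero    = *-identityʳ y
    subfield-^ {y} e (suc i) = trans (^-*′ y q (q ℕ.^ i)) (trans (^-cong (q ℕ.^ i) e) (subfield-^ e i))

    tr-scale : ∀ {y} → y ^ q ≈ y → ∀ i x → tr i (y * x) ≈ y * tr i x
    tr-scale {y} e zero    x = sym (zeroʳ y)
    tr-scale {y} e (suc i) x = trans (+-cong (trans (*-^ y x (q ℕ.^ i)) (*-congʳ (subfield-^ e i))) (tr-scale e i x)) (sym (distribˡ y _ _))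

    tr-^q : ∀ i x → tr i x ^ q + x ≈ tr (suc i) x
    tr-^q zero    x = begin
      0# ^ q + x          ≈⟨ +-congʳ (0^ q ℕ.z<s) ⟩
      0# + x              ≈⟨ +-comm 0# x ⟩
      x + 0#              ≈⟨ +-congʳ (*-identityʳ x) ⟨
      x * 1# + 0#         ∎
    tr-^q (suc i) x = begin
      (x ^ (q ℕ.^ i) + tr i x) ^ q + x               ≈⟨ +-congʳ (frobenius₁ (x ^ (q ℕ.^ i)) (tr i x)) ⟩
      ((x ^ (q ℕ.^ i)) ^ q + tr i x ^ q) + x         ≈⟨ +-assoc _ _ _ ⟩
      (x ^ (q ℕ.^ i)) ^ q + (tr i x ^ q + x)         ≈⟨ +-cong (sym (^-* x q (q ℕ.^ i))) (tr-^q i x) ⟩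
      x ^ (q ℕ.^ suc i) + tr (suc i) x               ∎

    -- Raising to the power q advances each conjugate. Adding x and comparing the two ways of
    -- reading a trace with one more term shows that the last conjugate has become x again.
    tr-subfield : ∀ x → tr (suc n) x ^ q ≈ tr (suc n) x
    tr-subfield x = +-cancelʳ x _ _ (begin
      tr (suc n) x ^ q + x                 ≈⟨ tr-^q (suc n) x ⟩
      x ^ (q ℕ.^ suc n) + tr (suc n) x     ≈⟨ +-congʳ x^≈x ⟩
      x + tr (suc n) x                     ≈⟨ +-comm _ _ ⟩
      tr (suc n) x + x                     ∎)
      where
      x^≈x : x ^ (q ℕ.^ suc n) ≈ x
      x^≈x with x ≟ 0#
      ... | yes x≈0 = trans (^-cong (q ℕ.^ suc n) x≈0) (trans (0^ (q ℕ.^ suc n) (subst (0 ℕ.<_) size ℕ.z<s)) (sym x≈0))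
      ... | no  x≉0 = trans (reflexive (cong (x ^_) (≡.sym size))) (trans (*-congˡ (lagrange x≉0)) (*-identityʳ x))

    q^>0 : ∀ i → 0 ℕ.< q ℕ.^ i
    q^>0 i = ℕ.m^n>0 q i

    tr-poly : ∀ i → Poly 0# (q ℕ.^ i) (tr i)
    tr-poly zero    = Poly-suc {l = 0#} (const (λ _ → refl))
    tr-poly (suc i) = Poly-raise (q ℕ.^ suc i) (subst (q ℕ.^ i ℕ.<_) (ℕ.*-comm (q ℕ.^ i) q) (ℕ.m<m*n (q ℕ.^ i) q {{ℕ.>-nonZero (q^>0 i)}} (ℕ.s<s 0<J))) (Poly-+ (Poly-^ (q ℕ.^ i)) (tr-poly i))

    tr-minus-poly : ∀ γ → Poly 1# Y (λ x → tr (suc n) x - γ)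
    tr-minus-poly γ = Poly-cong (trans (+-identityʳ _) (+-identityʳ 1#)) (λ _ → refl)
      (Poly-+ (Poly-+ (Poly-^ Y) (tr-poly n)) (Poly-raise Y (q^>0 n) (const {f = λ _ → - γ} λ _ → refl)))

    t : ℕ → Carrier
    t a = tr (suc n) (g ^ a)

    -- Lists the nonzero elements of the small field starting from γ 0 = β, as g^Q generates its
    -- multiplicative group.
    γ : ℕ → Carrier
    γ j = β * g ^ (j ℕ.* Q)

    t-period : ∀ a → t (N ℕ.+ a) ≈ t a
    t-period a = tr-cong (suc n) (g^-period a)

    gQ-subfield : ∀ j → (g ^ (j ℕ.* Q)) ^ q ≈ g ^ (j ℕ.* Q)
    gQ-subfield j = trans (*-congˡ (begin
      (g ^ (j ℕ.* Q)) ^ J        ≈⟨ ^-*′ g (j ℕ.* Q) J ⟨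
      g ^ (j ℕ.* Q ℕ.* J)        ≡⟨ cong (g ^_) (≡.trans (ℕ.*-assoc j Q J) (cong (j ℕ.*_) QJ≡N)) ⟩
      g ^ (j ℕ.* N)              ≈⟨ ^-multiple g^N j ⟩
      1#                         ∎)) (*-identityʳ _)

    t-scale : ∀ j a → t (j ℕ.* Q ℕ.+ a) ≈ g ^ (j ℕ.* Q) * t a
    t-scale j a = trans (tr-cong (suc n) (^-+ g (j ℕ.* Q) a)) (tr-scale (gQ-subfield j) (suc n) (g ^ a))

    0<Q : 0 ℕ.< Q
    0<Q = ℕ.n≢0⇒n>0 λ { ≡.refl → ℕ.<-irrefl QJ≡N 0<N }

    subfield-log : ∀ {y} → ¬ y ≈ 0# → y ^ q ≈ y → Σ ℕ λ j → j ℕ.< J × y ≈ g ^ (j ℕ.* Q)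
    subfield-log {y} y≉0 e with a , a<N , g^a≈y ← log y≉0
      with ℕ.divides j ≡.refl ← ℕ.*-cancelʳ-∣ {Q} {a} J {{ℕ.>-nonZero 0<J}} (subst (ℕ._∣ a ℕ.* J) (≡.sym QJ≡N) (g^-∣ (a ℕ.* J)
        (trans (^-*′ g a J) (trans (^-cong J g^a≈y) (cancelˡ y≉0 (trans e (sym (*-identityʳ y))))))))
      = j , ℕ.*-cancelˡ-< Q j J (subst (ℕ._< Q ℕ.* J) (ℕ.*-comm j Q) (subst (j ℕ.* Q ℕ.<_) (≡.sym QJ≡N) a<N)) , sym g^a≈y

    γ-onto : ∀ {x} → ¬ x ≈ 0# → x ^ q ≈ x → Σ ℕ λ j → j ℕ.< J × x ≈ γ j
    γ-onto {x} x≉0 x∈ = let j , j<J , e = subfield-log y≉0 y∈ in j , j<J , trans (sym βy≈x) (*-congˡ e)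
      where
      b = proj₁ (inverse β β≉0)
      βb≈1 = proj₂ (inverse β β≉0)
      y = b * x
      βy≈x : β * y ≈ x
      βy≈x = trans (sym (*-assoc β b x)) (trans (*-congʳ βb≈1) (*-identityˡ x))
      y≉0 : ¬ y ≈ 0#
      y≉0 y≈0 = x≉0 (trans (sym βy≈x) (trans (*-congˡ y≈0) (zeroʳ β)))
      y∈ : y ^ q ≈ y
      y∈ = cancelˡ β≉0 (begin
        β * y ^ q        ≈⟨ *-congʳ β∈ ⟨
        β ^ q * y ^ q    ≈⟨ *-^ β y q ⟨
        (β * y) ^ q      ≈⟨ ^-cong q βy≈x ⟩
        x ^ q            ≈⟨ x∈ ⟩
        x                ≈⟨ βy≈x ⟨
        β * y            ∎)

    γ-injective : ∀ {i j} → i ℕ.< J → j ℕ.< J → γ i ≈ γ j → i ≡ j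
    γ-injective {i} {j} i<J j<J e = ℕ.*-cancelʳ-≡ i j Q (g^-injective (bound i<J) (bound j<J) (cancelˡ β≉0 e))
      where
      instance _ = ℕ.>-nonZero 0<Q
      bound : ∀ {i} → i ℕ.< J → i ℕ.* Q ℕ.< N
      bound {i} i<J = subst (i ℕ.* Q ℕ.<_) (≡.trans (ℕ.*-comm J Q) QJ≡N) (ℕ.*-monoˡ-< Q i<J)

    γ≉0 : ∀ j → ¬ γ j ≈ 0#
    γ≉0 j = *-≉0 β≉0 (^-≉0 g≉0 (j ℕ.* Q))

    open import Data.Integer using (ℤ; 0ℤ; 1ℤ) renaming (_+_ to _⊹_; _*_ to _·_; _-_ to _∸ℤ_)

    z : ℕ → ℤ
    z a = 𝟙 (t a ≟ 0#)

    w : ℕ → ℕ → ℤ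
    w j a = 𝟙 (t a ≟ γ j)

    Θ : ℕ → ℕ → ℤ
    Θ a b = 𝟙 (t a ≟ t b)

    𝟙≟-cong : ∀ {x x′ y y′} → x ≈ x′ → y ≈ y′ → 𝟙 (x ≟ y) ≡ 𝟙 (x′ ≟ y′)
    𝟙≟-cong {x} {x′} {y} {y′} e e′ = 𝟙-cong (x ≟ y) (x′ ≟ y′) (λ h → trans (sym e) (trans h e′)) (λ h → trans e (trans h (sym e′)))

    -- A trace value lies in the subfield, hence is 0 or exactly one of the γ j.
    classify : ∀ a (h : ℕ → ℤ) h₀ → (t a ≈ 0# × z a · h₀ ⊹ ∑ J (λ j → w j a · h j) ≡ h₀)
                                 ⊎ (Σ ℕ λ j → t a ≈ γ j × z a · h₀ ⊹ ∑ J (λ j → w j a · h j) ≡ h j)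
    classify a h h₀ = cases (t a ≟ 0#)
      where
      S : ℤ
      S = z a · h₀ ⊹ ∑ J (λ j → w j a · h j)
      cases : Dec (t a ≈ 0#) → (t a ≈ 0# × S ≡ h₀) ⊎ (Σ ℕ λ j → t a ≈ γ j × S ≡ h j)
      cases (yes e) = inj₁ (e , ≡.trans (cong₂ _⊹_ (≡.trans (cong (_· h₀) (𝟙-yes (t a ≟ 0#) e)) (ℤ.*-identityˡ h₀))
            (≡.trans (∑-cong J λ j → cong (_· h j) (𝟙-no (t a ≟ γ j) λ e′ → γ≉0 j (trans (sym e′) e))) (∑-zero J))) (ℤ.+-identityʳ h₀))
      cases (no ne) = let j , j<J , e = γ-onto ne (tr-subfield (g ^ a)) in
        inj₂ (j , e , ≡.trans (cong₂ _⊹_ (cong (_· h₀) (𝟙-no (t a ≟ 0#) ne))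
            (∑-single J j j<J (λ i → w i a · h i) λ i i<J i≢j → cong (_· h i) (𝟙-no (t a ≟ γ i) λ e′ → i≢j (γ-injective i<J j<J (trans (sym e′) e)))))
              (≡.trans (ℤ.+-identityˡ (w j a · h j)) (≡.trans (cong (_· h j) (𝟙-yes (t a ≟ γ j) e)) (ℤ.*-identityˡ (h j)))))

    Θ-split : ∀ a b → Θ a b ≡ z a · z b ⊹ ∑ J (λ j → w j a · w j b)
    Θ-split a b = cases (classify a (λ j → w j b) (z b))
      where
      cases : _ → Θ a b ≡ z a · z b ⊹ ∑ J (λ j → w j a · w j b)
      cases (inj₁ (e , eq))     = ≡.trans (𝟙-cong (t a ≟ t b) (t b ≟ 0#) (λ h → trans (sym h) e) (λ h → trans e (sym h))) (≡.sym eq)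
      cases (inj₂ (j , e , eq)) = ≡.trans (𝟙-cong (t a ≟ t b) (t b ≟ γ j) (λ h → trans (sym h) e) (λ h → trans e (sym h))) (≡.sym eq)

    total : ∀ a → z a ⊹ ∑ J (λ j → w j a) ≡ 1ℤ
    total a = ≡.trans (cong₂ _⊹_ (≡.sym (ℤ.*-identityʳ (z a))) (∑-cong J λ j → ≡.sym (ℤ.*-identityʳ (w j a)))) (value (classify a (λ _ → 1ℤ) 1ℤ))
      where
      value : _ → z a · 1ℤ ⊹ ∑ J (λ j → w j a · 1ℤ) ≡ 1ℤ
      value (inj₁ (_ , eq))     = eq
      value (inj₂ (_ , _ , eq)) = eq

    0<Y : 0 ℕ.< Y
    0<Y = q^>0 n

    count-≤ : ∀ x → ∑ N (λ a → 𝟙 (t a ≟ x)) ℤ.≤ ℤ.+ Y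
    count-≤ x = subst (ℤ._≤ ℤ.+ Y) (powersWhere-length (λ a → t a ≟ x) N)
      (ℤ.+≤+ (roots-≤-degree (tr-minus-poly x) _ (powersWhere-distinct _ N ℕ.≤-refl) (powersWhere-All _ N λ a _ e → x≈y⇒x-y≈0 e)))

    tr-0 : ∀ i → tr i 0# ≈ 0#
    tr-0 zero    = refl
    tr-0 (suc i) = trans (+-cong (0^ (q ℕ.^ i) (q^>0 i)) (tr-0 i)) (+-identityˡ 0#)

    -- One better than `count-≤`, as 0 is a root that is no power of `g`.
    count-0-≤ : 1ℤ ⊹ ∑ N z ℤ.≤ ℤ.+ Y
    count-0-≤ = subst (λ x → 1ℤ ⊹ x ℤ.≤ ℤ.+ Y) (powersWhere-length (λ a → t a ≟ 0#) N)
      (ℤ.+≤+ (roots-≤-degree (tr-minus-poly 0#) (0# ∷ _) (powersWhere-All _ N (λ a _ _ e → ^-≉0 g≉0 a (sym e)) ∷ powersWhere-distinct _ N ℕ.≤-refl)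
        (x≈y⇒x-y≈0 (tr-0 (suc n)) ∷ powersWhere-All _ N λ a _ e → x≈y⇒x-y≈0 e)))

    pred-Y : ℤ.+ ℕ.pred Y ≡ ℤ.+ Y ∸ℤ 1ℤ
    pred-Y with Y | 0<Y
    ... | suc y | _ = ≡.refl

    N-value : ℤ.+ N ≡ (ℤ.+ Y ⊹ ℤ.+ J · ℤ.+ Y) ∸ℤ 1ℤ
    N-value = ≡.trans (lemma (ℤ.+ N)) (cong (_∸ℤ 1ℤ) (≡.trans (≡.sym (ℤ.pos-+ 1 N)) (≡.trans (cong ℤ.+_ size)
      (≡.trans (ℤ.pos-+ Y (J ℕ.* Y)) (cong (ℤ.+ Y ⊹_) (ℤ.pos-* J Y))))))
      where
      lemma : ∀ x → x ≡ (1ℤ ⊹ x) ∸ℤ 1ℤ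
      lemma = solve-∀

    -- The degree bounds, Y - 1 for trace 0 and Y for each of the J other values, add up to exactly
    -- N; so each of them is attained.
    z-count : ∑ N z ≡ ℤ.+ ℕ.pred Y
    z-count = ≡.trans (ℤ.≤-antisym upper lower) (≡.sym pred-Y)
      where
      shift : ∀ x y → 1ℤ ⊹ x ℤ.≤ y → x ℤ.≤ y ∸ℤ 1ℤ
      shift x y le = subst (ℤ._≤ y ∸ℤ 1ℤ) (lemma x) (ℤ.+-monoˡ-≤ (ℤ.- 1ℤ) le)
        where
        lemma : ∀ x → (1ℤ ⊹ x) ∸ℤ 1ℤ ≡ x
        lemma = solve-∀
      upper : ∑ N z ℤ.≤ ℤ.+ Y ∸ℤ 1ℤ
      upper = shift (∑ N z) (ℤ.+ Y) count-0-≤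
      rest : ∑ J (λ j → ∑ N (w j)) ℤ.≤ ℤ.+ J · ℤ.+ Y
      rest = subst (∑ J (λ j → ∑ N (w j)) ℤ.≤_) (∑-const J (ℤ.+ Y)) (∑-mono J λ j _ → count-≤ (γ j))
      everything : ∑ N z ⊹ ∑ J (λ j → ∑ N (w j)) ≡ ℤ.+ N
      everything = ≡.trans (cong (∑ N z ⊹_) (∑-swap J N _)) (≡.trans (≡.sym (∑-+ N _ _)) (≡.trans (∑-cong N total) (≡.trans (∑-const N 1ℤ) (ℤ.*-identityʳ (ℤ.+ N)))))
      lower : ℤ.+ Y ∸ℤ 1ℤ ℤ.≤ ∑ N z
      lower = ℤ.≤-trans (ℤ.≤-reflexive (≡.trans (lemma (ℤ.+ Y) (ℤ.+ J · ℤ.+ Y)) (cong (_∸ℤ (ℤ.+ J · ℤ.+ Y)) (≡.trans (≡.sym N-value) (≡.sym everything)))))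
        (ℤ.≤-trans (ℤ.+-monoʳ-≤ (∑ N z ⊹ ∑ J (λ j → ∑ N (w j))) (ℤ.neg-mono-≤ rest)) (ℤ.≤-reflexive (lemma′ (∑ N z) (∑ J (λ j → ∑ N (w j))))))
        where
        lemma : ∀ y x → y ∸ℤ 1ℤ ≡ ((y ⊹ x) ∸ℤ 1ℤ) ∸ℤ x
        lemma = solve-∀
        lemma′ : ∀ x y → (x ⊹ y) ∸ℤ y ≡ x
        lemma′ = solve-∀

    -- The traces of g^(s+a) and g^a agree when (g^s - 1) g^a has trace 0. The factor g^s - 1 is
    -- nonzero, hence some g^r, and a shift by r reduces the count to `z-count`.
    Θ-off : ∀ s → 0 ℕ.< s → s ℕ.< N → ∑ N (λ a → Θ (s ℕ.+ a) a) ≡ ℤ.+ ℕ.pred Y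
    Θ-off s 0<s s<N = ≡.trans (∑-cong N step) (≡.trans (∑-shift N r z λ a → 𝟙≟-cong (t-period a) refl) z-count)
      where
      ne : ¬ g ^ s - 1# ≈ 0#
      ne e = ℕ.>⇒∤ {{ℕ.>-nonZero 0<s}} s<N (g^-∣ s (x-y≈0⇒x≈y (g ^ s) 1# e))
      r = proj₁ (log ne)
      g^r≈ = proj₂ (proj₂ (log ne))
      minus : ∀ a → t (r ℕ.+ a) + t a ≈ t (s ℕ.+ a)
      minus a = trans (sym (tr-+ (suc n) (g ^ (r ℕ.+ a)) (g ^ a))) (tr-cong (suc n) (begin
        g ^ (r ℕ.+ a) + g ^ a                    ≈⟨ +-congʳ (trans (^-+ g r a) (*-congʳ g^r≈)) ⟩
        (g ^ s - 1#) * g ^ a + g ^ a             ≈⟨ +-congˡ (*-identityˡ (g ^ a)) ⟨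
        (g ^ s - 1#) * g ^ a + 1# * g ^ a        ≈⟨ distribʳ (g ^ a) (g ^ s - 1#) 1# ⟨
        ((g ^ s - 1#) + 1#) * g ^ a              ≈⟨ *-congʳ (trans (+-assoc _ _ _) (trans (+-congˡ (-‿inverseˡ 1#)) (+-identityʳ _))) ⟩
        g ^ s * g ^ a                            ≈⟨ ^-+ g s a ⟨
        g ^ (s ℕ.+ a)                            ∎))
      step : ∀ a → Θ (s ℕ.+ a) a ≡ z (r ℕ.+ a)
      step a = 𝟙-cong (t (s ℕ.+ a) ≟ t a) (t (r ℕ.+ a) ≟ 0#)
        (λ h → +-cancelʳ (t a) _ _ (trans (minus a) (trans h (sym (+-identityˡ (t a))))))
        (λ h → trans (sym (minus a)) (trans (+-congʳ h) (+-identityˡ (t a))))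

    traceData : TraceData N J Q (ℕ.pred Y) Y
    traceData = record
      { z = z ; w = w ; Θ = Θ ; N>0 = 0<N ; J>0 = 0<J
      ; Θ-split = Θ-split
      ; Θ-diag = λ a → 𝟙-yes (t a ≟ t a) refl
      ; Θ-off = Θ-off
      ; z-per = λ a → 𝟙≟-cong (t-period a) refl
      ; w-per = λ j a → 𝟙≟-cong (t-period a) refl
      ; w-scale = λ j a → 𝟙-cong (t (j ℕ.* Q ℕ.+ a) ≟ γ j) (t a ≟ γ 0)
          (λ h → trans (cancelˡ (^-≉0 g≉0 (j ℕ.* Q)) (trans (sym (t-scale j a)) (trans h (*-comm β _)))) (sym (*-identityʳ β)))
          (λ h → trans (t-scale j a) (trans (*-congˡ (trans h (*-identityʳ β))) (*-comm _ β)))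
      ; z-count = z-count
      ; total = total
      ; sizes = ≡.trans (cong₂ _∸ℤ_ N-value pred-Y) (lemma (ℤ.+ Y) (ℤ.+ J · ℤ.+ Y))
      }
      where
      lemma : ∀ y x → ((y ⊹ x) ∸ℤ 1ℤ) ∸ℤ (y ∸ℤ 1ℤ) ≡ x
      lemma = solve-∀

    w01 : ∀ b → w 0 b ≡ 0ℤ ⊎ w 0 b ≡ 1ℤ
    w01 b = 𝟙-01 (t b ≟ γ 0)
      where
      𝟙-01 : ∀ {p} {P : Set p} (d : Dec P) → 𝟙 d ≡ 0ℤ ⊎ 𝟙 d ≡ 1ℤ
      𝟙-01 (yes _) = inj₂ ≡.refl
      𝟙-01 (no _)  = inj₁ ≡.refl

    w≡1⇒ : ∀ j b → w j b ≡ 1ℤ → t b ≈ γ j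
    w≡1⇒ j b = holds (t b ≟ γ j)
      where
      holds : ∀ {p} {P : Set p} (d : Dec P) → 𝟙 d ≡ 1ℤ → P
      holds (yes p) _ = p

-- Rational arithmetic and sums of reciprocals of primes.

module Rationals where
  open import Defs using (recip; sumRecip)
  open PositiveKernels using (∑L)
  open import Data.Nat as ℕ using (ℕ; zero; suc; NonZero)
  import Data.Nat.Properties as ℕ
  open import Data.Nat.Primality using (Prime; prime⇒nonZero)
  open import Data.Integer as ℤ using (ℤ; +_)
  import Data.Integer.Properties as ℤ
  open import Data.Rational using (ℚ; 0ℚ; 1ℚ; _+_; _*_; _-_; -_; _≤_; _<_; _/_; toℚᵘ; positive; nonNegative)
  open import Data.Rational.Properties as ℚ using (≤-trans; ≤-refl; ≤-reflexive; <⇒≤; <-≤-trans)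
  import Data.Rational.Unnormalised as ℚᵘ
  import Data.Rational.Unnormalised.Properties as ℚᵘ
  open import Data.List using (List; []; _∷_; _++_; length)
  open import Data.List.Relation.Unary.All as All using (All; []; _∷_)
  open import Data.List.Relation.Unary.Any using (here; there)
  open import Data.List.Membership.Propositional using (_∈_)
  open import Relation.Nullary.Decidable using (dec⇒maybe)
  open import Relation.Binary.PropositionalEquality using (_≡_; refl; sym; trans; cong; cong₂; subst; subst₂; module ≡-Reasoning)
  import Tactic.RingSolver.Core.AlmostCommutativeRing as ACR
  open import Tactic.RingSolver using (solve-∀)
  open import Level using (0ℓ)

  ℚ-ring : ACR.AlmostCommutativeRing 0ℓ 0ℓ
  ℚ-ring = ACR.fromCommutativeRing ℚ.+-*-commutativeRing (λ x → dec⇒maybe (0ℚ ℚ.≟ x))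

  abstract
    ι : ℤ → ℚ
    ι i = i / 1

    /1≡ι : ∀ i → i / 1 ≡ ι i
    /1≡ι i = refl

    ι-0 : ι (+ 0) ≡ 0ℚ
    ι-0 = refl

    ι-1 : ι (+ 1) ≡ 1ℚ
    ι-1 = refl

    toℚᵘ-ι : ∀ i → toℚᵘ (ι i) ℚᵘ.≃ ℚᵘ.mkℚᵘ i 0
    toℚᵘ-ι i = ℚ.toℚᵘ-fromℚᵘ (ℚᵘ.mkℚᵘ i 0)

  ι-+ : ∀ i j → ι (i ℤ.+ j) ≡ ι i + ι j
  ι-+ i j = ℚ.toℚᵘ-injective (ℚᵘ.≃-trans (toℚᵘ-ι (i ℤ.+ j)) (ℚᵘ.≃-trans (ℚᵘ.*≡* (cong (ℤ._* + 1) (sym (cong₂ ℤ._+_ (ℤ.*-identityʳ i) (ℤ.*-identityʳ j)))))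
    (ℚᵘ.≃-sym (ℚᵘ.≃-trans (ℚ.toℚᵘ-homo-+ (ι i) (ι j)) (ℚᵘ.+-cong (toℚᵘ-ι i) (toℚᵘ-ι j))))))

  ι-* : ∀ i j → ι (i ℤ.* j) ≡ ι i * ι j
  ι-* i j = ℚ.toℚᵘ-injective (ℚᵘ.≃-trans (toℚᵘ-ι (i ℤ.* j))
    (ℚᵘ.≃-sym (ℚᵘ.≃-trans (ℚ.toℚᵘ-homo-* (ι i) (ι j)) (ℚᵘ.*-cong (toℚᵘ-ι i) (toℚᵘ-ι j)))))

  ι-mono : ∀ {i j} → i ℤ.≤ j → ι i ≤ ι j
  ι-mono {i} {j} le = ℚ.toℚᵘ-cancel-≤ (ℚᵘ.≤-trans (ℚᵘ.≤-reflexive (toℚᵘ-ι i))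
    (ℚᵘ.≤-trans (ℚᵘ.*≤* (subst₂ ℤ._≤_ (sym (ℤ.*-identityʳ i)) (sym (ℤ.*-identityʳ j)) le)) (ℚᵘ.≤-reflexive (ℚᵘ.≃-sym (toℚᵘ-ι j)))))

  ι-cancel : ∀ {i j} → ι i ≤ ι j → i ℤ.≤ j
  ι-cancel {i} {j} le with ℚᵘ.*≤* e ← ℚᵘ.≤-trans (ℚᵘ.≤-reflexive (ℚᵘ.≃-sym (toℚᵘ-ι i))) (ℚᵘ.≤-trans (ℚ.toℚᵘ-mono-≤ le) (ℚᵘ.≤-reflexive (toℚᵘ-ι j)))
    = subst₂ ℤ._≤_ (ℤ.*-identityʳ i) (ℤ.*-identityʳ j) e

  nat : ℕ → ℚ
  nat n = ι (+ n)

  nat-nonNeg : ∀ n → 0ℚ ≤ nat n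
  nat-nonNeg n = subst (_≤ nat n) ι-0 (ι-mono (ℤ.+≤+ ℕ.z≤n))

  nat-* : ∀ m n → nat (m ℕ.* n) ≡ nat m * nat n
  nat-* m n = trans (cong ι (ℤ.pos-* m n)) (ι-* (+ m) (+ n))

  nat-+ : ∀ m n → nat (m ℕ.+ n) ≡ nat m + nat n
  nat-+ m n = trans (cong ι (ℤ.pos-+ m n)) (ι-+ (+ m) (+ n))

  nat-mono : ∀ {m n} → m ℕ.≤ n → nat m ≤ nat n
  nat-mono le = ι-mono (ℤ.+≤+ le)

  nat-cancel : ∀ {m n} → nat m ≤ nat n → m ℕ.≤ n
  nat-cancel le = ℤ.drop‿+≤+ (ι-cancel le)

  nat-pos : ∀ {n} → 0 ℕ.< n → 0ℚ < nat n
  nat-pos {n} 0<n = <-≤-trans (ℚ.positive⁻¹ 1ℚ) (subst (_≤ nat n) ι-1 (nat-mono 0<n))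

  0≤-diff : ∀ {x y} → x ≤ y → 0ℚ ≤ y - x
  0≤-diff {x} {y} le = subst (_≤ y - x) (ℚ.+-inverseʳ x) (ℚ.+-monoˡ-≤ (- x) le)

  ≤-by : ∀ {x y} d → 0ℚ ≤ d → y ≡ x + d → x ≤ y
  ≤-by {x} {y} d 0≤d eq = subst₂ _≤_ (ℚ.+-identityʳ x) (sym eq) (ℚ.+-monoʳ-≤ x 0≤d)

  0≤-+ : ∀ {x y} → 0ℚ ≤ x → 0ℚ ≤ y → 0ℚ ≤ x + y
  0≤-+ = ℚ.+-mono-≤

  0≤-* : ∀ {x y} → 0ℚ ≤ x → 0ℚ ≤ y → 0ℚ ≤ x * y
  0≤-* {x} {y} 0≤x 0≤y = subst (_≤ x * y) (ℚ.*-zeroʳ x) (ℚ.*-monoˡ-≤-nonNeg x {{nonNegative 0≤x}} 0≤y)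

  0<-* : ∀ {x y} → 0ℚ < x → 0ℚ < y → 0ℚ < x * y
  0<-* {x} {y} 0<x 0<y = subst (_< x * y) (ℚ.*-zeroʳ x) (ℚ.*-monoʳ-<-pos x {{positive 0<x}} 0<y)

  recip-* : ∀ p .{{_ : NonZero p}} → recip p * nat p ≡ 1ℚ
  recip-* (suc p) = ℚ.toℚᵘ-injective (ℚᵘ.≃-trans (ℚ.toℚᵘ-homo-* (recip (suc p)) (nat (suc p)))
    (ℚᵘ.≃-trans (ℚᵘ.*-cong (ℚ.toℚᵘ-fromℚᵘ (ℚᵘ.mkℚᵘ (+ 1) p)) (toℚᵘ-ι (+ suc p))) (ℚᵘ.*≡* eq)))
    where
    eq : (+ 1 ℤ.* + suc p) ℤ.* + 1 ≡ + 1 ℤ.* + (suc p ℕ.* 1)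
    eq = cong +_ (trans (ℕ.*-identityʳ _) (trans (ℕ.*-identityˡ (suc p)) (sym (trans (ℕ.*-identityˡ _) (ℕ.*-identityʳ (suc p))))))

  recip-nonNeg : ∀ p → 0ℚ ≤ recip p
  recip-nonNeg zero    = ≤-refl
  recip-nonNeg (suc p) = ℚ.*-cancelʳ-≤-pos (nat (suc p)) {{positive (nat-pos {suc p} ℕ.z<s)}}
    (subst₂ _≤_ (sym (ℚ.*-zeroˡ (nat (suc p)))) (sym (recip-* (suc p))) (<⇒≤ (ℚ.positive⁻¹ 1ℚ)))

  recip≤1 : ∀ p .{{_ : NonZero p}} → recip p ≤ 1ℚ
  recip≤1 p = subst₂ _≤_ (trans (cong (recip p *_) ι-1) (ℚ.*-identityʳ (recip p))) (recip-* p) (ℚ.*-monoˡ-≤-nonNeg (recip p) {{nonNegative (recip-nonNeg p)}} (nat-mono (ℕ.>-nonZero⁻¹ p)))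

  ∑ℚ : List ℕ → (ℕ → ℚ) → ℚ
  ∑ℚ []       f = 0ℚ
  ∑ℚ (p ∷ ps) f = f p + ∑ℚ ps f

  ∑ℚ-++ : ∀ ps qs f → ∑ℚ (ps ++ qs) f ≡ ∑ℚ ps f + ∑ℚ qs f
  ∑ℚ-++ []       qs f = sym (ℚ.+-identityˡ _)
  ∑ℚ-++ (p ∷ ps) qs f = trans (cong (_+_ (f p)) (∑ℚ-++ ps qs f)) (sym (ℚ.+-assoc (f p) _ _))

  ι-∑L : ∀ ps f → ι (∑L ps f) ≡ ∑ℚ ps (λ p → ι (f p))
  ι-∑L []       f = ι-0
  ι-∑L (p ∷ ps) f = trans (ι-+ (f p) _) (cong (_+_ (ι (f p))) (ι-∑L ps f))

  sumRecip-++ : ∀ ps qs → sumRecip (ps ++ qs) ≡ sumRecip ps + sumRecip qs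
  sumRecip-++ []       qs = sym (ℚ.+-identityˡ _)
  sumRecip-++ (p ∷ ps) qs = trans (cong (_+_ (recip p)) (sumRecip-++ ps qs)) (sym (ℚ.+-assoc (recip p) _ _))

  -- The sum of 1 - 1/p over the list, in the form in which it appears in the hypothesis.
  E : List ℕ → ℚ
  E ps = nat (length ps) - sumRecip ps

  E-[] : E [] ≡ 0ℚ
  E-[] = cong (_- 0ℚ) ι-0

  E-∷ : ∀ p ps → E (p ∷ ps) ≡ (1ℚ - recip p) + E ps
  E-∷ p ps = trans (cong (_- (recip p + sumRecip ps)) (trans (nat-+ 1 (length ps)) (cong (_+ nat (length ps)) ι-1))) (lemma (nat (length ps)) (recip p) (sumRecip ps))
    where
    lemma : ∀ n r s → (1ℚ + n) - (r + s) ≡ (1ℚ - r) + (n - s)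
    lemma = solve-∀ ℚ-ring

  E-nonNeg : ∀ {ps} → All Prime ps → 0ℚ ≤ E ps
  E-nonNeg []                 = ≤-reflexive (sym E-[])
  E-nonNeg {p ∷ ps} (pp ∷ pps) = subst (0ℚ ≤_) (sym (E-∷ p ps)) (0≤-+ (0≤-diff (recip≤1 p {{prime⇒nonZero pp}})) (E-nonNeg pps))

  sumRecip-nonNeg : ∀ ps → 0ℚ ≤ sumRecip ps
  sumRecip-nonNeg []       = ≤-refl
  sumRecip-nonNeg (p ∷ ps) = 0≤-+ (recip-nonNeg p) (sumRecip-nonNeg ps)

  E-++ : ∀ ps qs → E (ps ++ qs) ≡ E ps + E qs
  E-++ []       qs = sym (trans (cong (_+ E qs) E-[]) (ℚ.+-identityˡ (E qs)))
  E-++ (p ∷ ps) qs = trans (E-∷ p (ps ++ qs)) (trans (cong (_+_ (1ℚ - recip p)) (E-++ ps qs)) (trans (sym (ℚ.+-assoc (1ℚ - recip p) (E ps) (E qs))) (cong (_+ E qs) (sym (E-∷ p ps)))))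

  weighted-const : ∀ ps (b : ℕ → ℚ) {c} → All (λ p → b p ≡ c) ps → ∑ℚ ps (λ p → (1ℚ - recip p) * b p) ≡ E ps * c
  weighted-const []       b {c} []       = sym (trans (cong (_* c) E-[]) (ℚ.*-zeroˡ c))
  weighted-const (p ∷ ps) b {c} (e ∷ es) = trans (cong₂ (λ x y → (1ℚ - recip p) * x + y) e (weighted-const ps b es))
    (trans (sym (ℚ.*-distribʳ-+ c (1ℚ - recip p) (E ps))) (cong (_* c) (sym (E-∷ p ps))))

  recip-∈ : ∀ {p ps} → p ∈ ps → recip p ≤ sumRecip ps
  recip-∈ {p} {_ ∷ ps} (here refl) = ≤-by (sumRecip ps) (sumRecip-nonNeg ps) refl
  recip-∈ {p} {q ∷ ps} (there i)   = ≤-trans (recip-∈ i) (≤-by (recip q) (recip-nonNeg q) (ℚ.+-comm (recip q) (sumRecip ps)))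

  E-∈ : ∀ {p ps} → All Prime ps → p ∈ ps → 1ℚ - recip p ≤ E ps
  E-∈ {p} {_ ∷ ps} (_ ∷ pps) (here refl) = ≤-by (E ps) (E-nonNeg pps) (E-∷ p ps)
  E-∈ {p} {q ∷ ps} (pq ∷ pps) (there i)  = ≤-trans (E-∈ pps i)
    (≤-by (1ℚ - recip q) (0≤-diff (recip≤1 q {{prime⇒nonZero pq}})) (trans (E-∷ q ps) (ℚ.+-comm (1ℚ - recip q) (E ps))))

  E≤length : ∀ ps → E ps ≤ nat (length ps)
  E≤length ps = ≤-by (sumRecip ps) (sumRecip-nonNeg ps) (lemma (nat (length ps)) (sumRecip ps))
    where
    lemma : ∀ n s → n ≡ (n - s) + s
    lemma = solve-∀ ℚ-ring

  sumRecip-bound : ∀ {M ps} → All Prime ps → All (M ℕ.≤_) ps → nat M * sumRecip ps ≤ nat (length ps)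
  sumRecip-bound {M} [] [] = ≤-reflexive (trans (ℚ.*-zeroʳ (nat M)) (sym ι-0))
  sumRecip-bound {M} {p ∷ ps} (pp ∷ pps) (M≤p ∷ ms) = subst₂ _≤_ (sym (ℚ.*-distribˡ-+ (nat M) (recip p) (sumRecip ps)))
    (sym (trans (nat-+ 1 (length ps)) (cong (_+ nat (length ps)) ι-1))) (ℚ.+-mono-≤ first (sumRecip-bound pps ms))
    where
    first : nat M * recip p ≤ 1ℚ
    first = subst (nat M * recip p ≤_) (trans (ℚ.*-comm (nat p) (recip p)) (recip-* p {{prime⇒nonZero pp}}))
      (ℚ.*-monoʳ-≤-nonNeg (recip p) {{nonNegative (recip-nonNeg p)}} (nat-mono M≤p))

-- The sieve inequality over ℚ and its conflict with the hypothesis.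

module RationalSieve where
  open import Defs using (recip; sumRecip; GtSqrt2Times)
  open PositiveKernels using (∑L; ∑L-*ˡ)
  open Rationals
  open import Data.Nat as ℕ using (ℕ; suc; pred; NonZero)
  open import Data.Nat.Primality using (Prime; prime⇒nonZero)
  open import Data.Integer as ℤ using (ℤ; +_)
  import Data.Integer.Properties as ℤ
  open import Data.Rational using (ℚ; 0ℚ; 1ℚ; _+_; _*_; _-_; -_; _≤_; _<_; _/_; _÷_; 1/_; positive; nonNegative; NonNegative; >-nonZero)
  open import Data.Rational.Properties as ℚ using (≤-trans; ≤-reflexive; <⇒≤; <-≤-trans)
  open import Data.List using (List; []; _∷_; _++_)
  open import Data.List.Relation.Unary.All as All using (All; []; _∷_)
  open import Data.Sum using (inj₁; inj₂)
  open import Data.Empty using (⊥; ⊥-elim)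
  open import Relation.Binary.PropositionalEquality using (_≡_; refl; sym; trans; cong; cong₂; subst; subst₂; module ≡-Reasoning)
  open import Tactic.RingSolver using (solve-∀)

  ∑ℚ-bound : ∀ {ps x a} {j b : ℕ → ℚ} → All Prime ps → All (λ p → nat p * j p ≤ x + a * (nat (pred p) * b p)) ps →
    ∑ℚ ps j ≤ sumRecip ps * x + a * ∑ℚ ps (λ p → (1ℚ - recip p) * b p)
  ∑ℚ-bound {[]} {x} {a} [] [] = ≤-reflexive (sym (lemma x a))
    where
    lemma : ∀ x a → 0ℚ * x + a * 0ℚ ≡ 0ℚ
    lemma = solve-∀ ℚ-ring
  ∑ℚ-bound {p ∷ ps} {x} {a} {j} {b} (pp ∷ pps) (h ∷ hs) = ≤-trans (ℚ.+-mono-≤ first (∑ℚ-bound {a = a} {b = b} pps hs))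
    (≤-reflexive (collect (recip p) x a (b p) (sumRecip ps) (∑ℚ ps λ p → (1ℚ - recip p) * b p)))
    where
    instance _ = prime⇒nonZero pp
    collect : ∀ r x a b s w → (r * x + a * ((1ℚ - r) * b)) + (s * x + a * w) ≡ (r + s) * x + a * ((1ℚ - r) * b + w)
    collect = solve-∀ ℚ-ring
    expand : ∀ r x a m b → r * (x + a * (m * b)) ≡ r * x + a * ((r * (1ℚ + m) - r) * b)
    expand = solve-∀ ℚ-ring
    nat-pred : ∀ p .{{_ : NonZero p}} → 1ℚ + nat (pred p) ≡ nat p
    nat-pred (suc p) = sym (trans (nat-+ 1 p) (cong (_+ nat p) ι-1))
    first : j p ≤ recip p * x + a * ((1ℚ - recip p) * b p)
    first = subst₂ _≤_
      (trans (sym (ℚ.*-assoc (recip p) (nat p) (j p))) (trans (cong (_* j p) (recip-* p)) (ℚ.*-identityˡ (j p))))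
      (trans (expand (recip p) x a (nat (pred p)) (b p)) (cong (λ y → recip p * x + a * ((y - recip p) * b p)) (trans (cong (recip p *_) (nat-pred p)) (recip-* p))))
      (ℚ.*-monoˡ-≤-nonNeg (recip p) {{nonNegative (recip-nonNeg p)}} h)

  -- Let σ be the sum of the reciprocals, δ = 1 - σ, and w the weighted sum on the right. Dividing
  -- each bound by its prime and summing gives x ≤ σ x + a w, that is δ x ≤ a w. Insert this into δ
  -- a S ≤ δ x + δ a B and cancel `a`.
  sieve-inequality : ∀ {ps x a S B} {j b : ℕ → ℚ} → All Prime ps → All (λ p → nat p * j p ≤ x + a * (nat (pred p) * b p)) ps →
    x ≤ ∑ℚ ps j → a * S ≤ x + a * B → 0ℚ < a → 0ℚ < 1ℚ - sumRecip ps →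
    (1ℚ - sumRecip ps) * S ≤ (1ℚ - sumRecip ps) * B + ∑ℚ ps (λ p → (1ℚ - recip p) * b p)
  sieve-inequality {ps} {x} {a} {S} {B} {j} {b} pps hs x≤ aS≤ 0<a 0<δ = ℚ.*-cancelˡ-≤-pos a {{positive 0<a}}
    (≤-by _ (0≤-+ (0≤-* (<⇒≤ 0<δ) (0≤-diff aS≤)) (0≤-diff (≤-trans x≤ (∑ℚ-bound {a = a} {b = b} pps hs)))) (lemma a S B x (sumRecip ps) w))
    where
    w = ∑ℚ ps (λ p → (1ℚ - recip p) * b p)
    lemma : ∀ a S B x σ w → a * ((1ℚ - σ) * B + w) ≡ a * ((1ℚ - σ) * S) + ((1ℚ - σ) * (x + a * B - a * S) + (σ * x + a * w - x))
    lemma = solve-∀ ℚ-ring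

  module _ {δ P T₀ T₁ : ℚ} (0<δ : 0ℚ < δ) (0<T₁ : 0ℚ < T₁) (T₁≤ : T₁ ≤ δ * T₀) (0≤P : 0ℚ ≤ P) where
    0<T₀ : 0ℚ < T₀
    0<T₀ = ℚ.*-cancelˡ-<-nonNeg δ {{nonNegative (<⇒≤ 0<δ)}} (subst (_< δ * T₀) (sym (ℚ.*-zeroʳ δ)) (<-≤-trans 0<T₁ T₁≤))

    -- (141/100)² < 2
    >√2⇒>1·41 : GtSqrt2Times P T₀ → (+ 141 / 1) * T₁ < (+ 100 / 1) * (δ * P)
    >√2⇒>1·41 (inj₁ T₀≤0) = ⊥-elim (ℚ.<-irrefl refl (<-≤-trans 0<T₀ T₀≤0))
    >√2⇒>1·41 (inj₂ 2T₀²<P²) = ℚ.≰⇒> λ h → ℚ.<-irrefl refl (<-≤-trans 2T₀²<P² (P²≤2T₀² h))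
      where
      P≤ : (+ 100 / 1) * (δ * P) ≤ (+ 141 / 1) * T₁ → (+ 100 / 1) * P ≤ (+ 141 / 1) * T₀
      P≤ h = ℚ.*-cancelˡ-≤-pos δ {{positive 0<δ}} (≤-by _ (0≤-+ (0≤-diff h) (0≤-* (ℚ.nonNegative⁻¹ (+ 141 / 1)) (0≤-diff T₁≤))) (lemma δ P T₀ T₁))
        where
        lemma : ∀ δ P T₀ T₁ → δ * ((+ 141 / 1) * T₀) ≡ δ * ((+ 100 / 1) * P) + (((+ 141 / 1) * T₁ - (+ 100 / 1) * (δ * P)) + (+ 141 / 1) * (δ * T₀ - T₁))
        lemma = solve-∀ ℚ-ring
      P²≤2T₀² : (+ 100 / 1) * (δ * P) ≤ (+ 141 / 1) * T₁ → P * P ≤ (1ℚ + 1ℚ) * (T₀ * T₀)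
      -- 119 = 2 · 100² - 141².
      P²≤2T₀² h = ℚ.*-cancelˡ-≤-pos (+ 10000 / 1) (≤-by _
        (0≤-+ (0≤-* (0≤-diff (P≤ h)) (0≤-+ (0≤-* (ℚ.nonNegative⁻¹ (+ 100 / 1)) 0≤P) (0≤-* (ℚ.nonNegative⁻¹ (+ 141 / 1)) (<⇒≤ 0<T₀))))
              (0≤-* (ℚ.nonNegative⁻¹ (+ 119 / 1)) (0≤-* (<⇒≤ 0<T₀) (<⇒≤ 0<T₀)))) (lemma P T₀))
        where
        lemma : ∀ P T → (+ 10000 / 1) * ((1ℚ + 1ℚ) * (T * T)) ≡ (+ 10000 / 1) * (P * P) + (((+ 141 / 1) * T - (+ 100 / 1) * P) * ((+ 100 / 1) * P + (+ 141 / 1) * T) + (+ 119 / 1) * (T * T))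
        lemma = solve-∀ ℚ-ring

  module Contradiction
    {δ P W W′ E₁ E₂ T₀ u t : ℚ} (0<δ : 0ℚ < δ) (0≤P : 0ℚ ≤ P) (0<W′ : 0ℚ < W′) (W′≤W : W′ ≤ W) (0≤E₁ : 0ℚ ≤ E₁) (0≤E₂ : 0ℚ ≤ E₂) (0≤u : 0ℚ ≤ u) (0≤t : 0ℚ ≤ t)
    (T₁≤ : (1ℚ + 1ℚ) * W * (δ + E₁ + E₂) - W′ * (δ + E₁) ≤ δ * T₀)
    (hyp : GtSqrt2Times P T₀)
    (sieved : δ * ((u + t) * P + u) + t * W′ * (δ + E₁) ≤ (1ℚ + 1ℚ) * (u + t) * W * (δ + E₁ + E₂)) where

    T₁ Y : ℚ
    T₁ = (1ℚ + 1ℚ) * W * (δ + E₁ + E₂) - W′ * (δ + E₁)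
    Y = δ + E₁

    0<Y : 0ℚ < Y
    0<Y = <-≤-trans 0<δ (≤-by E₁ 0≤E₁ refl)

    T₁≥ : W′ * Y + (1ℚ + 1ℚ) * W′ * E₂ ≤ T₁
    T₁≥ = ≤-by _ (0≤-* (0≤-* (ℚ.nonNegative⁻¹ (1ℚ + 1ℚ)) (0≤-diff W′≤W)) (0≤-+ (<⇒≤ 0<Y) 0≤E₂)) (lemma δ W W′ E₁ E₂)
      where
      lemma : ∀ δ W V E₁ E₂ → (1ℚ + 1ℚ) * W * (δ + E₁ + E₂) - V * (δ + E₁) ≡ (V * (δ + E₁) + (1ℚ + 1ℚ) * V * E₂) + (1ℚ + 1ℚ) * (W - V) * ((δ + E₁) + E₂)
      lemma = solve-∀ ℚ-ring

    W′Y≤T₁ : W′ * Y ≤ T₁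
    W′Y≤T₁ = ≤-trans (≤-by _ (0≤-* (0≤-* (ℚ.nonNegative⁻¹ (1ℚ + 1ℚ)) (<⇒≤ 0<W′)) 0≤E₂) refl) T₁≥

    0<W′Y : 0ℚ < W′ * Y
    0<W′Y = 0<-* 0<W′ 0<Y

    0<T₁ : 0ℚ < T₁
    0<T₁ = <-≤-trans 0<W′Y W′Y≤T₁

    -- With v = u + t the sieve says v δ P ≤ v T₁ + u W′ Y - u δ, and the hypothesis says 141 T₁ <
    -- 100 δ P. Eliminating δ P leaves 41 v T₁ < 100 u W′ Y.
    key : 0ℚ < u + t → (+ 41 / 1) * ((u + t) * T₁) < (+ 100 / 1) * (u * (W′ * Y))
    key 0<v = subst₂ _<_ (lhs (u + t) T₁ δ P) (rhs (u + t) T₁ δ P (u * (W′ * Y)))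
      (<-≤-trans (ℚ.+-monoˡ-< ((+ 41 / 1) * ((u + t) * T₁) - (+ 141 / 1) * ((u + t) * T₁)) (ℚ.*-monoʳ-<-pos (u + t) {{positive 0<v}} (>√2⇒>1·41 0<δ 0<T₁ T₁≤ 0≤P hyp)))
        (≤-by _ (0≤-+ (0≤-* (ℚ.nonNegative⁻¹ (+ 100 / 1)) (0≤-diff sieved)) (0≤-* (ℚ.nonNegative⁻¹ (+ 100 / 1)) (0≤-* 0≤u (<⇒≤ 0<δ)))) (lemma δ P W W′ E₁ E₂ u t)))
      where
      lhs : ∀ v T δ P → v * ((+ 141 / 1) * T) + ((+ 41 / 1) * (v * T) - (+ 141 / 1) * (v * T)) ≡ (+ 41 / 1) * (v * T)
      lhs = solve-∀ ℚ-ring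
      rhs : ∀ v T δ P x → (v * ((+ 100 / 1) * (δ * P)) + ((+ 41 / 1) * (v * T) - (+ 141 / 1) * (v * T))) + ((+ 100 / 1) * (v * T - v * (δ * P)) + (+ 100 / 1) * x) ≡ (+ 100 / 1) * x
      rhs = solve-∀ ℚ-ring
      lemma : ∀ δ P W V E₁ E₂ u t →
        (((u + t) * ((+ 100 / 1) * (δ * P)) + ((+ 41 / 1) * ((u + t) * ((1ℚ + 1ℚ) * W * (δ + E₁ + E₂) - V * (δ + E₁))) - (+ 141 / 1) * ((u + t) * ((1ℚ + 1ℚ) * W * (δ + E₁ + E₂) - V * (δ + E₁)))))
          + ((+ 100 / 1) * ((u + t) * ((1ℚ + 1ℚ) * W * (δ + E₁ + E₂) - V * (δ + E₁)) - (u + t) * (δ * P)) + (+ 100 / 1) * (u * (V * (δ + E₁)))))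
        ≡ ((u + t) * ((+ 100 / 1) * (δ * P)) + ((+ 41 / 1) * ((u + t) * ((1ℚ + 1ℚ) * W * (δ + E₁ + E₂) - V * (δ + E₁))) - (+ 141 / 1) * ((u + t) * ((1ℚ + 1ℚ) * W * (δ + E₁ + E₂) - V * (δ + E₁)))))
          + ((+ 100 / 1) * ((1ℚ + 1ℚ) * (u + t) * W * (δ + E₁ + E₂) - (δ * ((u + t) * P + u) + t * V * (δ + E₁))) + (+ 100 / 1) * (u * δ))
      lemma = solve-∀ ℚ-ring

    refute : 0ℚ < u + t → (+ 100 / 1) * (u * (W′ * Y)) ≤ (+ 41 / 1) * ((u + t) * T₁) → ⊥
    refute 0<v le = ℚ.<-irrefl refl (<-≤-trans (key 0<v) le)

    -- For the case that 2 divides k: as 2 does not divide Q, it doubles `W` against `W′`.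
    T₁≥3 : (1ℚ + 1ℚ) * W′ ≤ W → (+ 3 / 1) * (W′ * Y) ≤ T₁
    T₁≥3 le = ≤-by _ (0≤-+ (0≤-* (ℚ.nonNegative⁻¹ (1ℚ + 1ℚ)) (0≤-* (0≤-diff le) (0≤-+ (<⇒≤ 0<Y) 0≤E₂)))
        (0≤-* (ℚ.nonNegative⁻¹ (+ 4 / 1)) (0≤-* (<⇒≤ 0<W′) 0≤E₂))) (lemma δ W W′ E₁ E₂)
      where
      lemma : ∀ δ W V E₁ E₂ → (1ℚ + 1ℚ) * W * (δ + E₁ + E₂) - V * (δ + E₁)
        ≡ (+ 3 / 1) * (V * (δ + E₁)) + ((1ℚ + 1ℚ) * ((W - (1ℚ + 1ℚ) * V) * ((δ + E₁) + E₂)) + (+ 4 / 1) * (V * E₂))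
      lemma = solve-∀ ℚ-ring

    -- For the case that 2 is a sieving prime, whose share of `E₂` is 1/2.
    T₁≥V : 1ℚ - recip 2 ≤ E₂ → W′ * Y + W′ ≤ T₁
    T₁≥V le = ≤-trans (≤-by _ (0≤-* (0≤-* (ℚ.nonNegative⁻¹ (1ℚ + 1ℚ)) (<⇒≤ 0<W′)) (0≤-diff le)) (lemma W′ Y E₂)) T₁≥
      where
      lemma : ∀ V Y E → V * Y + (1ℚ + 1ℚ) * V * E ≡ (V * Y + V) + (1ℚ + 1ℚ) * V * (E - (1ℚ - (+ 1 / 2)))
      lemma = solve-∀ ℚ-ring

    sieved-weak : 0ℚ < u + t → δ * P ≤ (1ℚ + 1ℚ) * (W * (δ + E₁ + E₂))
    sieved-weak 0<v = ℚ.*-cancelˡ-≤-pos (u + t) {{positive 0<v}} (≤-by _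
      (0≤-+ (0≤-diff sieved) (0≤-+ (0≤-* (<⇒≤ 0<δ) 0≤u) (0≤-* (0≤-* 0≤t (<⇒≤ 0<W′)) (<⇒≤ 0<Y)))) (lemma δ P W W′ E₁ E₂ u t))
      where
      lemma : ∀ δ P W V E₁ E₂ u t → (u + t) * ((1ℚ + 1ℚ) * (W * (δ + E₁ + E₂)))
        ≡ (u + t) * (δ * P) + (((1ℚ + 1ℚ) * (u + t) * W * (δ + E₁ + E₂) - (δ * ((u + t) * P + u) + t * V * (δ + E₁))) + (δ * u + t * V * (δ + E₁)))
      lemma = solve-∀ ℚ-ring

  0≤[_] : ∀ x .{{_ : NonNegative x}} → 0ℚ ≤ x
  0≤[ x ] = ℚ.nonNegative⁻¹ x

  -- Here u / v = 1/3, and 41 · 3 > 100.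
  large-q : ∀ {X T} → 0ℚ ≤ X → X ≤ T → (+ 100 / 1) * ((+ 1 / 1) * X) ≤ (+ 41 / 1) * (((+ 1 / 1) + (+ 2 / 1)) * T)
  large-q {X} {T} 0≤X X≤T = ≤-by _ (0≤-+ (0≤-* 0≤[ + 123 / 1 ] (0≤-diff X≤T)) (0≤-* 0≤[ + 23 / 1 ] 0≤X)) (lemma X T)
    where
    lemma : ∀ X T → (+ 41 / 1) * (((+ 1 / 1) + (+ 2 / 1)) * T) ≡ (+ 100 / 1) * ((+ 1 / 1) * X) + ((+ 123 / 1) * (T - X) + (+ 23 / 1) * X)
    lemma = solve-∀ ℚ-ring

  -- Here u / v = 56/125, and 41 · 125 · 3 > 100 · 56.
  small-q-even : ∀ {X T} → 0ℚ ≤ X → (+ 3 / 1) * X ≤ T → (+ 100 / 1) * ((+ 56 / 1) * X) ≤ (+ 41 / 1) * (((+ 56 / 1) + (+ 69 / 1)) * T)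
  small-q-even {X} {T} 0≤X X≤T = ≤-by _ (0≤-+ (0≤-* 0≤[ + 5125 / 1 ] (0≤-diff X≤T)) (0≤-* 0≤[ + 9775 / 1 ] 0≤X)) (lemma X T)
    where
    lemma : ∀ X T → (+ 41 / 1) * (((+ 56 / 1) + (+ 69 / 1)) * T) ≡ (+ 100 / 1) * ((+ 56 / 1) * X) + ((+ 5125 / 1) * (T - (+ 3 / 1) * X) + (+ 9775 / 1) * X)
    lemma = solve-∀ ℚ-ring

  -- With u / v = 56/125 the requirement is 5600 Y ≤ 5125 (Y + 1), or 475 Y ≤ 5125, which Y ≤ 21/2
  -- satisfies.
  small-q-few : ∀ {V Y T} → 0ℚ ≤ V → V * Y + V ≤ T → (+ 2 / 1) * Y ≤ (+ 21 / 1) → (+ 100 / 1) * ((+ 56 / 1) * (V * Y)) ≤ (+ 41 / 1) * (((+ 56 / 1) + (+ 69 / 1)) * T)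
  small-q-few {V} {Y} {T} 0≤V le Y≤ = ≤-by _
    (0≤-+ (0≤-* 0≤[ + 5125 / 1 ] (0≤-diff le)) (0≤-+ (0≤-* 0≤V (0≤-* 0≤[ + 475 / 2 ] (0≤-diff Y≤))) (0≤-* 0≤[ + 275 / 2 ] 0≤V))) (lemma V Y T)
    where
    lemma : ∀ V Y T → (+ 41 / 1) * (((+ 56 / 1) + (+ 69 / 1)) * T)
      ≡ (+ 100 / 1) * ((+ 56 / 1) * (V * Y)) + ((+ 5125 / 1) * (T - (V * Y + V)) + (V * ((+ 475 / 2) * ((+ 21 / 1) - (+ 2 / 1) * Y)) + (+ 275 / 2) * V))
    lemma = solve-∀ ℚ-ring

  -- The factor multiplying √2 in the hypothesis, with the division by δ cleared.
  cleared : ∀ {δ σ σ₁} s r (w w₁ : ℕ) (δpos : 0ℚ < δ) → δ ≡ 1ℚ - σ →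
    δ * (((+ 2 / 1) * ((((+ s / 1) - 1ℚ) ÷ δ) {{>-nonZero δpos}} + (+ 2 / 1)) * (+ w / 1))
         - ((((((+ r / 1) - 1ℚ) + (1ℚ - σ₁)) ÷ δ) {{>-nonZero δpos}} + 1ℚ) * (+ w₁ / 1)))
    ≡ (1ℚ + 1ℚ) * nat w * (δ + (nat s - σ)) - nat w₁ * (δ + (nat r - σ₁))
  cleared {δ} {σ} {σ₁} s r w w₁ δpos δ≡ =
    trans (lemma δ (1/ δ) (+ s / 1) (+ r / 1) σ₁ (+ w / 1) (+ w₁ / 1))
    (trans (cong (λ o → (1ℚ + 1ℚ) * (+ w / 1) * (((+ s / 1) - 1ℚ) * o + (1ℚ + 1ℚ) * δ) - (+ w₁ / 1) * (((+ r / 1) - σ₁) * o + δ)) (ℚ.*-inverseʳ δ))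
    (trans (lemma′ δ σ (+ s / 1) (+ r / 1) σ₁ (+ w / 1) (+ w₁ / 1) δ≡)
      (cong₂ (λ x y → x - y) (cong₂ (λ a b → (1ℚ + 1ℚ) * a * (δ + (b - σ))) (/1≡ι (+ w)) (/1≡ι (+ s)))
                             (cong₂ (λ a b → a * (δ + (b - σ₁))) (/1≡ι (+ w₁)) (/1≡ι (+ r))))))
    where
    instance _ = >-nonZero δpos
    lemma : ∀ δ i s r σ₁ w w₁ →
      δ * (((+ 2 / 1) * ((s - 1ℚ) * i + (+ 2 / 1)) * w) - (((((r - 1ℚ) + (1ℚ - σ₁)) * i) + 1ℚ) * w₁))
      ≡ (1ℚ + 1ℚ) * w * ((s - 1ℚ) * (δ * i) + (1ℚ + 1ℚ) * δ) - w₁ * ((r - σ₁) * (δ * i) + δ)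
    lemma = solve-∀ ℚ-ring
    lemma′ : ∀ δ σ s r σ₁ w w₁ → δ ≡ 1ℚ - σ →
      (1ℚ + 1ℚ) * w * ((s - 1ℚ) * 1ℚ + (1ℚ + 1ℚ) * δ) - w₁ * ((r - σ₁) * 1ℚ + δ)
      ≡ (1ℚ + 1ℚ) * w * (δ + (s - σ)) - w₁ * (δ + (r - σ₁))
    lemma′ _ σ s r σ₁ w w₁ refl = poly σ s r σ₁ w w₁
      where
      poly : ∀ σ s r σ₁ w w₁ → (1ℚ + 1ℚ) * w * ((s - 1ℚ) * 1ℚ + (1ℚ + 1ℚ) * (1ℚ - σ)) - w₁ * ((r - σ₁) * 1ℚ + (1ℚ - σ))
        ≡ (1ℚ + 1ℚ) * w * ((1ℚ - σ) + (s - σ)) - w₁ * ((1ℚ - σ) + (r - σ₁))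
      poly = solve-∀ ℚ-ring

  2ℚ : nat 2 ≡ 1ℚ + 1ℚ
  2ℚ = trans (nat-+ 1 1) (cong₂ _+_ ι-1 ι-1)

  -- The cost `b` is constant on the sieving primes dividing Q and on the others. Moving the terms
  -- with `t W′` to the left restores the full 2 v W on both groups, whence the common factor on the
  -- right.
  sieved : ∀ {u t v P A BT BF W W′ : ℕ} {G : ℤ} {Jp : ℕ → ℤ} (b : ℕ → ℕ) (ps₁ ps₂ : List ℕ) →
    All Prime (ps₁ ++ ps₂) → 0ℚ < 1ℚ - sumRecip (ps₁ ++ ps₂) → 0 ℕ.< A →
    G ℤ.≤ ∑L (ps₁ ++ ps₂) Jp →
    All (λ p → + p ℤ.* (+ v ℤ.* Jp p) ℤ.≤ + v ℤ.* G ℤ.+ + A ℤ.* (+ pred p ℤ.* + b p)) (ps₁ ++ ps₂) →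
    + A ℤ.* (+ v ℤ.* + P ℤ.+ + u) ℤ.≤ + v ℤ.* G ℤ.+ + A ℤ.* + BT →
    All (λ p → b p ≡ BT) ps₁ → All (λ p → b p ≡ BF) ps₂ →
    v ≡ u ℕ.+ t → BT ℕ.+ t ℕ.* W′ ≡ 2 ℕ.* v ℕ.* W → BF ≡ 2 ℕ.* v ℕ.* W →
    let δ = 1ℚ - sumRecip (ps₁ ++ ps₂) in
    δ * ((nat u + nat t) * nat P + nat u) + nat t * nat W′ * (δ + E ps₁) ≤ (1ℚ + 1ℚ) * (nat u + nat t) * nat W * (δ + E ps₁ + E ps₂)
  sieved {u} {t} {v} {P} {A} {BT} {BF} {W} {W′} {G} {Jp} b ps₁ ps₂ pps 0<δ 0<A sieveℤ bounds lower b₁ b₂ refl BT≡ BF≡ =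
    ≤-trans (ℚ.+-monoˡ-≤ (nat t * nat W′ * (δ + E ps₁)) main) (≤-reflexive (begin
      δ * nat BT + (E ps₁ * nat BT + E ps₂ * nat BF) + nat t * nat W′ * (δ + E ps₁)
        ≡⟨ collect δ (E ps₁) (E ps₂) (nat BT) (nat BF) (nat t * nat W′) ⟩
      (nat BT + nat t * nat W′) * (δ + E ps₁) + nat BF * E ps₂
        ≡⟨ cong₂ (λ x y → x * (δ + E ps₁) + y * E ps₂) BTℚ BFℚ ⟩
      (1ℚ + 1ℚ) * (nat u + nat t) * nat W * (δ + E ps₁) + (1ℚ + 1ℚ) * (nat u + nat t) * nat W * E ps₂
        ≡⟨ ℚ.*-distribˡ-+ ((1ℚ + 1ℚ) * (nat u + nat t) * nat W) (δ + E ps₁) (E ps₂) ⟨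
      (1ℚ + 1ℚ) * (nat u + nat t) * nat W * (δ + E ps₁ + E ps₂) ∎))
    where
    open ≡-Reasoning
    ps = ps₁ ++ ps₂
    δ = 1ℚ - sumRecip ps
    collect : ∀ δ e₁ e₂ x y z → δ * x + (e₁ * x + e₂ * y) + z * (δ + e₁) ≡ (x + z) * (δ + e₁) + y * e₂
    collect = solve-∀ ℚ-ring
    2vW : nat (2 ℕ.* v ℕ.* W) ≡ (1ℚ + 1ℚ) * (nat u + nat t) * nat W
    2vW = trans (nat-* (2 ℕ.* v) W) (cong (_* nat W) (trans (nat-* 2 v) (cong₂ _*_ 2ℚ (nat-+ u t))))
    BTℚ : nat BT + nat t * nat W′ ≡ (1ℚ + 1ℚ) * (nat u + nat t) * nat W
    BTℚ = trans (cong (_+_ (nat BT)) (sym (nat-* t W′))) (trans (sym (nat-+ BT (t ℕ.* W′))) (trans (cong nat BT≡) 2vW))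
    BFℚ : nat BF ≡ (1ℚ + 1ℚ) * (nat u + nat t) * nat W
    BFℚ = trans (cong nat BF≡) 2vW
    ι-+* : ∀ i a j → ι (i ℤ.+ a ℤ.* j) ≡ ι i + ι a * ι j
    ι-+* i a j = trans (ι-+ i (a ℤ.* j)) (cong (_+_ (ι i)) (ι-* a j))
    boundℚ : ∀ {p} → + p ℤ.* (+ v ℤ.* Jp p) ℤ.≤ + v ℤ.* G ℤ.+ + A ℤ.* (+ pred p ℤ.* + b p) →
      nat p * ι (+ v ℤ.* Jp p) ≤ ι (+ v ℤ.* G) + nat A * (nat (pred p) * nat (b p))
    boundℚ {p} le = subst₂ _≤_ (ι-* (+ p) (+ v ℤ.* Jp p))
      (trans (ι-+* (+ v ℤ.* G) (+ A) (+ pred p ℤ.* + b p)) (cong (λ x → ι (+ v ℤ.* G) + nat A * x) (ι-* (+ pred p) (+ b p)))) (ι-mono le)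
    sieveℚ : ι (+ v ℤ.* G) ≤ ∑ℚ ps (λ p → ι (+ v ℤ.* Jp p))
    sieveℚ = subst (ι (+ v ℤ.* G) ≤_) (trans (cong ι (sym (∑L-*ˡ ps (+ v) Jp))) (ι-∑L ps (λ p → + v ℤ.* Jp p))) (ι-mono (ℤ.*-monoˡ-≤-nonNeg (+ v) sieveℤ))
    lowerℚ : nat A * ((nat u + nat t) * nat P + nat u) ≤ ι (+ v ℤ.* G) + nat A * nat BT
    lowerℚ = subst₂ _≤_ (trans (ι-* (+ A) (+ v ℤ.* + P ℤ.+ + u)) (cong (nat A *_) (trans (ι-+ (+ v ℤ.* + P) (+ u)) (cong (_+ nat u) (trans (ι-* (+ v) (+ P)) (cong (_* nat P) (nat-+ u t)))))))
      (ι-+* (+ v ℤ.* G) (+ A) (+ BT)) (ι-mono lower)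
    weights : ∑ℚ ps (λ p → (1ℚ - recip p) * nat (b p)) ≡ E ps₁ * nat BT + E ps₂ * nat BF
    weights = trans (∑ℚ-++ ps₁ ps₂ _) (cong₂ _+_ (weighted-const ps₁ (λ p → nat (b p)) (All.map (cong nat) b₁)) (weighted-const ps₂ (λ p → nat (b p)) (All.map (cong nat) b₂)))
    main : δ * ((nat u + nat t) * nat P + nat u) ≤ δ * nat BT + (E ps₁ * nat BT + E ps₂ * nat BF)
    main = subst (λ w → δ * ((nat u + nat t) * nat P + nat u) ≤ δ * nat BT + w) weights
      (sieve-inequality {j = λ p → ι (+ v ℤ.* Jp p)} {b = λ p → nat (b p)} pps (All.map boundℚ bounds) sieveℚ lowerℚ (nat-pos 0<A) 0<δ)

  2[δ+E]≤21 : ∀ {σ e} → recip 2 ≤ σ → e ≤ + 10 / 1 → (+ 2 / 1) * ((1ℚ - σ) + e) ≤ + 21 / 1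
  2[δ+E]≤21 {σ} {e} σ≥ e≤ = ≤-by _ (0≤-* 0≤[ + 2 / 1 ] (0≤-+ (0≤-diff σ≥) (0≤-diff e≤))) (lemma σ e)
    where
    lemma : ∀ σ e → (+ 21 / 1) ≡ (+ 2 / 1) * ((1ℚ - σ) + e) + (+ 2 / 1) * ((σ - (+ 1 / 2)) + ((+ 10 / 1) - e))
    lemma = solve-∀ ℚ-ring

  -- The prime 2 takes 1/2 away from δ, and r primes of size at least 4r together take at most 1/4.
  quarter : ∀ {σ σ₁ r} → σ ≡ σ₁ + sumRecip (2 ∷ []) → 0ℚ < r → (+ 4 / 1) * r * σ₁ ≤ r → (+ 1 / 4) ≤ 1ℚ - σ
  quarter {_} {σ₁} {r} refl 0<r le = ℚ.*-cancelˡ-≤-pos r {{positive 0<r}} (≤-by _ (0≤-* 0≤[ + 1 / 4 ] (0≤-diff le)) (lemma r σ₁))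
    where
    lemma : ∀ r s → r * (1ℚ - (s + ((+ 1 / 2) + 0ℚ))) ≡ r * (+ 1 / 4) + (+ 1 / 4) * (r - (+ 4 / 1) * r * s)
    lemma = solve-∀ ℚ-ring

  total≤ : ∀ {σ e₁ e₂ r} → 0ℚ ≤ σ → e₁ ≤ nat r → e₂ ≤ 1ℚ → (1ℚ - σ) + e₁ + e₂ ≤ nat (r ℕ.+ 2)
  total≤ {σ} {e₁} {e₂} {r} 0≤σ e₁≤ e₂≤ = subst ((1ℚ - σ) + e₁ + e₂ ≤_) (sym (trans (nat-+ r 2) (cong (_+_ (nat r)) 2ℚ)))
    (≤-by _ (0≤-+ 0≤σ (0≤-+ (0≤-diff e₁≤) (0≤-diff e₂≤))) (lemma σ e₁ e₂ (nat r)))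
    where
    lemma : ∀ σ a b r → r + (1ℚ + 1ℚ) ≡ ((1ℚ - σ) + a + b) + (σ + ((r - a) + (1ℚ - b)))
    lemma = solve-∀ ℚ-ring

  weak-bound : ∀ {δ P W X R} → 0ℚ < W → δ * P ≤ (1ℚ + 1ℚ) * (W * X) → (+ 1 / 4) ≤ δ → X ≤ R → 0ℚ ≤ P → P ≤ (+ 8 / 1) * W * R
  weak-bound {δ} {P} {W} {X} {R} 0<W le δ≥ X≤ 0≤P = ≤-by _
    (0≤-+ (0≤-* 0≤[ + 4 / 1 ] (0≤-diff le)) (0≤-+ (0≤-* 0≤[ + 4 / 1 ] (0≤-* (0≤-diff δ≥) 0≤P)) (0≤-* 0≤[ + 8 / 1 ] (0≤-* (<⇒≤ 0<W) (0≤-diff X≤))))) (lemma δ P W X R)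
    where
    lemma : ∀ δ P W X R → (+ 8 / 1) * W * R ≡ P + ((+ 4 / 1) * ((1ℚ + 1ℚ) * (W * X) - δ * P) + ((+ 4 / 1) * ((δ - (+ 1 / 4)) * P) + (+ 8 / 1) * (W * (R - X))))
    lemma = solve-∀ ℚ-ring

-- Lists of prime divisors, the radical, and the parity of Q.

module PrimeLists where
  open import Defs using (primesDividing; rad; primePartIn; W)
  open PrimeKernels using (All≢⇒∉)
  open import Data.Nat as ℕ using (ℕ; zero; suc)
  import Data.Nat.Properties as ℕ
  import Data.Nat.Divisibility as ℕ
  import Data.Nat.DivMod as ℕ
  import Data.Nat.Tactic.RingSolver as ℕR
  open import Data.Nat.Primality using (Prime; prime?; productOfPrimes≥1)
  open import Data.Nat.Primality.Factorisation using (factorisationHasAllPrimeFactors)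
  open import Data.Nat.ListAction using (product)
  open import Data.Nat.ListAction.Properties using (∈⇒∣product)
  open import Data.List using (List; []; _∷_; _++_; length; filter; upTo)
  open import Data.List.Properties using (length-++)
  open import Data.List.Relation.Unary.All as All using (All; []; _∷_)
  open import Data.List.Relation.Unary.Any using (here; there)
  open import Data.List.Relation.Unary.AllPairs using ([]; _∷_)
  open import Data.List.Relation.Unary.Unique.Propositional using (Unique)
  open import Data.List.Relation.Unary.Unique.Propositional.Properties using (filter⁺; upTo⁺)
  open import Data.List.Membership.Propositional using (_∈_; _∉_)
  open import Data.List.Membership.Propositional.Properties using (∈-filter⁺; ∈-filter⁻; ∈-upTo⁺; ∈-∃++; ∈-++⁺ˡ; ∈-++⁺ʳ; ∈-++⁻)
  open import Data.Product using (Σ; _×_; _,_; proj₁; proj₂)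
  open import Data.Sum using (_⊎_; inj₁; inj₂)
  open import Data.Empty using (⊥-elim)
  open import Relation.Nullary using (¬_)
  open import Relation.Nullary.Decidable using (_×-dec_)
  open import Relation.Binary.PropositionalEquality using (_≡_; refl; sym; trans; cong; cong₂; subst; module ≡-Reasoning)

  ∈-primesDividing⁻ : ∀ {l} m → l ∈ primesDividing m → Prime l × l ℕ.∣ m
  ∈-primesDividing⁻ m i = proj₂ (∈-filter⁻ (λ p → prime? p ×-dec p ℕ.∣? m) {xs = upTo (suc m)} i)

  ∈-primesDividing⁺ : ∀ {l} m → 0 ℕ.< m → Prime l → l ℕ.∣ m → l ∈ primesDividing m
  ∈-primesDividing⁺ m 0<m pl l∣m = ∈-filter⁺ (λ p → prime? p ×-dec p ℕ.∣? m) (∈-upTo⁺ (ℕ.s≤s (ℕ.∣⇒≤ {{ℕ.>-nonZero 0<m}} l∣m))) (pl , l∣m)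

  primesDividing-unique : ∀ m → Unique (primesDividing m)
  primesDividing-unique m = filter⁺ (λ p → prime? p ×-dec p ℕ.∣? m) (upTo⁺ (suc m))

  primesDividing-prime : ∀ m → All Prime (primesDividing m)
  primesDividing-prime m = All.tabulate λ i → proj₁ (∈-primesDividing⁻ m i)

  prime∣rad⇒∣ : ∀ {l} m → Prime l → l ℕ.∣ rad m → l ℕ.∣ m
  prime∣rad⇒∣ m pl d = proj₂ (∈-primesDividing⁻ m (factorisationHasAllPrimeFactors pl d (primesDividing-prime m)))

  prime∣⇒∣rad : ∀ {l} m → 0 ℕ.< m → Prime l → l ℕ.∣ m → l ℕ.∣ rad m
  prime∣⇒∣rad m 0<m pl d = ∈⇒∣product (∈-primesDividing⁺ m 0<m pl d)

  rad>0 : ∀ m → 0 ℕ.< rad m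
  rad>0 m = productOfPrimes≥1 (primesDividing-prime m)

  unique-⊆⇒length≤ : ∀ {xs ys : List ℕ} → Unique xs → (∀ {x} → x ∈ xs → x ∈ ys) → length xs ℕ.≤ length ys
  unique-⊆⇒length≤ {[]} _ _ = ℕ.z≤n
  unique-⊆⇒length≤ {x ∷ xs} {ys} (x≢ ∷ u) sub with as , bs , refl ← ∈-∃++ (sub (here refl)) =
    subst (suc (length xs) ℕ.≤_) (sym (trans (length-++ as) (trans (ℕ.+-suc (length as) (length bs)) (cong suc (sym (length-++ as))))))
      (ℕ.s≤s (unique-⊆⇒length≤ u λ i → drop i (∈-++⁻ as (sub (there i)))))
    where
    drop : ∀ {y} → y ∈ xs → y ∈ as ⊎ y ∈ x ∷ bs → y ∈ as ++ bs
    drop i (inj₁ j)           = ∈-++⁺ˡ j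
    drop i (inj₂ (here refl)) = ⊥-elim (All≢⇒∉ x≢ i)
    drop i (inj₂ (there j))   = ∈-++⁺ʳ as j

  -- This direction is the useful one because W(k_Q) enters the hypothesis with a minus sign.
  W-primePartIn≤ : ∀ k Q → W (primePartIn k Q) ℕ.≤ 2 ℕ.^ length (filter (λ l → l ℕ.∣? Q) (primesDividing k))
  W-primePartIn≤ k Q = ℕ.^-monoʳ-≤ 2 (unique-⊆⇒length≤ (primesDividing-unique (product Ls)) λ i →
    let pl , d = ∈-primesDividing⁻ (product Ls) i in
    factorisationHasAllPrimeFactors pl d (All.tabulate λ j → proj₁ (∈-primesDividing⁻ k (proj₁ (∈-filter⁻ (λ l → l ℕ.∣? Q) {xs = primesDividing k} j)))))
    where Ls = filter (λ l → l ℕ.∣? Q) (primesDividing k)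

  -- The binomial expansion modulo J². It yields Q ≡ n modulo J, so that Q inherits oddness from n.
  [1+J]^n : ∀ J n → Σ ℕ λ c → suc J ℕ.^ n ≡ 1 ℕ.+ J ℕ.* (n ℕ.+ J ℕ.* c)
  [1+J]^n J zero    = 0 , lemma J
    where
    lemma : ∀ J → 1 ≡ 1 ℕ.+ J ℕ.* (0 ℕ.+ J ℕ.* 0)
    lemma = ℕR.solve-∀
  [1+J]^n J (suc n) with c , eq ← [1+J]^n J n = c ℕ.+ n ℕ.+ J ℕ.* c , trans (cong (suc J ℕ.*_) eq) (lemma J n c)
    where
    lemma : ∀ J n c → (1 ℕ.+ J) ℕ.* (1 ℕ.+ J ℕ.* (n ℕ.+ J ℕ.* c)) ≡ 1 ℕ.+ J ℕ.* ((1 ℕ.+ n) ℕ.+ J ℕ.* (c ℕ.+ n ℕ.+ J ℕ.* c))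
    lemma = ℕR.solve-∀

  quotient-odd : ∀ {J n Q} → 0 ℕ.< J → 2 ℕ.∣ J → ¬ 2 ℕ.∣ n → Q ℕ.* J ≡ suc J ℕ.^ n ℕ.∸ 1 → ¬ 2 ℕ.∣ Q
  quotient-odd {J} {n} {Q} 0<J 2∣J 2∤n QJ≡ 2∣Q with c , eq ← [1+J]^n J n =
    2∤n (ℕ.∣m+n∣m⇒∣n (subst (2 ℕ.∣_) (trans Q≡ (ℕ.+-comm n (J ℕ.* c))) 2∣Q) (ℕ.∣m⇒∣m*n c 2∣J))
    where
    Q≡ : Q ≡ n ℕ.+ J ℕ.* c
    Q≡ = ℕ.*-cancelˡ-≡ Q _ J {{ℕ.>-nonZero 0<J}} (trans (ℕ.*-comm J Q) (trans QJ≡ (cong (ℕ._∸ 1) eq)))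

  odd⇒2∤ : ∀ n → n ℕ.% 2 ≡ 1 → ¬ 2 ℕ.∣ n
  odd⇒2∤ n e d with () ← trans (sym e) (ℕ.n∣m⇒m%n≡0 n 2 d)

  odd-half : ∀ n → suc n ℕ.% 2 ≡ 1 → n ≡ n ℕ./ 2 ℕ.+ n ℕ./ 2
  odd-half n e = trans (cong (ℕ._∸ 1) decomposition) (trans (sym half) (cong₂ ℕ._+_ same same))
    where
    h = suc n ℕ./ 2
    decomposition : suc n ≡ 1 ℕ.+ h ℕ.* 2
    decomposition = trans (ℕ.m≡m%n+[m/n]*n (suc n) 2) (cong (ℕ._+ h ℕ.* 2) e)
    half : h ℕ.+ h ≡ h ℕ.* 2
    half = trans (cong (h ℕ.+_) (sym (ℕ.+-identityʳ h))) (ℕ.*-comm 2 h)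
    same : h ≡ n ℕ./ 2
    same = sym (trans (cong (ℕ._/ 2) (ℕ.suc-injective decomposition)) (ℕ.m*n/n≡m h 2))

  square-of-half-power : ∀ q n → suc n ℕ.% 2 ≡ 1 → q ℕ.^ n ≡ q ℕ.^ (n ℕ./ 2) ℕ.* q ℕ.^ (n ℕ./ 2)
  square-of-half-power q n e = trans (cong (q ℕ.^_) (odd-half n e)) (ℕ.^-distribˡ-+-* q (n ℕ./ 2) (n ℕ./ 2))

-- Prime divisors of (5^n - 1)/4 and the size estimates for q = 5.

module OrderOfFive where
  open PrimeKernels using (prime∤⇒coprime)
  open TraceSumBounds using (square-≤⇒≤)
  open FreshmansDream using (module Freshman)
  open import Data.Nat as ℕ using (ℕ; zero; suc; pred; _+_; _*_; _^_; _∸_; _≤_; _<_; s≤s; z≤n; z<s)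
  open import Data.Nat.Properties
  open import Data.Nat.Divisibility
  open import Data.Nat.DivMod using (m≡m%n+[m/n]*n; m%n<n)
  open import Data.Nat.Coprimality using (coprime-Bézout)
  open import Data.Nat.GCD using (module Bézout)
  open import Data.Nat.Primality using (Prime; prime[2]; prime⇒nonZero; prime⇒nonTrivial; prime⇒irreducible; ¬prime[1]; euclidsLemma)
  open import Data.Nat.ListAction using (product)
  open import Data.Nat.Tactic.RingSolver using (solve-∀)
  open import Data.List using ([]; _∷_; length)
  open import Data.List.Relation.Unary.All as All using (All; []; _∷_)
  open import Data.Product using (Σ; _×_; _,_)
  open import Data.Sum using (_⊎_; inj₁; inj₂)
  open import Data.Empty using (⊥; ⊥-elim)
  open import Relation.Nullary using (¬_; Dec; yes; no)
  open import Relation.Binary.PropositionalEquality using (_≡_; _≢_; refl; sym; trans; cong; cong₂; subst; module ≡-Reasoning)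
  open Freshman +-*-commutativeSemiring using (freshman)
  import Algebra.Properties.Semiring.Exp +-*-semiring as Exp
  import Algebra.Properties.Semiring.Mult +-*-semiring as Mult

  Exp≡^ : ∀ x n → x Exp.^ n ≡ x ^ n
  Exp≡^ x zero    = refl
  Exp≡^ x (suc n) = cong (x *_) (Exp≡^ x n)

  Mult≡* : ∀ n x → n Mult.× x ≡ n * x
  Mult≡* zero    x = refl
  Mult≡* (suc n) x = cong (x +_) (Mult≡* n x)

  fermat : ∀ {p} → Prime p → ∀ a → Σ ℕ λ c → a ^ p ≡ a + p * c
  fermat {p@(suc _)} pp zero    = 0 , sym (*-zeroʳ p)
  fermat {p} pp (suc a) with c , eq ← freshman pp 1 a | c′ , eq′ ← fermat pp a = c′ + c , (begin
    suc a ^ p                             ≡⟨ Exp≡^ (suc a) p ⟨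
    (1 + a) Exp.^ p                       ≡⟨ eq ⟩
    1 Exp.^ p + a Exp.^ p + p Mult.× c    ≡⟨ cong₂ _+_ (cong₂ _+_ (trans (Exp≡^ 1 p) (^-zeroˡ p)) (trans (Exp≡^ a p) eq′)) (Mult≡* p c) ⟩
    1 + (a + p * c′) + p * c              ≡⟨ lemma a p c′ c ⟩
    suc a + p * (c′ + c)                  ∎)
    where
    open ≡-Reasoning
    lemma : ∀ a p x y → 1 + (a + p * x) + p * y ≡ (1 + a) + p * (x + y)
    lemma = solve-∀

  OneMod : ℕ → ℕ → Set
  OneMod l x = Σ ℕ λ c → x ≡ 1 + l * c

  OneMod-^ : ∀ {l x} → OneMod l x → ∀ k → OneMod l (x ^ k)
  OneMod-^ {l} _ zero = 0 , cong suc (sym (*-zeroʳ l))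
  OneMod-^ {l} o@(c , eq) (suc k) with c′ , eq′ ← OneMod-^ {l} o k = c + c′ + l * (c * c′) , trans (cong₂ _*_ eq eq′) (lemma l c c′)
    where
    lemma : ∀ l c d → (1 + l * c) * (1 + l * d) ≡ 1 + l * (c + d + l * (c * d))
    lemma = solve-∀

  prime∣4⇒≡2 : ∀ {l} → Prime l → l ∣ 4 → l ≡ 2
  prime∣4⇒≡2 {l} pl d with euclidsLemma 2 2 pl d
  ... | inj₁ d′ = case d′
    where
    case : l ∣ 2 → l ≡ 2
    case d with prime⇒irreducible prime[2] d
    ... | inj₁ refl = ⊥-elim (¬prime[1] pl)
    ... | inj₂ e    = e
  ... | inj₂ d′ with prime⇒irreducible prime[2] d′
  ...   | inj₁ refl = ⊥-elim (¬prime[1] pl)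
  ...   | inj₂ e    = e

  -- The order of 5 modulo l is n, so n divides l - 1; both n and l are odd.
  prime-divisor-bound : ∀ {n Q l} → Prime n → ¬ 2 ∣ n → Q * 4 ≡ 5 ^ n ∸ 1 → ¬ 2 ∣ Q → Prime l → l ∣ Q → 1 + 2 * n ≤ l
  prime-divisor-bound {n} {Q} {l} pn 2∤n eq 2∤Q pl l∣Q = bound (n ∣? pred l)
    where
    instance
      _ = prime⇒nonZero pl
      _ = prime⇒nonZero pn
    l≡ : l ≡ suc (pred l)
    l≡ = sym (suc-pred l)
    l≢2 : l ≢ 2
    l≢2 refl = 2∤Q l∣Q
    5^n : OneMod l (5 ^ n)
    5^n = quotient l∣Q * 4 , (begin
      5 ^ n                            ≡⟨ m+[n∸m]≡n (m^n>0 5 n) ⟨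
      1 + (5 ^ n ∸ 1)                  ≡⟨ cong suc eq ⟨
      1 + Q * 4                        ≡⟨ cong (λ x → 1 + x * 4) (m∣n⇒n≡quotient*m l∣Q) ⟩
      1 + (quotient l∣Q * l) * 4       ≡⟨ cong suc (lemma (quotient l∣Q) l) ⟩
      1 + l * (quotient l∣Q * 4)       ∎)
      where
      open ≡-Reasoning
      lemma : ∀ c l → c * l * 4 ≡ l * (c * 4)
      lemma = solve-∀
    l∤5 : ¬ l ∣ 5
    l∤5 l∣5 with c , e ← 5^n = >⇒∤ (ℕ.nonTrivial⇒n>1 l {{prime⇒nonTrivial pl}}) (∣m+n∣m⇒∣n (subst (l ∣_) (trans e (+-comm 1 (l * c))) l∣5^n) (m∣m*n c))
      where
      l∣5^n : l ∣ 5 ^ n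
      l∣5^n = subst (λ m → l ∣ 5 ^ m) (suc-pred n) (∣m⇒∣m*n (5 ^ pred n) l∣5)
    5^[l-1] : OneMod l (5 ^ pred l)
    5^[l-1] with c , e ← fermat pl 5 = finish (euclidsLemma 5 (5 ^ pred l ∸ 1) pl (divides c (begin
      5 * (5 ^ pred l ∸ 1)        ≡⟨ *-distribˡ-∸ 5 (5 ^ pred l) 1 ⟩
      5 ^ suc (pred l) ∸ 5        ≡⟨ cong (λ m → 5 ^ m ∸ 5) (sym l≡) ⟩
      5 ^ l ∸ 5                   ≡⟨ cong (_∸ 5) e ⟩
      5 + l * c ∸ 5               ≡⟨ m+n∸m≡n 5 (l * c) ⟩
      l * c                       ≡⟨ *-comm l c ⟩
      c * l                       ∎)))
      where
      open ≡-Reasoning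
      finish : l ∣ 5 ⊎ l ∣ 5 ^ pred l ∸ 1 → OneMod l (5 ^ pred l)
      finish (inj₁ d) = ⊥-elim (l∤5 d)
      finish (inj₂ (divides k e)) = k , trans (sym (m+[n∸m]≡n (m^n>0 5 (pred l)))) (cong suc (trans e (*-comm k l)))
    -- If both powers were 1 modulo l, so would be their quotient 5, and l would divide 4.
    5≢1 : ∀ x y → 5 ^ y * 5 ≡ 5 ^ x → OneMod l (5 ^ x) → OneMod l (5 ^ y) → ⊥
    5≢1 x y e (a , ea) (b , eb) = l≢2 (prime∣4⇒≡2 pl (∣m+n∣m⇒∣n (divides a (begin
      l * (5 * b) + 4       ≡⟨ suc-injective (trans (lemma l b) (trans (cong (_* 5) (sym eb)) (trans e ea))) ⟩
      l * a                 ≡⟨ *-comm l a ⟩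
      a * l                 ∎)) (m∣m*n (5 * b))))
      where
      open ≡-Reasoning
      lemma : ∀ l b → 1 + (l * (5 * b) + 4) ≡ (1 + l * b) * 5
      lemma = solve-∀
    power : ∀ {m} k → OneMod l (5 ^ m) → OneMod l (5 ^ (k * m))
    power {m} k o = subst (OneMod l) (trans (^-*-assoc 5 m k) (cong (5 ^_) (*-comm m k))) (OneMod-^ {l} o k)
    5^-suc : ∀ y z → 1 + y ≡ z → 5 ^ y * 5 ≡ 5 ^ z
    5^-suc y z e = trans (*-comm (5 ^ y) 5) (cong (5 ^_) e)
    bound : Dec (n ∣ pred l) → 1 + 2 * n ≤ l
    -- If n and l - 1 were coprime, some multiples of them would differ by 1, making 5 itself
    -- congruent to 1.
    bound (no n∤) with coprime-Bézout (prime∤⇒coprime pn n∤)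
    ... | Bézout.+- x y e = ⊥-elim (5≢1 (x * n) (y * pred l) (5^-suc _ _ e) (power x 5^n) (power y 5^[l-1]))
    ... | Bézout.-+ x y e = ⊥-elim (5≢1 (y * pred l) (x * n) (5^-suc _ _ e) (power y 5^[l-1]) (power x 5^n))
    bound (yes (divides 0 e)) = ⊥-elim (¬prime[1] (subst Prime (trans l≡ (cong suc e)) pl))
    -- This would be l = n + 1, an even number.
    bound (yes (divides 1 e)) = ⊥-elim (2∤n (odd-even n l-odd))
      where
      l-odd : ¬ 2 ∣ suc n
      l-odd d with prime⇒irreducible pl (subst (2 ∣_) (sym (trans l≡ (cong suc (trans e (+-identityʳ n))))) d)
      ... | inj₂ 2≡l = l≢2 (sym 2≡l)
      odd-even : ∀ n → ¬ 2 ∣ suc n → 2 ∣ n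
      odd-even n ¬d with n ℕ.% 2 | m≡m%n+[m/n]*n n 2 | m%n<n n 2
      ... | 0 | e | _ = divides (n ℕ./ 2) e
      ... | 1 | e | _ = ⊥-elim (¬d (divides (suc (n ℕ./ 2)) (cong suc e)))
      ... | suc (suc _) | _ | s≤s (s≤s ())
    bound (yes (divides (suc (suc m)) e)) = subst (1 + 2 * n ≤_) (sym (trans l≡ (cong suc e))) (s≤s (*-monoˡ-≤ n {2} {suc (suc m)} (s≤s (s≤s z≤n))))

  ^-length≤product : ∀ {M xs} → All (M ≤_) xs → M ^ length xs ≤ product xs
  ^-length≤product []       = ≤-refl
  ^-length≤product (p ∷ ps) = *-mono-≤ p (^-length≤product ps)

  16[r+2]<5^r : ∀ r → 16 * ((3 + r) + 2) < 5 ^ (3 + r)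
  16[r+2]<5^r zero    = <ᵇ⇒< 80 125 _
  16[r+2]<5^r (suc r) = begin-strict
    16 * ((3 + suc r) + 2)         ≡⟨ lemma r ⟩
    16 * ((3 + r) + 2) + 16        <⟨ +-mono-<-≤ (16[r+2]<5^r r) (≤-trans (m≤m+n 16 109) (^-monoʳ-≤ 5 {3} {3 + r} (s≤s (s≤s (s≤s z≤n))))) ⟩
    5 ^ (3 + r) + 5 ^ (3 + r)      ≤⟨ m≤m+n _ (3 * 5 ^ (3 + r)) ⟩
    5 ^ (3 + r) + 5 ^ (3 + r) + 3 * 5 ^ (3 + r) ≡⟨ lemma′ (5 ^ (3 + r)) ⟩
    5 * 5 ^ (3 + r)                ∎
    where
    open ≤-Reasoning
    lemma : ∀ r → 16 * ((3 + (1 + r)) + 2) ≡ 16 * ((3 + r) + 2) + 16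
    lemma = solve-∀
    lemma′ : ∀ x → x + x + 3 * x ≡ 5 * x
    lemma′ = solve-∀

  module _ {n Q P κ r : ℕ} (pn : Prime n) (Q≡ : Q * 4 ≡ 5 ^ n ∸ 1) (P² : P * P ≡ 5 ^ pred n)
    (r≥11 : 11 ≤ r) (size : (1 + 2 * n) ^ (κ + r) ≤ Q) where
    private
      T = κ + r
      instance _ = prime⇒nonZero pn

    Q<5^n : Q * 4 < 5 ^ n
    Q<5^n = subst (_< 5 ^ n) (sym Q≡) (∸-monoʳ-< {o = 0} z<s (m^n>0 5 n))

    exponent< : ∀ {a} m → m ^ a ≤ Q → 5 ≤ m → a < n
    exponent< {a} m le 5≤m = ≰⇒> λ n≤a → <⇒≱ (≤-<-trans (m≤m*n Q 4) Q<5^n) (≤-trans (^-monoʳ-≤ 5 n≤a) (≤-trans (^-monoˡ-≤ a 5≤m) le))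

    -- The start of a bootstrap: 2n + 1 ≥ 5 gives 5^(κ+r) ≤ Q < 5^n and so n > κ + r ≥ 11; now 2n +
    -- 1 ≥ 25, which in turn gives n > 2 (κ + r).
    12≤n : 12 ≤ n
    12≤n = ≤-trans (s≤s (≤-trans r≥11 (m≤n+m r κ))) (exponent< (1 + 2 * n) size (s≤s (*-monoʳ-≤ 2 (ℕ.nonTrivial⇒n>1 n {{prime⇒nonTrivial pn}}))))

    25^T≤Q : 5 ^ T * 5 ^ T ≤ Q
    25^T≤Q = ≤-trans (≤-reflexive (trans (sym (^-distribˡ-* 5 5 T)) refl)) (≤-trans (^-monoˡ-≤ T (s≤s (*-monoʳ-≤ 2 12≤n))) size)
      where
      ^-distribˡ-* : ∀ a b k → (a * b) ^ k ≡ a ^ k * b ^ k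
      ^-distribˡ-* a b zero    = refl
      ^-distribˡ-* a b (suc k) = trans (cong (a * b *_) (^-distribˡ-* a b k)) (lemma a b (a ^ k) (b ^ k))
        where
        lemma : ∀ a b x y → a * b * (x * y) ≡ a * x * (b * y)
        lemma = solve-∀

    -- Makes the reciprocals of r primes, each at least 2n + 1, add up to at most 1/4.
    4r≤2n+1 : 4 * r ≤ 1 + 2 * n
    4r≤2n+1 = ≤-trans (≤-trans (≤-reflexive (lemma r)) (*-monoʳ-≤ 2 (≤-trans (+-mono-≤ (m≤n+m r κ) (m≤n+m r κ)) (<⇒≤ T+T<n)))) (n≤1+n (2 * n))
      where
      lemma : ∀ r → 4 * r ≡ 2 * (r + r)
      lemma = solve-∀
      T+T<n : T + T < n
      T+T<n = exponent< 5 (≤-trans (≤-reflexive (^-distribˡ-+-* 5 T T)) 25^T≤Q) ≤-refl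

    5^T≤2P : 5 ^ T ≤ 2 * P
    5^T≤2P = square-≤⇒≤ (*-cancelʳ-≤ _ _ 4 (begin
      5 ^ T * 5 ^ T * 4            ≤⟨ *-monoˡ-≤ 4 25^T≤Q ⟩
      Q * 4                        ≤⟨ <⇒≤ Q<5^n ⟩
      5 ^ n                        ≡⟨ cong (5 ^_) (suc-pred n) ⟨
      5 * 5 ^ pred n               ≡⟨ cong (5 *_) P² ⟨
      5 * (P * P)                  ≤⟨ *-monoˡ-≤ (P * P) (m≤m+n 5 11) ⟩
      16 * (P * P)                 ≡⟨ lemma P ⟩
      2 * P * (2 * P) * 4          ∎))
      where
      open ≤-Reasoning
      lemma : ∀ P → 16 * (P * P) ≡ 2 * P * (2 * P) * 4
      lemma = solve-∀

    -- Contradicts the sieve once δ ≥ 1/4 and δ + E ≤ r + 2, since it then gives P ≤ 8 W(k) (r + 2).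
    P-large : 8 * 2 ^ κ * (r + 2) < P
    P-large = *-cancelˡ-< 2 _ _ (begin-strict
      2 * (8 * 2 ^ κ * (r + 2))    ≡⟨ lemma (2 ^ κ) (r + 2) ⟩
      2 ^ κ * (16 * (r + 2))       <⟨ *-monoʳ-< (2 ^ κ) {{m^n≢0 2 κ}} (subst (λ x → 16 * (x + 2) < 5 ^ x) (m+[n∸m]≡n (≤-trans (m≤m+n 3 8) r≥11)) (16[r+2]<5^r (r ∸ 3))) ⟩
      2 ^ κ * 5 ^ r                ≤⟨ *-monoˡ-≤ (5 ^ r) (^-monoˡ-≤ κ (s≤s (s≤s z≤n))) ⟩
      5 ^ κ * 5 ^ r                ≡⟨ ^-distribˡ-+-* 5 κ r ⟨
      5 ^ T                        ≤⟨ 5^T≤2P ⟩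
      2 * P                        ∎)
      where
      open ≤-Reasoning
      lemma : ∀ w x → 2 * (8 * w * x) ≡ w * (16 * x)
      lemma = solve-∀

-- Assembly of the theorem: the contradiction for q ≥ 9 and for q = 5.

open import Defs
open SecondMoments
open PrimeKernels using (product-distinct-primes-∣; φ; φ>0)
open SievedSums
open FiniteFields
open PrimitiveElements
open TraceDistribution
open Rationals
open RationalSieve
open PrimeLists
open OrderOfFive
open import Algebra.Bundles using (CommutativeRing)
open import Data.Nat as ℕ using (ℕ; zero; suc; _≥_)
import Data.Nat.Properties as ℕ
import Data.Nat.Divisibility as ℕ
open import Data.Nat.Divisibility using (_∣_)
import Data.Nat.DivMod as ℕ
open import Data.Nat.Primality using (Prime; prime[2]; prime⇒nonZero; prime⇒nonTrivial; euclidsLemma; ¬prime[0])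
open import Data.Nat.Primality.Factorisation using (factorisationHasAllPrimeFactors)
open import Data.Nat.ListAction using (product)
open import Data.Nat.ListAction.Properties using (∈⇒∣product)
open import Data.Integer as ℤ using (ℤ; +_)
open import Data.Rational as ℚ using (ℚ; 0ℚ; 1ℚ; nonNegative)
open import Data.Rational.Properties as ℚ using ()
open import Data.Bool using (true; false)
open import Data.List using (List; []; _∷_; _++_; length; filter)
open import Data.List.Properties using (length-++; length-filter; filter-notAll)
open import Data.List.Relation.Unary.All as All using (All; []; _∷_)
import Data.List.Relation.Unary.All.Properties as All
open import Data.List.Relation.Unary.Any as Any using (here)
open import Data.List.Relation.Unary.AllPairs using ([]; _∷_)
open import Data.List.Relation.Unary.Unique.Propositional using (Unique)
open import Data.List.Relation.Unary.Unique.Propositional.Properties using () renaming (++⁺ to Unique-++⁺)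
open import Data.List.Membership.Propositional using (_∈_; _∉_)
open import Data.List.Membership.Propositional.Properties using (∈-++⁺ˡ; ∈-++⁺ʳ; ∈-++⁻)
open import Data.Product using (Σ; _×_; _,_; proj₂)
open import Data.Sum using (_⊎_; inj₁; inj₂; [_,_]′)
open import Data.Empty using (⊥; ⊥-elim)
open import Relation.Nullary using (¬_; Dec; yes; no)
open import Relation.Nullary.Decidable using (_×-dec_; ¬?; dec-true; dec-false)
open import Relation.Binary.PropositionalEquality as ≡ using (_≡_; _≢_; refl; sym; trans; cong; subst; subst₂)
import Data.Nat.Tactic.RingSolver as ℕR

Unique-++⁻ˡ : ∀ (xs : List ℕ) {ys} → Unique (xs ++ ys) → Unique xs
Unique-++⁻ˡ []       _        = []
Unique-++⁻ˡ (x ∷ xs) (a ∷ u) = All.++⁻ˡ xs a ∷ Unique-++⁻ˡ xs u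

Unique-++⁻ʳ : ∀ (xs : List ℕ) {ys} → Unique (xs ++ ys) → Unique ys
Unique-++⁻ʳ []       u       = u
Unique-++⁻ʳ (x ∷ xs) (_ ∷ u) = Unique-++⁻ʳ xs u

singleton : ∀ {x : ℕ} {xs} → x ∈ xs → All (_≡ x) xs → Unique xs → xs ≡ x ∷ []
singleton {xs = _ ∷ []}    _ (refl ∷ _)        _               = refl
singleton {xs = _ ∷ _ ∷ _} _ (refl ∷ refl ∷ _) ((ne ∷ _) ∷ _) = ⊥-elim (ne refl)

0<m*n⇒0<n : ∀ m {n} → 0 ℕ.< m ℕ.* n → 0 ℕ.< n
0<m*n⇒0<n m {zero}  h = ⊥-elim (ℕ.<-irrefl (sym (ℕ.*-zeroʳ m)) h)
0<m*n⇒0<n m {suc _} _ = ℕ.z<s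

module Core {c ℓ} (F : CommutativeRing c ℓ) {J n p e m Q k N : ℕ} (ff : IsFiniteFieldOfSize F (suc N))
  (size : suc N ≡ suc J ℕ.^ suc n) (pp : Prime p) (q≡ : suc J ≡ p ℕ.^ e) (J≡ : J ≡ m ℕ.* 4) (0<m : 0 ℕ.< m)
  (pn : Prime (suc n)) (n-odd : suc n ℕ.% 2 ≡ 1) (QJ≡N : Q ℕ.* J ≡ N)
  (β : CommutativeRing.Carrier F) (β∈ : InSubfield F (suc J) β) (β≉0 : ¬ CommutativeRing._≈_ F β (CommutativeRing.0# F))
  (ps₁ ps₂ : List ℕ) (pps : All Prime (ps₁ ++ ps₂)) (ups : Unique (ps₁ ++ ps₂)) (ps∤k : All (λ l → ¬ l ℕ.∣ k) (ps₁ ++ ps₂))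
  (rad≡ : rad N ≡ k ℕ.* product (ps₁ ++ ps₂)) (ps₁∣Q : All (ℕ._∣ Q) ps₁) (ps₂∤Q : All (λ l → ¬ l ℕ.∣ Q) ps₂)
  (0<δ : 0ℚ ℚ.< 1ℚ ℚ.- sumRecip (ps₁ ++ ps₂)) {T₀ : ℚ}
  (T₀≡ : (1ℚ ℚ.- sumRecip (ps₁ ++ ps₂)) ℚ.* T₀ ≡
    (1ℚ ℚ.+ 1ℚ) ℚ.* nat (W k) ℚ.* ((1ℚ ℚ.- sumRecip (ps₁ ++ ps₂)) ℚ.+ E (ps₁ ++ ps₂))
      ℚ.- nat (W (primePartIn k Q)) ℚ.* ((1ℚ ℚ.- sumRecip (ps₁ ++ ps₂)) ℚ.+ E ps₁))
  (hyp : GtSqrt2Times (nat (suc J ℕ.^ (n ℕ./ 2))) T₀) where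

  -- The degree is `suc n`, so n / 2 is half of the degree minus one. `H` is N / 2, the exponent of
  -- -1, in a form that shows it to be even.
  P H κ κQ W′ : ℕ
  P = suc J ℕ.^ (n ℕ./ 2)
  H = Q ℕ.* m ℕ.* 2
  ps Ls : List ℕ
  ps = ps₁ ++ ps₂
  Ls = primesDividing k
  κ = length Ls
  κQ = length (filter (λ l → l ℕ.∣? Q) Ls)
  W′ = 2 ℕ.^ κQ
  δ : ℚ
  δ = 1ℚ ℚ.- sumRecip ps

  0<J : 0 ℕ.< J
  0<J = subst (0 ℕ.<_) (sym J≡) (ℕ.*-mono-< {0} {m} {0} {4} 0<m ℕ.z<s)

  N≡ : N ≡ suc J ℕ.^ suc n ℕ.∸ 1
  N≡ = cong (ℕ._∸ 1) size

  0<N : 0 ℕ.< N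
  0<N = ℕ.≤-pred (subst (1 ℕ.<_) (sym size) (ℕ.<-≤-trans (ℕ.s<s 0<J) (ℕ.m≤m*n (suc J) (suc J ℕ.^ n) {{ℕ.m^n≢0 (suc J) n}})))

  0<Q : 0 ℕ.< Q
  0<Q = 0<m*n⇒0<n J (subst (0 ℕ.<_) (trans (sym QJ≡N) (ℕ.*-comm Q J)) 0<N)

  2∤n : ¬ 2 ℕ.∣ suc n
  2∤n = odd⇒2∤ (suc n) n-odd

  2∤Q : ¬ 2 ℕ.∣ Q
  2∤Q = quotient-odd 0<J (subst (2 ℕ.∣_) (sym J≡) (ℕ.∣n⇒∣m*n m (ℕ.divides 2 refl))) 2∤n (trans QJ≡N N≡)

  N≡H+H : N ≡ H ℕ.+ H
  N≡H+H = trans (sym QJ≡N) (trans (cong (Q ℕ.*_) J≡) (lemma Q m))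
    where
    lemma : ∀ Q m → Q ℕ.* (m ℕ.* 4) ≡ Q ℕ.* m ℕ.* 2 ℕ.+ Q ℕ.* m ℕ.* 2
    lemma = ℕR.solve-∀

  2∣H : 2 ℕ.∣ H
  2∣H = ℕ.n∣m*n (Q ℕ.* m)

  2∣N : 2 ℕ.∣ N
  2∣N = subst (2 ℕ.∣_) (sym N≡H+H) (ℕ.∣m∣n⇒∣m+n 2∣H 2∣H)

  0<k : 0 ℕ.< k
  0<k = 0<m*n⇒0<n (product ps) (subst (0 ℕ.<_) (trans rad≡ (ℕ.*-comm k (product ps))) (rad>0 N))

  pL : All Prime Ls
  pL = primesDividing-prime k

  L∣N : All (ℕ._∣ N) Ls
  L∣N = All.tabulate λ i → let pl , l∣k = ∈-primesDividing⁻ k i in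
    prime∣rad⇒∣ N pl (subst (_ ℕ.∣_) (sym rad≡) (ℕ.∣m⇒∣m*n (product ps) l∣k))

  ps∣N : All (ℕ._∣ N) ps
  ps∣N = All.tabulate λ i → prime∣rad⇒∣ N (All.lookup pps i) (subst (_ ℕ.∣_) (sym rad≡) (ℕ.∣n⇒∣m*n k (∈⇒∣product i)))

  disjoint : ∀ {l} → l ∈ Ls → l ∉ ps
  disjoint i j = All.lookup ps∤k j (proj₂ (∈-primesDividing⁻ k i))

  covered : ∀ {l} → Prime l → l ℕ.∣ N → l ∈ Ls ++ ps
  covered {l} pl l∣N = [ (λ d → ∈-++⁺ˡ (∈-primesDividing⁺ k 0<k pl d)) , (λ d → ∈-++⁺ʳ Ls (factorisationHasAllPrimeFactors pl d pps)) ]′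
    (euclidsLemma k (product ps) pl (subst (l ℕ.∣_) rad≡ (prime∣⇒∣rad N 0<N pl l∣N)))

  open CommutativeRing F using (_≈_; _*_; *-identityʳ) renaming (trans to ≈-trans; sym to ≈-sym)
  open FiniteField F ff using (_^_; ^-+)
  open Generator F ff using (module Log)
  open Log 0<N using (g; g^-free)
  module TF = TraceField F ff 0<N {p} {e} {J} {n} {Q} pp q≡ size 0<J QJ≡N β β∈ β≉0
  open TraceData TF.traceData using (w)

  Good : ℕ → Set
  Good a = w 0 (a ℕ.+ a) ≡ ℤ.1ℤ × All (λ l → ¬ l ℕ.∣ a) (Ls ++ ps)

  good? : ∀ a → Dec (Good a)
  good? a = (w 0 (a ℕ.+ a) ℤ.≟ ℤ.1ℤ) ×-dec All.all? (λ l → ¬? (l ℕ.∣? a)) (Ls ++ ps)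

  good⇒solution : ∀ {a} → Good a → Σ (CommutativeRing.Carrier F) λ ξ → Free F N ξ × Tr F (suc J) (suc n) (ξ * ξ) ≈ β
  good⇒solution {a} (w≡1 , avoids) = g ^ a , g^-free (λ pl l∣N → All.lookup avoids (covered pl l∣N)) ,
    ≈-trans (TF.tr-cong (suc n) (≈-sym (^-+ g a a))) (≈-trans (TF.w≡1⇒ 0 (a ℕ.+ a) w≡1) (*-identityʳ β))

  module _ (none : ∀ a → a ℕ.< N → ¬ Good a) where
    module _ (u t : ℕ) (v²≤u²q : (u ℕ.+ t) ℕ.* (u ℕ.+ t) ℕ.≤ u ℕ.* u ℕ.* suc J) where
      private
        v = u ℕ.+ t
        module S = Sieve {P = P} {H = H} {u = u} {v = v} TF.traceData (square-of-half-power (suc J) n n-odd) N≡H+H 2∣H 2∤Q v²≤u²q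
        none′ : ∀ a → a ℕ.< N → w 0 (a ℕ.+ a) ≡ ℤ.1ℤ → All (λ l → ¬ l ℕ.∣ a) (Ls ++ ps) → ⊥
        none′ a a<N w≡1 av = none a a<N (w≡1 , av)
        adL : All Prime Ls × Unique Ls × All (ℕ._∣ N) Ls
        adL = pL , primesDividing-unique k , L∣N
        ad₁ : ∀ {l} → l ∈ ps → S.AdmissibleOver Ls (l ∷ [])
        ad₁ i = S.admissibleOver adL (All.lookup pps i ∷ [] , [] ∷ [] , All.lookup ps∣N i ∷ []) λ { j (here refl) → disjoint j i }
        bound : ∀ {l} → l ∈ ps → _
        bound {l} i = S.Jp-bound Ls ps pL pps TF.w01 none′ l {{prime⇒nonZero (All.lookup pps i)}} (ad₁ i)

      inequality : δ ℚ.* ((nat u ℚ.+ nat t) ℚ.* nat P ℚ.+ nat u) ℚ.+ nat t ℚ.* nat W′ ℚ.* (δ ℚ.+ E ps₁)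
        ℚ.≤ (1ℚ ℚ.+ 1ℚ) ℚ.* (nat u ℚ.+ nat t) ℚ.* nat (W k) ℚ.* (δ ℚ.+ E ps₁ ℚ.+ E ps₂)
      inequality = sieved {u} {t} {v} {P} {φ Ls ℕ.* P} {S.bnd true Ls} {S.bnd false Ls} {W k} {W′}
        {S.G Ls []} {S.Jp Ls ps pL pps TF.w01 none′} (λ l → S.bnd (S.flag l) Ls) ps₁ ps₂ pps 0<δ
        (ℕ.*-mono-< (φ>0 pL) (ℕ.m^n>0 (suc J) (n ℕ./ 2)))
        (S.sieve Ls ps pL pps TF.w01 none′)
        (All.tabulate bound)
        (S.G-lower Ls (S.admissibleOver adL ([] , [] , []) λ _ ()))
        (All.map (λ {l} d → cong (λ b → S.bnd b Ls) (dec-true (l ℕ.∣? Q) d)) ps₁∣Q)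
        (All.map (λ {l} d → cong (λ b → S.bnd b Ls) (dec-false (l ℕ.∣? Q) d)) ps₂∤Q)
        refl (S.bnd-true refl Ls) (S.bnd-false Ls)

    κQ≤κ : κQ ℕ.≤ κ
    κQ≤κ = length-filter (λ l → l ℕ.∣? Q) Ls

    0<W′ : 0ℚ ℚ.< nat W′
    0<W′ = nat-pos (ℕ.m^n>0 2 κQ)

    0≤E₁ : 0ℚ ℚ.≤ E ps₁
    0≤E₁ = E-nonNeg (All.++⁻ˡ ps₁ pps)

    0≤E₂ : 0ℚ ℚ.≤ E ps₂
    0≤E₂ = E-nonNeg (All.++⁻ʳ ps₁ pps)

    0≤Y : 0ℚ ℚ.≤ δ ℚ.+ E ps₁
    0≤Y = 0≤-+ (ℚ.<⇒≤ 0<δ) 0≤E₁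

    T₁≤ : (1ℚ ℚ.+ 1ℚ) ℚ.* nat (W k) ℚ.* (δ ℚ.+ E ps₁ ℚ.+ E ps₂) ℚ.- nat W′ ℚ.* (δ ℚ.+ E ps₁) ℚ.≤ δ ℚ.* T₀
    T₁≤ = subst₂ ℚ._≤_ (cong (λ x → (1ℚ ℚ.+ 1ℚ) ℚ.* nat (W k) ℚ.* x ℚ.- nat W′ ℚ.* (δ ℚ.+ E ps₁)) X≡) (sym T₀≡)
      (ℚ.+-monoʳ-≤ ((1ℚ ℚ.+ 1ℚ) ℚ.* nat (W k) ℚ.* (δ ℚ.+ E ps)) (ℚ.neg-antimono-≤ (ℚ.*-monoʳ-≤-nonNeg (δ ℚ.+ E ps₁) {{nonNegative 0≤Y}} (nat-mono (W-primePartIn≤ k Q)))))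
      where
      X≡ : δ ℚ.+ E ps ≡ δ ℚ.+ E ps₁ ℚ.+ E ps₂
      X≡ = trans (cong (δ ℚ.+_) (E-++ ps₁ ps₂)) (sym (ℚ.+-assoc δ (E ps₁) (E ps₂)))

    inequality′ : ∀ u t → (u ℕ.+ t) ℕ.* (u ℕ.+ t) ℕ.≤ u ℕ.* u ℕ.* suc J → ∀ {x y} → x ≡ nat u → y ≡ nat t →
      δ ℚ.* ((x ℚ.+ y) ℚ.* nat P ℚ.+ x) ℚ.+ y ℚ.* nat W′ ℚ.* (δ ℚ.+ E ps₁)
        ℚ.≤ (1ℚ ℚ.+ 1ℚ) ℚ.* (x ℚ.+ y) ℚ.* nat (W k) ℚ.* (δ ℚ.+ E ps₁ ℚ.+ E ps₂)
    inequality′ u t v²≤ refl refl = inequality u t v²≤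

    large : 8 ℕ.≤ J → ⊥
    large 8≤J = C.refute (ℚ.positive⁻¹ ((+ 1 ℚ./ 1) ℚ.+ (+ 2 ℚ./ 1))) (large-q (ℚ.<⇒≤ C.0<W′Y) C.W′Y≤T₁)
      where
      -- u = 1 and t = 2, so v = 3, and v² = 9 ≤ q.
      module C = Contradiction 0<δ (nat-nonNeg P) 0<W′ (nat-mono (ℕ.^-monoʳ-≤ 2 κQ≤κ)) 0≤E₁ 0≤E₂ 0≤[ + 1 ℚ./ 1 ] 0≤[ + 2 ℚ./ 1 ] T₁≤ hyp
        (inequality′ 1 2 (subst (9 ℕ.≤_) (sym (ℕ.+-identityʳ (suc J))) (ℕ.s≤s 8≤J)) (/1≡ι (+ 1)) (/1≡ι (+ 2)))

    module Small (J≡4 : J ≡ 4) where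
      -- u = 56 and t = 69, so v = 125: the ratio 0.448 lies just above 5^(-1/2) = 0.4472..., as
      -- 125² = 15625 ≤ 15680 = 5 · 56².
      module C = Contradiction 0<δ (nat-nonNeg P) 0<W′ (nat-mono (ℕ.^-monoʳ-≤ 2 κQ≤κ)) 0≤E₁ 0≤E₂ 0≤[ + 56 ℚ./ 1 ] 0≤[ + 69 ℚ./ 1 ] T₁≤ hyp
        (inequality′ 56 69 (subst (λ j → 125 ℕ.* 125 ℕ.≤ 56 ℕ.* 56 ℕ.* suc j) (sym J≡4) (ℕ.≤ᵇ⇒≤ (125 ℕ.* 125) (56 ℕ.* 56 ℕ.* 5) _)) (/1≡ι (+ 56)) (/1≡ι (+ 69)))

      0<v : 0ℚ ℚ.< (+ 56 ℚ./ 1) ℚ.+ (+ 69 ℚ./ 1)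
      0<v = ℚ.positive⁻¹ ((+ 56 ℚ./ 1) ℚ.+ (+ 69 ℚ./ 1))

      prime∣N⇒ : ∀ {l} → Prime l → l ℕ.∣ N → l ℕ.∣ Q ⊎ l ≡ 2
      prime∣N⇒ {l} pl d = [ inj₁ , (λ d′ → inj₂ (prime∣4⇒≡2 pl (subst (l ℕ.∣_) J≡4 d′))) ]′ (euclidsLemma Q J pl (subst (l ℕ.∣_) (sym QJ≡N) d))

      2∈Ls : 2 ∈ Ls → ⊥
      2∈Ls i = C.refute 0<v (small-q-even (ℚ.<⇒≤ C.0<W′Y) (C.T₁≥3 (subst (ℚ._≤ nat (W k)) (trans (nat-* 2 W′) (cong (ℚ._* nat W′) 2ℚ)) (nat-mono (ℕ.^-monoʳ-≤ 2 κQ<κ)))))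
        where
        κQ<κ : κQ ℕ.< κ
        κQ<κ = filter-notAll (λ l → l ℕ.∣? Q) Ls (Any.map (λ { refl → 2∤Q }) i)

      module _ (2∈ps₂ : 2 ∈ ps₂) where
        r : ℕ
        r = length ps₁

        few : r ℕ.≤ 10 → ⊥
        few r≤10 = C.refute 0<v (small-q-few (ℚ.<⇒≤ 0<W′) (C.T₁≥V (E-∈ (All.++⁻ʳ ps₁ pps) 2∈ps₂))
          (2[δ+E]≤21 (recip-∈ (∈-++⁺ʳ ps₁ 2∈ps₂)) (ℚ.≤-trans (E≤length ps₁) (subst (nat r ℚ.≤_) (sym (/1≡ι (+ 10))) (nat-mono r≤10)))))

        -- With 2 among `ps₂`, all primes of `Ls` and `ps₁` are distinct divisors of Q, so κ + r
        -- factors that are large compared with the degree fit into Q. As `ps₂` consists of 2 alone,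
        -- δ ≥ 1/4 follows, and the sieve bound on P contradicts `P-large`.
        many : 11 ℕ.≤ r → ⊥
        many r≥11 = ℕ.<⇒≱ (P-large {κ = κ} {r = r} pn Q≡ P² r≥11 size₅) (nat-cancel (subst (nat P ℚ.≤_) nat-eq
          (weak-bound 0<W (C.sieved-weak 0<v) δ≥¼ X≤ (nat-nonNeg P))))
          where
          Q≡ : Q ℕ.* 4 ≡ 5 ℕ.^ suc n ℕ.∸ 1
          Q≡ = subst (λ j → Q ℕ.* j ≡ suc j ℕ.^ suc n ℕ.∸ 1) J≡4 (trans QJ≡N N≡)
          P² : P ℕ.* P ≡ 5 ℕ.^ n
          P² = trans (sym (square-of-half-power (suc J) n n-odd)) (cong (λ j → suc j ℕ.^ n) J≡4)
          0<W = nat-pos (ℕ.m^n>0 2 κ)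
          L∣Q : All (ℕ._∣ Q) Ls
          L∣Q = All.tabulate λ i → [ (λ d → d) , (λ { refl → ⊥-elim (disjoint i (∈-++⁺ʳ ps₁ 2∈ps₂)) }) ]′ (prime∣N⇒ (All.lookup pL i) (All.lookup L∣N i))
          pps₁ = All.++⁻ˡ ps₁ pps
          big : ∀ {l} → Prime l → l ℕ.∣ Q → 1 ℕ.+ 2 ℕ.* suc n ℕ.≤ l
          big = prime-divisor-bound pn 2∤n Q≡ 2∤Q
          size₅ : (1 ℕ.+ 2 ℕ.* suc n) ℕ.^ (κ ℕ.+ r) ℕ.≤ Q
          size₅ = ℕ.≤-trans (subst (λ x → (1 ℕ.+ 2 ℕ.* suc n) ℕ.^ x ℕ.≤ product (Ls ++ ps₁)) (length-++ Ls)
              (^-length≤product (All.zipWith (λ (pl , d) → big pl d) (All.++⁺ pL pps₁ , All.++⁺ L∣Q ps₁∣Q))))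
            (ℕ.∣⇒≤ {{ℕ.>-nonZero 0<Q}} (product-distinct-primes-∣ (All.++⁺ pL pps₁)
              (Unique-++⁺ (primesDividing-unique k) (Unique-++⁻ˡ ps₁ ups) λ (i , j) → disjoint i (∈-++⁺ˡ j)) (All.++⁺ L∣Q ps₁∣Q)))
          ps₂≡ : ps₂ ≡ 2 ∷ []
          ps₂≡ = singleton 2∈ps₂ (All.tabulate λ i → [ (λ d → ⊥-elim (All.lookup ps₂∤Q i d)) , (λ l≡2 → l≡2) ]′
            (prime∣N⇒ (All.lookup pps (∈-++⁺ʳ ps₁ i)) (All.lookup ps∣N (∈-++⁺ʳ ps₁ i)))) (Unique-++⁻ʳ ps₁ ups)
          4r≤ : All (4 ℕ.* r ℕ.≤_) ps₁
          4r≤ = All.zipWith (λ (pl , d) → ℕ.≤-trans (4r≤2n+1 {P = P} {κ = κ} {r = r} pn Q≡ P² r≥11 size₅) (big pl d)) (pps₁ , ps₁∣Q)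
          δ≥¼ : (+ 1 ℚ./ 4) ℚ.≤ δ
          δ≥¼ = quarter (trans (sumRecip-++ ps₁ ps₂) (cong (λ xs → sumRecip ps₁ ℚ.+ sumRecip xs) ps₂≡))
            (nat-pos (ℕ.≤-trans (ℕ.s≤s ℕ.z≤n) r≥11)) (subst (λ x → x ℚ.* sumRecip ps₁ ℚ.≤ nat r) (trans (nat-* 4 r) (cong (ℚ._* nat r) (sym (/1≡ι (+ 4))))) (sumRecip-bound pps₁ 4r≤))
          X≤ : δ ℚ.+ E ps₁ ℚ.+ E ps₂ ℚ.≤ nat (r ℕ.+ 2)
          X≤ = total≤ (sumRecip-nonNeg ps) (E≤length ps₁) (ℚ.≤-trans (E≤length ps₂) (ℚ.≤-reflexive (trans (cong (λ xs → nat (length xs)) ps₂≡) ι-1)))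
          nat-eq : (+ 8 ℚ./ 1) ℚ.* nat (W k) ℚ.* nat (r ℕ.+ 2) ≡ nat (8 ℕ.* 2 ℕ.^ κ ℕ.* (r ℕ.+ 2))
          nat-eq = sym (trans (nat-* (8 ℕ.* 2 ℕ.^ κ) (r ℕ.+ 2)) (cong (ℚ._* nat (r ℕ.+ 2)) (trans (nat-* 8 (2 ℕ.^ κ)) (cong (ℚ._* nat (W k)) (sym (/1≡ι (+ 8)))))))

        2∈ps₂⇒⊥ : ⊥
        2∈ps₂⇒⊥ with r ℕ.≤? 10
        ... | yes r≤10 = few r≤10
        ... | no  r≰10 = many (ℕ.≰⇒> r≰10)

      small : ⊥
      small = [ 2∈Ls , (λ i → [ (λ j → 2∤Q (All.lookup ps₁∣Q j)) , 2∈ps₂⇒⊥ ]′ (∈-++⁻ ps₁ i)) ]′ (∈-++⁻ Ls (covered prime[2] 2∣N))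

    no-solution⇒⊥ : ⊥
    no-solution⇒⊥ = split m J≡ 0<m
      where
      split : ∀ m → J ≡ m ℕ.* 4 → 0 ℕ.< m → ⊥
      -- q - 1 = 4m: the value m = 1 is q = 5, and m ≥ 2 means q ≥ 9.
      split 1             J≡4 _ = Small.small J≡4
      split (suc (suc m)) J≡  _ = large (subst (8 ℕ.≤_) (sym J≡) (ℕ.s≤s (ℕ.s≤s (ℕ.s≤s (ℕ.s≤s (ℕ.s≤s (ℕ.s≤s (ℕ.s≤s (ℕ.s≤s ℕ.z≤n)))))))))

  solution : Σ (CommutativeRing.Carrier F) λ ξ → Free F N ξ × Tr F (suc J) (suc n) (ξ * ξ) ≈ β
  solution = search (ℕ.anyUpTo? good? N)
    where
    search : Dec (Σ ℕ λ a → a ℕ.< N × Good a) → Σ (CommutativeRing.Carrier F) λ ξ → Free F N ξ × Tr F (suc J) (suc n) (ξ * ξ) ≈ β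
    search (yes (a , _ , good)) = good⇒solution good
    search (no none)            = ⊥-elim (no-solution⇒⊥ λ a a<N good → none (a , a<N , good))

theorem6p6 : ∀ {c ℓ} (F : CommutativeRing c ℓ) (q p e n Q k : ℕ) (ps₁ ps₂ : List ℕ)
    → Prime p → e ≥ 1 → q ≡ p ℕ.^ e → q ℕ.% 4 ≡ 1
    → Prime n → n ℕ.% 2 ≡ 1
    → IsFiniteFieldOfSize F (q ℕ.^ n)
    → Q ℕ.* (q ℕ.∸ 1) ≡ q ℕ.^ n ℕ.∸ 1
    → (β : CommutativeRing.Carrier F)
    → InSubfield F q β → ¬ CommutativeRing._≈_ F β (CommutativeRing.0# F)
    → All Prime (ps₁ ++ ps₂) → Unique (ps₁ ++ ps₂)
    → All (λ p′ → ¬ p′ ∣ k) (ps₁ ++ ps₂)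
    → rad (q ℕ.^ n ℕ.∸ 1) ≡ k ℕ.* product (ps₁ ++ ps₂)
    → All (λ p′ → p′ ∣ Q) ps₁ → All (λ p′ → ¬ p′ ∣ Q) ps₂
    → (δpos : 0ℚ ℚ.< 1ℚ ℚ.- sumRecip (ps₁ ++ ps₂))
    → GtSqrt2Times
    (+ (q ℕ.^ ((n ℕ.∸ 1) ℕ./ 2)) ℚ./ 1)
    (((+ 2 ℚ./ 1) ℚ.* ((((+ length (ps₁ ++ ps₂) ℚ./ 1) ℚ.- 1ℚ) ℚ.÷ (1ℚ ℚ.- sumRecip (ps₁ ++ ps₂)))
    {{ℚ.>-nonZero δpos}} ℚ.+ (+ 2 ℚ./ 1)) ℚ.* (+ W k ℚ./ 1))
    ℚ.- ((((((+ length ps₁ ℚ./ 1) ℚ.- 1ℚ) ℚ.+ (1ℚ ℚ.- sumRecip ps₁)) ℚ.÷ (1ℚ ℚ.- sumRecip (ps₁ ++ ps₂)))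
    {{ℚ.>-nonZero δpos}} ℚ.+ 1ℚ) ℚ.* (+ W (primePartIn k Q) ℚ./ 1)))
    → Σ (CommutativeRing.Carrier F) (λ ξ →
    Free F (q ℕ.^ n ℕ.∸ 1) ξ
    × CommutativeRing._≈_ F (Tr F q n (CommutativeRing._*_ F ξ ξ)) β)
theorem6p6 F zero p e n Q k ps₁ ps₂ pp e≥1 q≡ ()
theorem6p6 F (suc J) p e zero Q k ps₁ ps₂ pp e≥1 q≡ q%4 pn = ⊥-elim (¬prime[0] pn)
theorem6p6 F (suc J) p e (suc n) Q k ps₁ ps₂ pp e≥1 q≡ q%4 pn n-odd ff QJ≡N β β∈ β≉0 pps ups ps∤k rad≡ ps₁∣Q ps₂∤Q δpos hyp =
  Core.solution F {e = e} {m = suc J ℕ./ 4} (subst (IsFiniteFieldOfSize F) (sym size) ff) size pp q≡ J≡ 0<m pn n-odd QJ≡N β β∈ β≉0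
    ps₁ ps₂ pps ups ps∤k rad≡ ps₁∣Q ps₂∤Q δpos
    (cleared (length (ps₁ ++ ps₂)) (length ps₁) (W k) (W (primePartIn k Q)) δpos refl)
    (subst (λ x → GtSqrt2Times x _) (/1≡ι (+ (suc J ℕ.^ (n ℕ./ 2)))) hyp)
  where
  size : suc (suc J ℕ.^ suc n ℕ.∸ 1) ≡ suc J ℕ.^ suc n
  size = ℕ.m+[n∸m]≡n (ℕ.m^n>0 (suc J) (suc n))
  J≡ : J ≡ suc J ℕ./ 4 ℕ.* 4
  J≡ = ℕ.suc-injective (trans (ℕ.m≡m%n+[m/n]*n (suc J) 4) (cong (ℕ._+ suc J ℕ./ 4 ℕ.* 4) q%4))
  1<q : 1 ℕ.< suc J
  1<q = subst (1 ℕ.<_) (sym q≡) (ℕ.<-≤-trans (ℕ.nonTrivial⇒n>1 p {{prime⇒nonTrivial pp}})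
    (subst (ℕ._≤ p ℕ.^ e) (ℕ.*-identityʳ p) (ℕ.^-monoʳ-≤ p {{prime⇒nonZero pp}} e≥1)))
  0<m : 0 ℕ.< suc J ℕ./ 4
  0<m = ℕ.n≢0⇒n>0 λ m≡0 → ℕ.<-irrefl (cong suc (sym (trans J≡ (cong (ℕ._* 4) m≡0)))) 1<q
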